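{- For all integers $k\ge 1$ and $n\ge 3$, $$(n-1)k+n+1\le GR_k(C_{2n})\le (n-1)k+2n+2.$$
   Context: A Gallai coloring of a complete graph is an edge-coloring with no rainbow triangle (a triangle whose three edges receive three distinct colors); a Gallai $k$-coloring is a Gallai coloring using $k$ colors. For a graph $H$ and integer $k\ge1$, the Gallai-Ramsey number $GR_k(H)$ is the least positive integer $N$ such that every Gallai $k$-coloring of the complete graph $K_N$ contains a monochromatic copy of $H$. $C_m$ denotes the cycle on $m$ vertices. -}

module Defs where

open import Data.Nat using (ℕ; zero; suc; _≤_)
open import Data.Fin using (Fin; toℕ)
open import Data.Product using (Σ; _×_; ∃)
open import Data.Sum using (_⊎_)
open import Relation.Binary.PropositionalEquality using (_≡_; _≢_)
open import Relation.Nullary using (¬_)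
open import Function.Definitions using (Injective)

-- An edge-colouring of the complete graph K_N with k colours
-- (vertices Fin N, colours Fin k).  The value c i i is irrelevant
-- (there are no loops); symmetry makes it a colouring of undirected edges.
record Colouring (N k : ℕ) : Set where
  field
    col : Fin N → Fin N → Fin k
    sym : ∀ i j → col i j ≡ col j i
open Colouring public

RainbowTriangle : ∀ {N k} → Colouring N k → Set
RainbowTriangle {N} c =
  Σ (Fin N) λ x → Σ (Fin N) λ y → Σ (Fin N) λ z →
    (x ≢ y) × (y ≢ z) × (x ≢ z) ×
    (col c x y ≢ col c y z) × (col c y z ≢ col c x z) × (col c x y ≢ col c x z)

Gallai : ∀ {N k} → Colouring N k → Set
Gallai c = ¬ RainbowTriangle c

CycleAdj : (m : ℕ) → Fin m → Fin m → Set
CycleAdj m i j = (suc (toℕ i) ≡ toℕ j) ⊎ ((suc (toℕ i) ≡ m) × (toℕ j ≡ 0))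

HasMonoCycle : ∀ {N k} → (m : ℕ) → Colouring N k → Set
HasMonoCycle {N} {k} m c =
  Σ (Fin m → Fin N) λ v → Injective _≡_ _≡_ v ×
    Σ (Fin k) λ r → ∀ i j → CycleAdj m i j → col c (v i) (v j) ≡ r

Arrows : (N k m : ℕ) → Set
Arrows N k m = (c : Colouring N k) → Gallai c → HasMonoCycle m c

IsGRCycle : (k m N : ℕ) → Set
IsGRCycle k m N =
  (1 ≤ N) × Arrows N k m × (∀ M → 1 ≤ M → Arrows M k m → N ≤ M)

-- Upper bound. Suppose that there is no monochromatic C_2n. A Gallai colouring has a partition into modules between
-- which at most two colours r, b occur. As long as some module has at least n vertices, keep only such a module; every
-- vertex left out is joined to the kept ones in a single colour, and by K_{n,n} fewer than n vertices are left out
-- for each colour. In the end all modules have fewer than n vertices, and at least 4n − t_r − t_b vertices are kept,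
-- where t_i vertices were left out for colour i. If t_r ≥ max(1, t_b), depth-first search in colour r yields either two
-- n-sets without an edge of colour r between them, hence a C_2n of colour b by an Ore-type rotation argument, or a
-- long path of colour r, which is closed through the left-out vertices. If t_r = t_b = 0, then at least 4n vertices are
-- kept, and every module has at least 2n neighbours in one of the two colours; its inner edges may be recoloured with
-- that colour. Take a longest monochromatic cycle with as few inner edges as possible. It has none at all. If it
-- has fewer than 2n vertices, the components of its colour outside of it give a longer cycle of the other
-- colour. If it is even, it can be shortened by chords until a C_2n appears in one of the colours. If it is odd, walking
-- around it in steps of two gives, after contracting steps inside modules and using outside vertices instead, a longer
-- cycle of the other colour.
--
-- Lower bound. An edge is coloured by the block of its larger end, for a first block of 2n − 1 vertices and
-- k − 1 further blocks of n − 1 vertices: a monochromatic C_2n would need n of its vertices in a later block.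
module Submission where

open import Defs renaming (sym to col-sym)
open import Data.Nat hiding (_≟_; parity)
open import Data.Nat.Properties hiding (_≟_)
open import Data.Nat.DivMod using (_/_; _%_; m<n*o⇒m/o<n; m/n≡0⇒m<n; m%n<n; m≡m%n+[m/n]*n; 0/n≡0)
open import Data.Nat.Tactic.RingSolver using (solve-∀; solve)
open import Data.Bool using (Bool; true; false; not; if_then_else_; _∧_)
import Data.Bool as Bool
open import Data.Fin using (Fin; toℕ; fromℕ<)
import Data.Fin as Fin
import Data.Fin.Properties as Finₚ
open import Data.List using (List; initLast; _∷ʳ′_; []; _∷_; _++_; length; reverse; filterᵇ; lookup; allFin; map; tabulate)
open import Data.List.Properties using (unfold-reverse; length-++; ++-assoc; ++-identityʳ; length-map; length-tabulate; map-tabulate; map-id; ∷-injectiveˡ; ∷-injectiveʳ; ∷ʳ-injectiveˡ; ∷ʳ-injectiveʳ)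
open import Data.Product using (Σ; _×_; _,_; proj₁; proj₂; ∃; Σ-syntax)
open import Data.Sum using (_⊎_; inj₁; inj₂; [_,_]′)
open import Data.Empty using (⊥; ⊥-elim)
open import Data.Unit using (⊤; tt)
open import Relation.Nullary using (¬_; Dec; yes; no; does; ¬?)
open import Relation.Nullary.Decidable using (_×-dec_; _⊎-dec_; decidable-stable; dec-true; dec-false)
open import Relation.Binary.PropositionalEquality using (_≡_; _≢_; refl; sym; trans; cong; cong₂; subst; subst₂; module ≡-Reasoning)
open import Function using (_∘_; id; case_of_)
open import Function.Definitions using (Injective)
import Data.Nat.Properties as ℕₚ
open import Data.Vec using (Vec) renaming ([] to ε; _∷_ to _▸_)
import Data.Vec as Vec
open import Data.Vec.Functional using () renaming (_∷_ to _◂_)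

-- Counting and closed chains

-- The constant 2n + 2 comes from the two colours `r`, `b` of a partition: each other colour
-- accounts for at most n - 1 left-out vertices, and (n - 1)k + 2n + 2 - (n - 1)(k - 2) = 4n. The
-- number 4n is what the two-coloured core needs. Edges inside a module may have any colour, so a
-- longest-cycle argument has no complete two-coloured graph to work in until they are recoloured;
-- but a cycle through a recoloured edge is not a cycle of the given colouring. Hence the two
-- relations `E` (after recolouring) and `Real` (between different modules), and the second
-- optimisation after the length. The degree 2n in the colour given to a module pays for it: on a
-- cycle with at most 4n vertices, 2n neighbours of a vertex next to one of its twins cannot all be
-- placed without two consecutive ones. A single inner colour per module keeps its vertices
-- interchangeable towards all vertices, so that one may replace another on a cycle. That 4n is even
-- matters too: an odd cycle misses some vertex.

b2n : Bool → ℕ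
b2n true  = 1
b2n false = 0

count : {A : Set} → (A → Bool) → List A → ℕ
count p []       = 0
count p (x ∷ xs) = b2n (p x) + count p xs

count-++ : {A : Set} (p : A → Bool) (xs ys : List A) → count p (xs ++ ys) ≡ count p xs + count p ys
count-++ p []       ys = refl
count-++ p (x ∷ xs) ys rewrite count-++ p xs ys = sym (+-assoc (b2n (p x)) (count p xs) (count p ys))

count-rev : {A : Set} (p : A → Bool) (xs : List A) → count p (reverse xs) ≡ count p xs
count-rev p [] = refl
count-rev p (x ∷ xs) rewrite unfold-reverse x xs | count-++ p (reverse xs) (x ∷ []) | count-rev p xs
                           | +-identityʳ (b2n (p x)) = +-comm (count p xs) (b2n (p x))

count-true : {A : Set} (xs : List A) → count (λ _ → true) xs ≡ length xs
count-true []       = refl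
count-true (x ∷ xs) = cong suc (count-true xs)

infix 4 _≋_ _⊑_

-- Multiset equality, and below multiset inclusion, tested by every Boolean predicate. The constant
-- predicate yields lengths and `v ==_` multiplicities, so rearranged cycles need no explicit
-- permutations.
record _≋_ {A : Set} (xs ys : List A) : Set where
  constructor ≋!
  field ≋at : ∀ p → count p xs ≡ count p ys
open _≋_ public

record _⊑_ {A : Set} (xs ys : List A) : Set where
  constructor ⊑!
  field ⊑at : ∀ p → count p xs ≤ count p ys
open _⊑_ public

≋⇒⊑ : {A : Set} {xs ys : List A} → xs ≋ ys → xs ⊑ ys
≋⇒⊑ h = ⊑! λ p → ≤-reflexive (≋at h p)

≋-length : {A : Set} {xs ys : List A} → xs ≋ ys → length xs ≡ length ys
≋-length {xs = xs} {ys} h = trans (sym (count-true xs)) (trans (≋at h _) (count-true ys))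

count-≤-length : {A : Set} (p : A → Bool) (xs : List A) → count p xs ≤ length xs
count-≤-length p [] = z≤n
count-≤-length p (x ∷ xs) with p x
... | true  = s≤s (count-≤-length p xs)
... | false = m≤n⇒m≤1+n (count-≤-length p xs)

count-split : {A : Set} (p : A → Bool) (xs : List A) → 1 ≤ count p xs →
  Σ[ ys ∈ List A ] Σ[ v ∈ A ] Σ[ zs ∈ List A ] (xs ≡ ys ++ v ∷ zs × p v ≡ true)
count-split p (x ∷ xs) h with p x in eq
... | true  = [] , x , xs , refl , eq
... | false with count-split p xs h
...   | ys , v , zs , e , pv = x ∷ ys , v , zs , cong (x ∷_) e , pv

count-mono : {A : Set} (p q : A → Bool) (xs : List A) → (∀ x → p x ≡ true → q x ≡ true) → count p xs ≤ count q xs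
count-mono p q []       h = z≤n
count-mono p q (x ∷ xs) h with p x in e | q x in e′
... | true  | true  = s≤s (count-mono p q xs h)
... | true  | false = case trans (sym (h x e)) e′ of λ ()
... | false | true  = m≤n⇒m≤1+n (count-mono p q xs h)
... | false | false = count-mono p q xs h

count-partition : {A : Set} (p : A → Bool) (xs : List A) → count p xs + count (not ∘ p) xs ≡ length xs
count-partition p [] = refl
count-partition p (x ∷ xs) with p x
... | true  = cong suc (count-partition p xs)
... | false = trans (+-suc _ _) (cong suc (count-partition p xs))

count-incl-excl : {A : Set} (p q : A → Bool) (xs : List A) →
  count p xs + count q xs ≤ length xs + count (λ x → p x ∧ q x) xs
count-incl-excl p q [] = z≤n
count-incl-excl p q (x ∷ xs) with p x | q x | count-incl-excl p q xs
... | true  | true  | h rewrite +-suc (count p xs) (count q xs) | +-suc (length xs) (count (λ x → p x ∧ q x) xs) = s≤s (s≤s h)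
... | true  | false | h = s≤s h
... | false | true  | h rewrite +-suc (count p xs) (count q xs) = s≤s h
... | false | false | h = m≤n⇒m≤1+n h

length-filter : {A : Set} (p : A → Bool) (xs : List A) → length (filterᵇ p xs) ≡ count p xs
length-filter p [] = refl
length-filter p (x ∷ xs) with p x
... | true  = cong suc (length-filter p xs)
... | false = length-filter p xs

count-filter : {A : Set} (p q : A → Bool) (xs : List A) → count q (filterᵇ p xs) ≡ count (λ x → p x ∧ q x) xs
count-filter p q [] = refl
count-filter p q (x ∷ xs) with p x
... | true  = cong (b2n (q x) +_) (count-filter p q xs)
... | false = count-filter p q xs

filter-⊑ : {A : Set} (p : A → Bool) (xs : List A) → filterᵇ p xs ⊑ xs
filter-⊑ p xs = ⊑! λ q → subst (_≤ count q xs) (sym (count-filter p q xs)) (count-mono _ q xs λ x → ∧-right (p x))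
  where
  ∧-right : ∀ a {b} → a ∧ b ≡ true → b ≡ true
  ∧-right true e = e

filter-split : {A : Set} (p : A → Bool) (xs : List A) → filterᵇ p xs ++ filterᵇ (not ∘ p) xs ≋ xs
filter-split {A} p xs = ≋! λ q → go q xs
  where
  shuffle : ∀ a b c → a + (b + c) ≡ b + (a + c)
  shuffle = solve-∀
  go : (q : A → Bool) (xs : List A) → count q (filterᵇ p xs ++ filterᵇ (not ∘ p) xs) ≡ count q xs
  go q [] = refl
  go q (x ∷ xs) with p x
  ... | true  = cong (b2n (q x) +_) (go q xs)
  ... | false rewrite count-++ q (filterᵇ p xs) (x ∷ filterᵇ (not ∘ p) xs) | sym (go q xs)
                    | count-++ q (filterᵇ p xs) (filterᵇ (not ∘ p) xs) =
                        shuffle (count q (filterᵇ p xs)) (b2n (q x)) _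

Prefix : {A : Set} → ℕ → List A → Set
Prefix {A} k xs = Σ[ ys ∈ List A ] Σ[ zs ∈ List A ] (xs ≡ ys ++ zs × length ys ≡ k)

splitAt-length : {A : Set} (k : ℕ) (xs : List A) → k ≤ length xs → Prefix k xs
splitAt-length zero    xs       h       = [] , xs , refl , refl
splitAt-length (suc k) (x ∷ xs) (s≤s h) with splitAt-length k xs h
... | ys , zs , e , l = x ∷ ys , zs , cong (x ∷_) e , cong suc l

-- A chain x, xs, y: consecutive entries are related, so Ch E x xs x is a closed walk with vertex list x ∷ xs.
Ch : {A : Set} → (A → A → Set) → A → List A → A → Set
Ch E x []       y = E x y
Ch E x (z ∷ zs) y = E x z × Ch E z zs y

Cyc : {A : Set} → (A → A → Set) → List A → Set
Cyc E []       = ⊥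
Cyc E (x ∷ xs) = Ch E x xs x

Ch-++ : {A : Set} {E : A → A → Set} {x y z : A} (xs : List A) {ys : List A} →
  Ch E x xs y → Ch E y ys z → Ch E x (xs ++ y ∷ ys) z
Ch-++ []       c       d = c , d
Ch-++ (_ ∷ xs) (e , c) d = e , Ch-++ xs c d

Ch-split : {A : Set} {E : A → A → Set} {x y z : A} (xs : List A) {ys : List A} →
  Ch E x (xs ++ y ∷ ys) z → Ch E x xs y × Ch E y ys z
Ch-split []       (e , c) = e , c
Ch-split (_ ∷ xs) (e , c) with Ch-split xs c
... | c₁ , c₂ = (e , c₁) , c₂

Ch-rev : {A : Set} {E : A → A → Set} → (∀ {x y} → E x y → E y x) → {x y : A} (xs : List A) →
  Ch E x xs y → Ch E y (reverse xs) x
Ch-rev s []       e = s e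
Ch-rev s {x} (z ∷ zs) (e , c) rewrite unfold-reverse z zs = Ch-++ (reverse zs) (Ch-rev s zs c) (s e)

Ch-map : {A : Set} {E F : A → A → Set} → (∀ {x y} → E x y → F x y) → {x y : A} (xs : List A) → Ch E x xs y → Ch F x xs y
Ch-map f []       e       = f e
Ch-map f (_ ∷ xs) (e , c) = f e , Ch-map f xs c

Cyc-map : {A : Set} {E F : A → A → Set} → (∀ {x y} → E x y → F x y) → (xs : List A) → Cyc E xs → Cyc F xs
Cyc-map f (x ∷ xs) = Ch-map f xs

Cyc-rotate : {A : Set} {E : A → A → Set} (xs ys : List A) → Cyc E (xs ++ ys) → Cyc E (ys ++ xs)
Cyc-rotate [] ys c = subst (Cyc _) (sym (++-identityʳ ys)) c
Cyc-rotate (x ∷ xs) [] c = subst (Cyc _) (++-identityʳ (x ∷ xs)) c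
Cyc-rotate (x ∷ xs) (y ∷ ys) c with Ch-split xs c
... | c₁ , c₂ = Ch-++ ys c₂ c₁

Cyc-map∈ : {A : Set} {E F : A → A → Set} (P : A → Set) → (∀ {x y} → P x → P y → E x y → F x y) →
  (xs : List A) → (∀ ys v zs → xs ≡ ys ++ v ∷ zs → P v) → Cyc E xs → Cyc F xs
Cyc-map∈ {A} {E} {F} P f (x ∷ xs) h c = go xs [] x refl c
  where
  go : ∀ zs pre y → x ∷ xs ≡ pre ++ y ∷ zs → Ch E y zs x → Ch F y zs x
  go []       pre y eq e = f (h pre y [] eq) (h [] x xs refl) e
  go (z ∷ zs) pre y eq (e , c) =
    f (h pre y (z ∷ zs) eq) (h (pre ++ y ∷ []) z zs eq′) e , go zs (pre ++ y ∷ []) z eq′ c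
    where
    eq′ : x ∷ xs ≡ (pre ++ y ∷ []) ++ z ∷ zs
    eq′ = trans eq (sym (++-assoc pre (y ∷ []) (z ∷ zs)))

≋-refl : {A : Set} {xs : List A} → xs ≋ xs
≋-refl = ≋! λ p → refl

≋-sym : {A : Set} {xs ys : List A} → xs ≋ ys → ys ≋ xs
≋-sym h = ≋! λ p → sym (≋at h p)

≋-trans : {A : Set} {xs ys zs : List A} → xs ≋ ys → ys ≋ zs → xs ≋ zs
≋-trans h k = ≋! λ p → trans (≋at h p) (≋at k p)

⊑-refl : {A : Set} {xs : List A} → xs ⊑ xs
⊑-refl = ⊑! λ p → ≤-refl

⊑-trans : {A : Set} {xs ys zs : List A} → xs ⊑ ys → ys ⊑ zs → xs ⊑ zs
⊑-trans h k = ⊑! λ p → ≤-trans (⊑at h p) (⊑at k p)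

≋-++ : {A : Set} {xs xs′ ys ys′ : List A} → xs ≋ xs′ → ys ≋ ys′ → xs ++ ys ≋ xs′ ++ ys′
≋-++ {xs = xs} {xs′} {ys} {ys′} h k = ≋! λ p →
  trans (count-++ p xs ys) (trans (cong₂ _+_ (≋at h p) (≋at k p)) (sym (count-++ p xs′ ys′)))

⊑-++ : {A : Set} {xs xs′ ys ys′ : List A} → xs ⊑ xs′ → ys ⊑ ys′ → xs ++ ys ⊑ xs′ ++ ys′
⊑-++ {xs = xs} {xs′} {ys} {ys′} h k = ⊑! λ p →
  subst₂ _≤_ (sym (count-++ p xs ys)) (sym (count-++ p xs′ ys′)) (+-mono-≤ (⊑at h p) (⊑at k p))

≋-swap : {A : Set} (xs ys : List A) → xs ++ ys ≋ ys ++ xs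
≋-swap xs ys = ≋! λ p → trans (count-++ p xs ys) (trans (+-comm (count p xs) (count p ys)) (sym (count-++ p ys xs)))

⊑-++ˡ : {A : Set} (xs ys : List A) → xs ⊑ xs ++ ys
⊑-++ˡ xs ys = ⊑! λ p → ≤-trans (m≤m+n _ _) (≤-reflexive (sym (count-++ p xs ys)))

⊑-++ʳ : {A : Set} (xs ys : List A) → ys ⊑ xs ++ ys
⊑-++ʳ xs ys = ⊑! λ p → ≤-trans (m≤n+m _ _) (≤-reflexive (sym (count-++ p xs ys)))

-- Duplicate-free lists of vertices, membership and complements

infix 4 _==_ _∈_

_==_ : {M : ℕ} → Fin M → Fin M → Bool
x == y = does (x Fin.≟ y)

==-refl : {M : ℕ} (x : Fin M) → (x == x) ≡ true
==-refl x = dec-true (x Fin.≟ x) refl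

==⇒≡ : {M : ℕ} {x y : Fin M} → (x == y) ≡ true → x ≡ y
==⇒≡ {x = x} {y} e with x Fin.≟ y
... | yes p = p

≢⇒== : {M : ℕ} {x y : Fin M} → x ≢ y → (x == y) ≡ false
≢⇒== {x = x} {y} n = dec-false (x Fin.≟ y) n

record _∈_ {M : ℕ} (v : Fin M) (xs : List (Fin M)) : Set where
  constructor mem
  field once : 1 ≤ count (v ==_) xs
open _∈_ public

-- Phrased by multiplicities like `_∈_`, so that a new cycle is duplicate-free as soon as it is `⊑`
-- a duplicate-free list.
record U {M : ℕ} (xs : List (Fin M)) : Set where
  constructor uniq
  field U≤ : ∀ v → count (v ==_) xs ≤ 1
open U public

U-⊑ : {M : ℕ} {xs ys : List (Fin M)} → xs ⊑ ys → U ys → U xs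
U-⊑ h u = uniq λ v → ≤-trans (⊑at h (v ==_)) (U≤ u v)

∈-⊑ : {M : ℕ} {v : Fin M} {xs ys : List (Fin M)} → xs ⊑ ys → v ∈ xs → v ∈ ys
∈-⊑ {v = v} h (mem m) = mem (≤-trans m (⊑at h (v ==_)))

∈-here : {M : ℕ} (v : Fin M) (xs : List (Fin M)) → v ∈ v ∷ xs
∈-here v xs = mem (subst (λ b → 1 ≤ b2n b + count (v ==_) xs) (sym (==-refl v)) (s≤s z≤n))

∈-there : {M : ℕ} {v : Fin M} (x : Fin M) {xs : List (Fin M)} → v ∈ xs → v ∈ x ∷ xs
∈-there {v = v} x (mem m) = mem (≤-trans m (m≤n+m _ (b2n (v == x))))

∈-++ˡ : {M : ℕ} {v : Fin M} {xs : List (Fin M)} (ys : List (Fin M)) → v ∈ xs → v ∈ xs ++ ys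
∈-++ˡ {v = v} {xs} ys (mem m) = mem (subst (1 ≤_) (sym (count-++ (v ==_) xs ys)) (≤-trans m (m≤m+n _ _)))

∈-++ʳ : {M : ℕ} {v : Fin M} (xs : List (Fin M)) {ys : List (Fin M)} → v ∈ ys → v ∈ xs ++ ys
∈-++ʳ {v = v} xs {ys} (mem m) = mem (subst (1 ≤_) (sym (count-++ (v ==_) xs ys)) (≤-trans m (m≤n+m _ _)))

∈-∷⁻ : {M : ℕ} {v x : Fin M} {xs : List (Fin M)} → v ∈ x ∷ xs → (v ≡ x) ⊎ (v ∈ xs)
∈-∷⁻ {v = v} {x} (mem m) with v Fin.≟ x
... | yes e = inj₁ e
... | no  _ = inj₂ (mem m)

∈-++⁻ : {M : ℕ} {v : Fin M} (xs : List (Fin M)) {ys : List (Fin M)} → v ∈ xs ++ ys → (v ∈ xs) ⊎ (v ∈ ys)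
∈-++⁻ []       m = inj₂ m
∈-++⁻ (x ∷ xs) m with ∈-∷⁻ m
... | inj₁ refl = inj₁ (∈-here x xs)
... | inj₂ m′ with ∈-++⁻ xs m′
...   | inj₁ k = inj₁ (∈-there x k)
...   | inj₂ k = inj₂ k

∈-mid : {M : ℕ} (xs : List (Fin M)) (v : Fin M) (ys : List (Fin M)) → v ∈ xs ++ v ∷ ys
∈-mid xs v ys = ∈-++ʳ xs (∈-here v ys)

∈-split : {M : ℕ} {v : Fin M} (xs : List (Fin M)) → v ∈ xs →
  Σ[ ys ∈ List (Fin M) ] Σ[ zs ∈ List (Fin M) ] xs ≡ ys ++ v ∷ zs
∈-split {v = v} xs (mem m) with count-split (v ==_) xs m
... | ys , w , zs , e , t = ys , zs , trans e (cong (λ u → ys ++ u ∷ zs) (sym (==⇒≡ t)))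

∈-count : {M : ℕ} (p : Fin M → Bool) {v : Fin M} (xs : List (Fin M)) → v ∈ xs → p v ≡ true → 1 ≤ count p xs
∈-count p {v} xs (mem m) pv = ≤-trans m (count-mono (v ==_) p xs λ x e → subst (λ y → p y ≡ true) (==⇒≡ e) pv)

count-∈ : {M : ℕ} (p : Fin M → Bool) (xs : List (Fin M)) → 1 ≤ count p xs → Σ[ v ∈ Fin M ] (v ∈ xs × p v ≡ true)
count-∈ p xs h with count-split p xs h
... | ys , v , zs , refl , pv = v , ∈-mid ys v zs , pv

∈-filter⁻ : {M : ℕ} (p : Fin M → Bool) {v : Fin M} (xs : List (Fin M)) → v ∈ filterᵇ p xs → (v ∈ xs) × p v ≡ true
∈-filter⁻ p {v} (x ∷ xs) m with p x in e
... | false = let (a , b) = ∈-filter⁻ p xs m in ∈-there x a , b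
... | true with ∈-∷⁻ m
...   | inj₁ refl = ∈-here x xs , e
...   | inj₂ m′   = let (a , b) = ∈-filter⁻ p xs m′ in ∈-there x a , b

∈-filter⁺ : {M : ℕ} (p : Fin M → Bool) {v : Fin M} (xs : List (Fin M)) → v ∈ xs → p v ≡ true → v ∈ filterᵇ p xs
∈-filter⁺ p {v} xs m pv = mem (subst (1 ≤_) (sym (count-filter p (v ==_) xs)) (∈-count (λ x → p x ∧ (v == x)) xs m lem))
  where
  lem : (p v ∧ (v == v)) ≡ true
  lem rewrite pv = ==-refl v

count-all : {M : ℕ} (v : Fin M) → count (v ==_) (allFin M) ≡ 1
count-all {M} v = go M id (λ e → e) v refl
  where
  miss : (m : ℕ) (f : Fin m → Fin M) → (∀ i → f i ≢ v) → count (v ==_) (tabulate f) ≡ 0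
  miss zero    f h = refl
  miss (suc m) f h rewrite ≢⇒== (h Fin.zero ∘ sym) = miss m (f ∘ Fin.suc) (h ∘ Fin.suc)
  go : (m : ℕ) (f : Fin m → Fin M) → (∀ {i j} → f i ≡ f j → i ≡ j) → (i : Fin m) → f i ≡ v →
       count (v ==_) (tabulate f) ≡ 1
  go (suc m) f inj Fin.zero    refl rewrite ==-refl (f Fin.zero) =
    cong suc (miss m (f ∘ Fin.suc) λ j e → case inj e of λ ())
  go (suc m) f inj (Fin.suc i) e rewrite ≢⇒== {x = v} {f Fin.zero} (λ d → case inj (trans e d) of λ ()) =
    go m (f ∘ Fin.suc) (λ d → Finₚ.suc-injective (inj d)) i e

∈-all : {M : ℕ} (v : Fin M) → v ∈ allFin M
∈-all v = mem (≤-reflexive (sym (count-all v)))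

U-all : {M : ℕ} → U (allFin M)
U-all = uniq λ v → ≤-reflexive (count-all v)

remove : {M : ℕ} {v : Fin M} (ys : List (Fin M)) → v ∈ ys → Σ[ zs ∈ List (Fin M) ] v ∷ zs ≋ ys
remove {v = v} ys m with ∈-split ys m
... | as , bs , refl = as ++ bs , ≋! lem
  where
  shuffle : ∀ a b c → a + (b + c) ≡ b + (a + c)
  shuffle = solve-∀
  lem : ∀ p → count p (v ∷ as ++ bs) ≡ count p (as ++ v ∷ bs)
  lem p rewrite count-++ p as (v ∷ bs) | count-++ p as bs = shuffle (b2n (p v)) (count p as) (count p bs)

-- Induction on the first list: `ys` has more copies of `x` than `xs` has, so `x` is still present
-- in the complement of `xs` and can be taken out of it.
complement : {M : ℕ} (xs ys : List (Fin M)) → (∀ v → count (v ==_) xs ≤ count (v ==_) ys) →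
  Σ[ zs ∈ List (Fin M) ] xs ++ zs ≋ ys
complement []       ys h = ys , ≋-refl
complement (x ∷ xs) ys h with complement xs ys (λ v → ≤-trans (m≤n+m _ (b2n (v == x))) (h v))
... | zs , e with remove {v = x} zs (mem (+-cancelˡ-≤ (count (x ==_) xs) 1 (count (x ==_) zs)
                    (subst₂ _≤_ (+-comm 1 _) (trans (sym (≋at e (x ==_))) (count-++ (x ==_) xs zs))
                       (subst (λ b → b2n b + count (x ==_) xs ≤ count (x ==_) ys) (==-refl x) (h x)))))
...   | ws , d = ws , ≋! lem
  where
  shuffle : ∀ a b c → a + (b + c) ≡ b + (a + c)
  shuffle = solve-∀
  lem : ∀ p → count p (x ∷ xs ++ ws) ≡ count p ys
  lem p rewrite sym (≋at e p) | count-++ p xs zs | sym (≋at d p) | count-++ p xs ws = shuffle (b2n (p x)) (count p xs) (count p ws)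

U-⇒⊑ : {M : ℕ} (xs ys : List (Fin M)) → U xs → (∀ v → v ∈ xs → v ∈ ys) → Σ[ zs ∈ List (Fin M) ] xs ++ zs ≋ ys
U-⇒⊑ xs ys u h = complement xs ys le
  where
  le : ∀ v → count (v ==_) xs ≤ count (v ==_) ys
  le v with count (v ==_) xs in e | U≤ u v
  ... | zero     | _       = z≤n
  ... | suc zero | s≤s z≤n = once (h v (mem (≤-reflexive (sym e))))

outside : {M : ℕ} (xs : List (Fin M)) → U xs → Σ[ zs ∈ List (Fin M) ] xs ++ zs ≋ allFin M
outside xs u = U-⇒⊑ xs (allFin _) u (λ v _ → ∈-all v)

≋-∈ : {M : ℕ} {v : Fin M} {xs ys : List (Fin M)} → xs ≋ ys → v ∈ xs → v ∈ ys
≋-∈ h = ∈-⊑ (≋⇒⊑ h)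

∉-both : {M : ℕ} {v : Fin M} (xs ys : List (Fin M)) → U (xs ++ ys) → v ∈ xs → v ∈ ys → ⊥
∉-both {v = v} xs ys u (mem a) (mem b) with subst (_≤ 1) (count-++ (v ==_) xs ys) (U≤ u v)
... | h = <⇒≱ (+-mono-≤ a b) h

U-∷ : {M : ℕ} {x : Fin M} {xs : List (Fin M)} → ¬ (x ∈ xs) → U xs → U (x ∷ xs)
U-∷ {x = x} {xs} n u = uniq le
  where
  le : ∀ v → count (v ==_) (x ∷ xs) ≤ 1
  le v with v Fin.≟ x
  ... | yes refl = s≤s (≮⇒≥ λ h → n (mem h))
  ... | no  _    = U≤ u v

∉[] : {M : ℕ} {v : Fin M} → ¬ (v ∈ [])
∉[] (mem ())

∈-single : {M : ℕ} {v x : Fin M} → v ∈ x ∷ [] → v ≡ x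
∈-single m = [ id , (λ n → ⊥-elim (∉[] n)) ]′ (∈-∷⁻ m)

U-pair : {M : ℕ} {x y : Fin M} → x ≢ y → U (x ∷ y ∷ [])
U-pair n = U-∷ (n ∘ ∈-single) (U-∷ ∉[] (uniq λ _ → z≤n))

pair-⊆ : {M : ℕ} {x y : Fin M} {zs : List (Fin M)} → x ∈ zs → y ∈ zs → ∀ v → v ∈ x ∷ y ∷ [] → v ∈ zs
pair-⊆ {zs = zs} a b v m = [ (λ e → subst (_∈ zs) (sym e) a) , (λ n → subst (_∈ zs) (sym (∈-single n)) b) ]′ (∈-∷⁻ m)

U-++ : {M : ℕ} (xs ys : List (Fin M)) → U xs → U ys → (∀ {v} → v ∈ xs → v ∈ ys → ⊥) → U (xs ++ ys)
U-++ []       ys u w d = w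
U-++ (x ∷ xs) ys u w d = U-∷ {x = x} {xs ++ ys} notin (U-++ xs ys (U-⊑ (⊑-++ʳ (x ∷ []) xs) u) w (λ a → d (∈-there x a)))
  where
  notin : ¬ (x ∈ xs ++ ys)
  notin m with ∈-++⁻ xs m
  ... | inj₁ (mem a) = <⇒≱ (s≤s a) (subst (λ b → b2n b + count (x ==_) xs ≤ 1) (==-refl x) (U≤ u x))
  ... | inj₂ b = d (∈-here x xs) b

U-++ˡ : {M : ℕ} (xs ys : List (Fin M)) → U (xs ++ ys) → U xs
U-++ˡ xs ys = U-⊑ (⊑-++ˡ xs ys)

U-++ʳ : {M : ℕ} (xs ys : List (Fin M)) → U (xs ++ ys) → U ys
U-++ʳ xs ys = U-⊑ (⊑-++ʳ xs ys)

length-all : {M : ℕ} → length (allFin M) ≡ M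
length-all {M} = length-tabulate id

lookup-∈ : {M : ℕ} (xs : List (Fin M)) (i : Fin (length xs)) → lookup xs i ∈ xs
lookup-∈ (x ∷ xs) Fin.zero    = ∈-here x xs
lookup-∈ (x ∷ xs) (Fin.suc i) = ∈-there x (lookup-∈ xs i)

lookup-injective : {M : ℕ} (xs : List (Fin M)) → U xs → ∀ {i j} → lookup xs i ≡ lookup xs j → i ≡ j
lookup-injective (x ∷ xs) u {Fin.zero}  {Fin.zero}  e = refl
lookup-injective (x ∷ xs) u {Fin.zero}  {Fin.suc j} e =
  ⊥-elim (∉-both (x ∷ []) xs u (∈-here x []) (subst (_∈ xs) (sym e) (lookup-∈ xs j)))
lookup-injective (x ∷ xs) u {Fin.suc i} {Fin.zero}  e =
  ⊥-elim (∉-both (x ∷ []) xs u (∈-here x []) (subst (_∈ xs) e (lookup-∈ xs i)))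
lookup-injective (x ∷ xs) u {Fin.suc i} {Fin.suc j} e =
  cong Fin.suc (lookup-injective xs (U-++ʳ (x ∷ []) xs u) e)

Ch-step : {A : Set} {E : A → A → Set} {x y : A} (xs : List A) → Ch E x xs y →
  ∀ i j → suc (toℕ i) ≡ toℕ j → E (lookup (x ∷ xs) i) (lookup (x ∷ xs) j)
Ch-step []       c Fin.zero (Fin.suc ()) e
Ch-step (z ∷ zs) (e , c) Fin.zero    (Fin.suc Fin.zero)    refl = e
Ch-step (z ∷ zs) (e , c) Fin.zero    (Fin.suc (Fin.suc _)) ()
Ch-step (z ∷ zs) (e , c) (Fin.suc i) (Fin.suc j) eq = Ch-step zs c i j (suc-injective eq)
Ch-step (z ∷ zs) c (Fin.suc i) Fin.zero ()

Ch-last : {A : Set} {E : A → A → Set} {x y : A} (xs : List A) → Ch E x xs y →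
  ∀ i → suc (toℕ i) ≡ length (x ∷ xs) → E (lookup (x ∷ xs) i) y
Ch-last []       c       Fin.zero    e = c
Ch-last (z ∷ zs) (e , c) (Fin.suc i) q = Ch-last zs c i (suc-injective q)

cycle⇒mono : {N k m : ℕ} (c : Colouring N k) (r : Fin k) (xs : List (Fin N)) →
  length xs ≡ m → U xs → Cyc (λ x y → col c x y ≡ r) xs → HasMonoCycle m c
cycle⇒mono {N} c r (x ∷ xs) refl u ch = lookup (x ∷ xs) , lookup-injective (x ∷ xs) u , r , adj
  where
  adj : ∀ i j → CycleAdj (length (x ∷ xs)) i j → col c (lookup (x ∷ xs) i) (lookup (x ∷ xs) j) ≡ r
  adj i j        (inj₁ e)         = Ch-step xs ch i j e
  adj i Fin.zero (inj₂ (e , refl)) = Ch-last xs ch i e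

-- Linear arithmetic and multiset identities by reflection

infixl 6 _⊕_

_⊕_ : ∀ {a b c d} → a ≤ b → c ≤ d → a + c ≤ b + d
_⊕_ = +-mono-≤

-- From L ≤ R one gets l ≤ r as soon as the excess r − l dominates R − L (by s).
linear : ∀ {L R l r} s → L ≤ R → R + l + s ≡ L + r → l ≤ r
linear {L} {R} {l} {r} s h e =
  +-cancelˡ-≤ R l r (≤-trans (m≤m+n (R + l) s) (≤-trans (≤-reflexive e) (+-monoˡ-≤ r h)))

1≰0 : ¬ (1 ≤ 0)
1≰0 ()

-- Multiset expressions over list variables, compared through their occurrence vectors.
data LE (n : ℕ) : Set where
  var     : Fin n → LE n
  _∪_     : LE n → LE n → LE n
  rv      : LE n → LE n
  nil     : LE n

infixr 5 _∪_

⟦_⟧ : ∀ {n} {A : Set} → LE n → Vec (List A) n → List A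
⟦ var i ⟧ ρ = Vec.lookup ρ i
⟦ e ∪ f ⟧ ρ = ⟦ e ⟧ ρ ++ ⟦ f ⟧ ρ
⟦ rv e  ⟧ ρ = reverse (⟦ e ⟧ ρ)
⟦ nil   ⟧ ρ = []

unit : ∀ {n} → Fin n → Vec ℕ n
unit Fin.zero    = 1 ▸ Vec.replicate _ 0
unit (Fin.suc i) = 0 ▸ unit i

occ : ∀ {n} → LE n → Vec ℕ n
occ (var i) = unit i
occ (e ∪ f) = Vec.zipWith _+_ (occ e) (occ f)
occ (rv e)  = occ e
occ nil     = Vec.replicate _ 0

weight : ∀ {n} {A : Set} → (A → Bool) → Vec (List A) n → Vec ℕ n → ℕ
weight p ε        ε        = 0
weight p (xs ▸ ρ) (k ▸ ks) = k * count p xs + weight p ρ ks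

weight-0 : ∀ {n} {A : Set} (p : A → Bool) (ρ : Vec (List A) n) → weight p ρ (Vec.replicate n 0) ≡ 0
weight-0 p ε        = refl
weight-0 p (xs ▸ ρ) = weight-0 p ρ

weight-unit : ∀ {n} {A : Set} (p : A → Bool) (ρ : Vec (List A) n) i → weight p ρ (unit i) ≡ count p (Vec.lookup ρ i)
weight-unit p (xs ▸ ρ) Fin.zero rewrite weight-0 p ρ = trans (+-identityʳ _) (+-identityʳ _)
weight-unit p (xs ▸ ρ) (Fin.suc i) = weight-unit p ρ i

weight-+ : ∀ {n} {A : Set} (p : A → Bool) (ρ : Vec (List A) n) ks ls →
  weight p ρ (Vec.zipWith _+_ ks ls) ≡ weight p ρ ks + weight p ρ ls
weight-+ p ε        ε        ε        = refl
weight-+ p (xs ▸ ρ) (k ▸ ks) (l ▸ ls) rewrite weight-+ p ρ ks ls =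
  shuffle k l (count p xs) (weight p ρ ks) (weight p ρ ls)
  where
  shuffle : ∀ k l c a b → (k + l) * c + (a + b) ≡ k * c + a + (l * c + b)
  shuffle = solve-∀

occ-sound : ∀ {n} {A : Set} (p : A → Bool) (ρ : Vec (List A) n) e → count p (⟦ e ⟧ ρ) ≡ weight p ρ (occ e)
occ-sound p ρ (var i) = sym (weight-unit p ρ i)
occ-sound p ρ (e ∪ f) rewrite count-++ p (⟦ e ⟧ ρ) (⟦ f ⟧ ρ) | occ-sound p ρ e | occ-sound p ρ f =
  sym (weight-+ p ρ (occ e) (occ f))
occ-sound p ρ (rv e)  = trans (count-rev p (⟦ e ⟧ ρ)) (occ-sound p ρ e)
occ-sound p ρ nil     = sym (weight-0 p ρ)

perm : ∀ {n} {A : Set} (ρ : Vec (List A) n) e f → occ e ≡ occ f → ⟦ e ⟧ ρ ≋ ⟦ f ⟧ ρ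
perm ρ e f h = ≋! λ p → trans (occ-sound p ρ e) (trans (cong (weight p ρ) h) (sym (occ-sound p ρ f)))

-- `g` lists the pieces of `f` missing from `e`; the inclusion becomes an equality of occurrence
-- vectors, to be settled by `refl`.
sub : ∀ {n} {A : Set} (ρ : Vec (List A) n) e f g → occ (e ∪ g) ≡ occ f → ⟦ e ⟧ ρ ⊑ ⟦ f ⟧ ρ
sub ρ e f g h = ⊑-trans (⊑-++ˡ (⟦ e ⟧ ρ) (⟦ g ⟧ ρ)) (≋⇒⊑ (perm ρ (e ∪ g) f h))

v0 : ∀ {n} → LE (1 + n)
v0 = var Fin.zero
v1 : ∀ {n} → LE (2 + n)
v1 = var (Fin.suc Fin.zero)
v2 : ∀ {n} → LE (3 + n)
v2 = var (Fin.suc (Fin.suc Fin.zero))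
v3 : ∀ {n} → LE (4 + n)
v3 = var (Fin.suc (Fin.suc (Fin.suc Fin.zero)))
v4 : ∀ {n} → LE (5 + n)
v4 = var (Fin.suc (Fin.suc (Fin.suc (Fin.suc Fin.zero))))
v5 : ∀ {n} → LE (6 + n)
v5 = var (Fin.suc (Fin.suc (Fin.suc (Fin.suc (Fin.suc Fin.zero)))))

-- Alternating cycles and their rotation

[_]₁ : {A : Set} → A → List A
[ x ]₁ = x ∷ []

interleave : {A : Set} → List A → List A → List A
interleave []       bs       = bs
interleave (a ∷ as) []       = a ∷ as
interleave (a ∷ as) (b ∷ bs) = a ∷ b ∷ interleave as bs

interleave-≋ : {A : Set} (as bs : List A) → interleave as bs ≋ as ++ bs
interleave-≋ as bs = ≋! λ p → go p as bs
  where
  shuffle : ∀ a b c d → a + (b + (c + d)) ≡ a + (c + (b + d))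
  shuffle = solve-∀
  go : ∀ p as bs → count p (interleave as bs) ≡ count p (as ++ bs)
  go p []       bs       = refl
  go p (a ∷ as) []       = cong (λ xs → b2n (p a) + count p xs) (sym (++-identityʳ as))
  go p (a ∷ as) (b ∷ bs) rewrite go p as bs | count-++ p as (b ∷ bs) | count-++ p as bs =
    shuffle (b2n (p a)) (b2n (p b)) (count p as) (count p bs)

interleave-Ch : ∀ {M} {E : Fin M → Fin M → Set} (P Q : Fin M → Set) → (∀ {a b} → P a → Q b → E a b × E b a) →
  ∀ {x b y} (as bs : List (Fin M)) → length as ≡ length bs → P x → Q b → P y →
  (∀ {a} → a ∈ as → P a) → (∀ {b} → b ∈ bs → Q b) → Ch E x (b ∷ interleave as bs) y
interleave-Ch P Q h []       []        l px qb py pa qs = proj₁ (h px qb) , proj₂ (h py qb)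
interleave-Ch P Q h (a ∷ as) (b′ ∷ bs) l px qb py pa qs =
  proj₁ (h px qb) , proj₂ (h (pa (∈-here a as)) qb) ,
  interleave-Ch P Q h as bs (suc-injective l) (pa (∈-here a as)) (qs (∈-here b′ bs)) py (pa ∘ ∈-there a) (qs ∘ ∈-there b′)

interleave-Cyc : ∀ {M} {E : Fin M → Fin M → Set} (as bs : List (Fin M)) → 1 ≤ length as → length as ≡ length bs →
  (∀ {a b} → a ∈ as → b ∈ bs → E a b × E b a) → Cyc E (interleave as bs)
interleave-Cyc (a ∷ as) (b ∷ bs) _ l h = interleave-Ch (_∈ a ∷ as) (_∈ b ∷ bs) h as bs (suc-injective l)
  (∈-here a as) (∈-here b bs) (∈-here a as) (∈-there a) (∈-there b)

does⇒ : {P : Set} (d : Dec P) → does d ≡ true → P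
does⇒ (yes p) e = p

¬does⇒ : {P : Set} (d : Dec P) → does d ≡ false → ¬ P
¬does⇒ (no n) e = n

bool-ext : ∀ {a b} → (a ≡ true → b ≡ true) → (b ≡ true → a ≡ true) → a ≡ b
bool-ext {true}  {b}     f g = sym (f refl)
bool-ext {false} {true}  f g = g refl
bool-ext {false} {false} f g = refl

-- An Ore-type rotation argument: a cyclic arrangement of two n-sets in alternation is improved
-- until no two neighbours lie in the same class.
module Bipartite {M : ℕ} (side : Fin M → Bool) (cls : Fin M → ℕ) where

  V : Set
  V = Fin M

  Alt Good : V → V → Set
  Alt x y  = side y ≡ not (side x)
  Good x y = Alt x y × cls x ≢ cls y

  Alt-sym : ∀ {x y} → Alt x y → Alt y x
  Alt-sym {x} {y} e rewrite e with side x
  ... | true  = refl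
  ... | false = refl

  same : V → V → Bool
  same x y = does (cls x ℕₚ.≟ cls y)

  same-sym : ∀ x y → same x y ≡ same y x
  same-sym x y = bool-ext (λ e → dec-true (cls y ℕₚ.≟ cls x) (sym (does⇒ (cls x ℕₚ.≟ cls y) e)))
                          (λ e → dec-true (cls x ℕₚ.≟ cls y) (sym (does⇒ (cls y ℕₚ.≟ cls x) e)))

  bad : V → List V → V → ℕ
  bad x []       y = b2n (same x y)
  bad x (z ∷ zs) y = b2n (same x z) + bad z zs y

  badC : List V → ℕ
  badC []       = 0
  badC (x ∷ xs) = bad x xs x

  bad-++ : ∀ {x y z} xs ys → bad x (xs ++ y ∷ ys) z ≡ bad x xs y + bad y ys z
  bad-++ []       ys = refl
  bad-++ {x} {y} {z} (w ∷ xs) ys rewrite bad-++ {w} {y} {z} xs ys = sym (+-assoc (b2n (same x w)) _ _)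

  bad-rev : ∀ {x y} xs → bad y (reverse xs) x ≡ bad x xs y
  bad-rev {x} {y} [] rewrite same-sym x y = refl
  bad-rev {x} {y} (z ∷ zs) rewrite unfold-reverse z zs | bad-++ {y} {z} {x} (reverse zs) [] | bad-rev {z} {y} zs | same-sym z x =
    +-comm (bad z zs y) _

  bad-rotate : ∀ xs ys → badC (xs ++ ys) ≡ badC (ys ++ xs)
  bad-rotate [] ys rewrite ++-identityʳ ys = refl
  bad-rotate (x ∷ xs) [] rewrite ++-identityʳ xs = refl
  bad-rotate (x ∷ xs) (y ∷ ys) rewrite bad-++ {x} {y} {x} xs ys | bad-++ {y} {x} {y} ys xs = +-comm (bad x xs y) _

  good : ∀ {x y} xs → Ch Alt x xs y → bad x xs y ≡ 0 → Ch Good x xs y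
  good {x} {y} [] c e with same x y in eq
  ... | false = c , ¬does⇒ (cls x ℕₚ.≟ cls y) eq
  good {x} (z ∷ zs) (c , cs) e with same x z in eq
  ... | false = (c , ¬does⇒ (cls x ℕₚ.≟ cls z) eq) , good zs cs e

  find : ∀ {x y} xs → 1 ≤ bad x xs y →
    (Σ[ as ∈ List V ] Σ[ p ∈ V ] (x ∷ xs ≡ as ++ p ∷ [] × same p y ≡ true)) ⊎
    (Σ[ as ∈ List V ] Σ[ p ∈ V ] Σ[ q ∈ V ] Σ[ bs ∈ List V ] (x ∷ xs ≡ as ++ p ∷ q ∷ bs × same p q ≡ true))
  find {x} {y} [] h with same x y in e
  ... | true = inj₁ ([] , x , refl , e)
  find {x} {y} (z ∷ zs) h with same x z in e
  ... | true  = inj₂ ([] , x , z , zs , refl , e)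
  ... | false with find zs h
  ...   | inj₁ (as , p , eq , t)          = inj₁ (x ∷ as , p , cong (x ∷_) eq , t)
  ...   | inj₂ (as , p , q , bs , eq , t) = inj₂ (x ∷ as , p , q , bs , cong (x ∷_) eq , t)

  -- The list falls into k consecutive pairs, and fewer than k entries satisfy `δ`, so some pair
  -- contains none of them. The even length of `as` puts `u` on the same side as the first vertex of
  -- an alternating cycle.
  evenPair : (δ : V → Bool) (k : ℕ) (xs : List V) → length xs ≡ k + k → count δ xs < k →
    Σ[ j ∈ ℕ ] Σ[ as ∈ List V ] Σ[ u ∈ V ] Σ[ v ∈ V ] Σ[ bs ∈ List V ]
      (xs ≡ as ++ u ∷ v ∷ bs × length as ≡ j + j × δ u ≡ false × δ v ≡ false)
  evenPair δ (suc k) []           l h = case l of λ ()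
  evenPair δ (suc k) (a ∷ [])     l h = case trans l (cong suc (+-suc k k)) of λ ()
  evenPair δ (suc k) (a ∷ b ∷ xs) l h with δ a in ea | δ b in eb
  ... | false | false = 0 , [] , a , b , xs , refl , refl , ea , eb
  ... | true  | d = step (evenPair δ k xs (suc-injective (suc-injective (trans l (cong suc (+-suc k k)))))
                        (≤-trans (s≤s (m≤n+m _ (b2n d))) (s≤s⁻¹ h)))
    where
    step : _ → _
    step (j , as , u , v , bs , refl , l′ , eu , ev) =
      suc j , a ∷ b ∷ as , u , v , bs , refl , cong suc (trans (cong suc l′) (sym (+-suc j j))) , eu , ev
  ... | false | true = step (evenPair δ k xs (suc-injective (suc-injective (trans l (cong suc (+-suc k k))))) (s≤s⁻¹ h))
    where
    step : _ → _
    step (j , as , u , v , bs , refl , l′ , eu , ev) =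
      suc j , a ∷ b ∷ as , u , v , bs , refl , cong suc (trans (cong suc l′) (sym (+-suc j j))) , eu , ev

  flip : ℕ → Bool → Bool
  flip zero    b = b
  flip (suc k) b = not (flip k b)

  flip-not : ∀ k b → flip k (not b) ≡ not (flip k b)
  flip-not zero    b = refl
  flip-not (suc k) b = cong not (flip-not k b)

  flip-even : ∀ j b → flip (j + j) b ≡ b
  flip-even zero    b = refl
  flip-even (suc j) b rewrite +-suc j j | flip-even j b with b
  ... | true  = refl
  ... | false = refl

  side-Ch : ∀ {x y} xs → Ch Alt x xs y → side y ≡ flip (suc (length xs)) (side x)
  side-Ch []       c = c
  side-Ch {x} {y} (z ∷ zs) (e , c) = trans (side-Ch zs c) (trans (cong (flip (suc (length zs))) e) (flip-not (suc (length zs)) (side x)))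

  isD : V → V → Bool
  isD q x = same x q

  Arr : List V → List V → Set
  Arr zs ws = Cyc Alt ws × ws ≋ zs

  rotated : ∀ zs → 2 ≤ length zs → Cyc Alt zs → 1 ≤ badC zs →
    Σ[ q ∈ V ] Σ[ ms ∈ List V ] Σ[ p ∈ V ]
      (Arr zs (q ∷ ms ++ p ∷ []) × badC (q ∷ ms ++ p ∷ []) ≡ badC zs × same p q ≡ true)
  rotated (x ∷ xs) l c b with find xs b
  rotated (x ∷ xs) l c b | inj₁ ([] , p , refl , t) = case l of λ { (s≤s ()) }
  rotated (x ∷ xs) l c b | inj₁ (q ∷ ms , p , eq , t) =
    q , ms , p , (subst (Cyc Alt) eq c , subst (_≋ x ∷ xs) eq ≋-refl) , cong badC (sym eq) ,
    subst (λ z → same p z ≡ true) (∷-injectiveˡ eq) t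
  rotated (x ∷ xs) l c b | inj₂ (as , p , q , bs , eq , t) =
    q , bs ++ as , p , (subst (Cyc Alt) shape (Cyc-rotate (as ++ [ p ]₁) (q ∷ bs) (subst (Cyc Alt) eq′ c)) , pm) ,
    trans (cong badC (sym shape)) (trans (sym (bad-rotate (as ++ [ p ]₁) (q ∷ bs))) (cong badC (sym eq′))) , t
    where
    eq′ : x ∷ xs ≡ (as ++ [ p ]₁) ++ q ∷ bs
    eq′ = trans eq (sym (++-assoc as [ p ]₁ (q ∷ bs)))
    shape : (q ∷ bs) ++ as ++ [ p ]₁ ≡ q ∷ (bs ++ as) ++ p ∷ []
    shape = cong (q ∷_) (sym (++-assoc bs as [ p ]₁))
    pm : q ∷ (bs ++ as) ++ p ∷ [] ≋ x ∷ xs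
    pm = subst₂ _≋_ shape (sym eq′) (≋-swap (q ∷ bs) (as ++ [ p ]₁))

  snoc : ∀ {u v p q : V} as (bs ms : List V) → q ∷ ms ++ p ∷ [] ≡ as ++ u ∷ v ∷ bs → u ≢ q → v ≢ p →
    Σ[ as′ ∈ List V ] Σ[ bs′ ∈ List V ] (as ≡ q ∷ as′ × bs ≡ bs′ ++ p ∷ [])
  snoc []       bs ms eq n m = ⊥-elim (n (sym (∷-injectiveˡ eq)))
  snoc {u} {v} {p} {q} (a ∷ as) bs ms eq n m with ∷-injectiveˡ eq | initLast bs
  ... | refl | [] = ⊥-elim (m (sym (∷ʳ-injectiveʳ (q ∷ ms) (a ∷ as ++ [ u ]₁) (trans eq (sym (++-assoc (a ∷ as) [ u ]₁ [ v ]₁))))))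
  ... | refl | bs′ ∷ʳ′ p′ with ∷ʳ-injectiveʳ (q ∷ ms) (a ∷ as ++ u ∷ v ∷ bs′)
                               (trans eq (sym (++-assoc (a ∷ as) (u ∷ v ∷ bs′) [ p′ ]₁)))
  ...   | refl = as , bs′ , refl , refl

  -- After rotation the bad pair consists of `p` (last) and `q` (first). Take consecutive `u`, `v`
  -- outside their class with `u` on the side of `q`. Reversing the segment from `q` to `u` replaces
  -- the pairs pq and uv by pu and qv: alternation is kept and neither new pair is bad.
  improve : ∀ k zs → length zs ≡ k + k → 2 ≤ length zs → (∀ q → count (isD q) zs < k) → Cyc Alt zs → 1 ≤ badC zs →
    Σ[ ws ∈ List V ] (Arr zs ws × badC ws < badC zs)
  improve k zs l l2 d c b with rotated zs l2 c b
  ... | q , ms , p , (c′ , pm) , be , t with evenPair (isD q) k (q ∷ ms ++ p ∷ []) (trans (≋-length pm) l)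
                                            (subst (_< k) (sym (≋at pm (isD q))) (d q))
  ...   | j , as , u , v , bs , eq , le , eu , ev with snoc as bs ms eq
            (λ { refl → case trans (sym eu) (dec-true (cls q ℕₚ.≟ cls q) refl) of λ () })
            (λ { refl → case trans (sym ev) t of λ () })
  ...     | as′ , bs′ , refl , refl = new , (cyc , pm′) , subst (badC new <_) (trans (cong badC (sym eq)) be) fewer
    where
    new = u ∷ reverse as′ ++ q ∷ v ∷ bs′ ++ p ∷ []
    C : Ch Alt q (as′ ++ u ∷ v ∷ bs′ ++ p ∷ []) q
    C = subst (Cyc Alt) eq c′
    C₁ : Ch Alt q as′ u
    C₁ = proj₁ (Ch-split as′ C)
    C₂ : Alt u v × Ch Alt v (bs′ ++ p ∷ []) q
    C₂ = proj₂ (Ch-split as′ C)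
    C₃ : Ch Alt v bs′ p × Alt p q
    C₃ = Ch-split bs′ (proj₂ C₂)
    uq : side u ≡ side q
    uq = trans (side-Ch as′ C₁) (trans (cong (λ i → flip i (side q)) le) (flip-even j (side q)))
    cyc : Cyc Alt new
    cyc = Ch-++ (reverse as′) (Ch-rev (λ {x} {y} → Alt-sym {x} {y}) as′ C₁)
            (subst (λ z → side v ≡ not z) uq (proj₁ C₂) ,
             Ch-++ bs′ (proj₁ C₃) (trans uq (proj₂ C₃)))
    pm′ : new ≋ zs
    pm′ = ≋-trans (perm ([ u ]₁ ▸ as′ ▸ [ q ]₁ ▸ ([ v ]₁ ++ bs′ ++ [ p ]₁) ▸ ε) (v0 ∪ rv v1 ∪ v2 ∪ v3) (v2 ∪ v1 ∪ v0 ∪ v3) refl)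
                  (subst (_≋ zs) eq pm)
    fewer : badC new < badC (q ∷ as′ ++ u ∷ v ∷ bs′ ++ p ∷ [])
    fewer rewrite bad-++ {u} {q} {u} (reverse as′) (v ∷ bs′ ++ p ∷ []) | bad-rev {q} {u} as′
               | bad-++ {v} {p} {u} bs′ [] | bad-++ {q} {u} {q} as′ (v ∷ bs′ ++ p ∷ []) | bad-++ {v} {p} {q} bs′ [] | t
               | same-sym q v | ev
               | trans (cong (λ z → does (z ℕₚ.≟ cls u)) (does⇒ (cls p ℕₚ.≟ cls q) t)) (trans (same-sym q u) eu) =
      +-monoʳ-< (bad q as′ u) (≤-trans (s≤s (≤-reflexive (+-identityʳ _))) (≤-trans (≤-reflexive (+-comm 1 _)) (m≤n+m _ (b2n (same u v)))))

  arrange : ∀ f k zs → length zs ≡ k + k → 2 ≤ length zs → (∀ q → count (isD q) zs < k) → Cyc Alt zs → badC zs ≤ f →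
    Σ[ ws ∈ List V ] (Cyc Good ws × ws ≋ zs)
  arrange f k (x ∷ xs) l l2 d c b with badC (x ∷ xs) in e
  ... | zero  = x ∷ xs , good xs c e , ≋-refl
  arrange (suc f) k zs@(x ∷ xs) l l2 d c (s≤s b) | suc m with improve k zs l l2 d c (subst (1 ≤_) (sym e) (s≤s z≤n))
  ...   | ws , (c′ , pm) , lt with arrange f k ws (trans (≋-length pm) l) (subst (2 ≤_) (sym (≋-length pm)) l2)
              (λ q → subst (_< k) (sym (≋at pm (isD q))) (d q)) c′ (≤-trans (s≤s⁻¹ (subst (badC ws <_) e lt)) b)
  ...     | ws′ , g , pm′ = ws′ , g , ≋-trans pm′ pm

-- The interleaving of `as` and `bs` alternates but may have neighbours in one class. Each class has
-- fewer than n of the 2n vertices, so such neighbours can be removed one after the other.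
bipartite : ∀ {M n} (cls : Fin M → ℕ) (as bs : List (Fin M)) → 1 ≤ n → length as ≡ n → length bs ≡ n → U (as ++ bs) →
  (∀ d → count (λ x → does (cls x ℕₚ.≟ d)) (as ++ bs) < n) →
  {E : Fin M → Fin M → Set} → (∀ {x y} → E x y → E y x) → (∀ {a b} → a ∈ as → b ∈ bs → cls a ≢ cls b → E a b) →
  Σ[ zs ∈ List (Fin M) ] (Cyc E zs × zs ≋ as ++ bs)
bipartite {M} {n} cls as bs n≥1 la lb u d {E} sy h =
  ws , Cyc-map∈ (_∈ as ++ bs) conv ws (λ { ys v zs e → ≋-∈ (≋-trans (subst (_≋ _) e pm) (interleave-≋ as bs)) (∈-mid ys v zs) })
         (proj₁ (proj₂ arranged)) , ≋-trans pm (interleave-≋ as bs)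
  where
  side : Fin M → Bool
  side x = does (1 ≤? count (x ==_) as)
  open Bipartite side cls
  len : length (interleave as bs) ≡ n + n
  len = trans (≋-length (interleave-≋ as bs)) (trans (length-++ as) (cong₂ _+_ la lb))
  inA : ∀ {x} → x ∈ as → side x ≡ true
  inA {x} (mem m) = dec-true (1 ≤? count (x ==_) as) m
  inB : ∀ {x} → x ∈ bs → side x ≡ false
  inB {x} m = dec-false (1 ≤? count (x ==_) as) λ k → ∉-both as bs u (mem k) m
  alt : ∀ {a b} → a ∈ as → b ∈ bs → Alt a b × Alt b a
  alt a b rewrite inA a | inB b = refl , refl
  arranged : Σ[ ws ∈ List (Fin M) ] (Cyc Good ws × ws ≋ interleave as bs)
  arranged = arrange (badC (interleave as bs)) n (interleave as bs) len (subst (2 ≤_) (sym len) (+-mono-≤ n≥1 n≥1))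
    (λ q → subst (_< n) (sym (≋at (interleave-≋ as bs) _)) (d (cls q)))
    (interleave-Cyc as bs (subst (1 ≤_) (sym la) n≥1) (trans la (sym lb)) alt) ≤-refl
  ws : List (Fin M)
  ws = proj₁ arranged
  pm : ws ≋ interleave as bs
  pm = proj₂ (proj₂ arranged)
  conv : ∀ {x y} → x ∈ as ++ bs → y ∈ as ++ bs → Good x y → E x y
  conv {x} {y} mx my (a , n) with ∈-++⁻ as mx | ∈-++⁻ as my
  ... | inj₁ xa | inj₂ yb = h xa yb n
  ... | inj₂ xb | inj₁ ya = sy (h ya xb (n ∘ sym))
  ... | inj₁ xa | inj₁ ya = case trans (sym (inA ya)) (trans a (cong not (inA xa))) of λ ()
  ... | inj₂ xb | inj₂ yb = case trans (sym (inB yb)) (trans a (cong not (inB xb))) of λ ()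

-- Paths and depth-first search

Path : {A : Set} → (A → A → Set) → List A → Set
Path E []           = ⊤
Path E (x ∷ [])     = ⊤
Path E (x ∷ y ∷ xs) = E x y × Path E (y ∷ xs)

final : {A : Set} → A → List A → A
final x []       = x
final x (y ∷ ys) = final y ys

final-∈ : ∀ {M} (x : Fin M) xs → final x xs ∈ x ∷ xs
final-∈ x []       = ∈-here x []
final-∈ x (y ∷ ys) = ∈-there x (final-∈ y ys)

Path-++ˡ : {A : Set} {E : A → A → Set} (xs : List A) {ys : List A} → Path E (xs ++ ys) → Path E xs
Path-++ˡ []           p       = tt
Path-++ˡ (x ∷ [])     p       = tt
Path-++ˡ (x ∷ y ∷ xs) (e , p) = e , Path-++ˡ (y ∷ xs) p

Path-tail : {A : Set} {E : A → A → Set} {x : A} (xs : List A) → Path E (x ∷ xs) → Path E xs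
Path-tail []       p       = tt
Path-tail (y ∷ ys) (e , p) = p

Path-Ch : {A : Set} {E : A → A → Set} {x y : A} (xs : List A) → Path E (x ∷ xs) → E (final x xs) y → Ch E x xs y
Path-Ch []       p       e = e
Path-Ch (z ∷ zs) (d , p) e = d , Path-Ch zs p e

Searched : ∀ {M} → (Fin M → Set) → List (Fin M) → Set
Searched {M} Q xs =
  (Σ[ as ∈ List (Fin M) ] Σ[ w ∈ Fin M ] Σ[ bs ∈ List (Fin M) ] (xs ≡ as ++ w ∷ bs × Q w)) ⊎ (∀ {w} → w ∈ xs → ¬ Q w)

search : ∀ {M} {Q : Fin M → Set} → (∀ x → Dec (Q x)) → (xs : List (Fin M)) → Searched Q xs
search Q? [] = inj₂ λ m → ⊥-elim (∉[] m)
search {Q = Q} Q? (x ∷ xs) with Q? x | search Q? xs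
... | yes q | _ = inj₁ ([] , x , xs , refl , q)
... | no  n | inj₁ (as , w , bs , e , q) = inj₁ (x ∷ as , w , bs , cong (x ∷_) e , q)
... | no  n | inj₂ h = inj₂ λ m → [ (λ e → subst (λ z → ¬ Q z) (sym e) n) , h ]′ (∈-∷⁻ m)

-- Together with `pop-≤`: twice the number of unvisited vertices plus the height of the stack is a
-- measure that every push and every pop lowers by one.
push-≤ : ∀ n p f → suc n + suc n + p ≤ suc f → n + n + suc p ≤ f
push-≤ n p f h = linear 0 h (solve (n ∷ p ∷ f ∷ []))

pop-≤ : ∀ n p f → n + suc p ≤ suc f → n + p ≤ f
pop-≤ n p f h = linear 0 h (solve (n ∷ p ∷ f ∷ []))

-- Depth-first search, stopped when k vertices are finished.
module DFS {M : ℕ} {E : Fin M → Fin M → Set} (E? : ∀ x y → Dec (E x y)) (E-sym : ∀ {x y} → E x y → E y x) where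

  record State (xs : List (Fin M)) (k : ℕ) : Set where
    field
      done stack rest : List (Fin M)
      parts    : done ++ stack ++ rest ≋ xs
      finished : length done ≡ k
      path     : Path E stack
      apart    : ∀ {x y} → x ∈ done → y ∈ rest → ¬ E x y

  run : ∀ f (xs : List (Fin M)) k j D P W → D ++ P ++ W ≋ xs → length D + j ≡ k → k ≤ length xs → Path E P →
    (∀ {x y} → x ∈ D → y ∈ W → ¬ E x y) → length W + length W + length P ≤ f → State xs k
  run f xs k zero D P W pm l lk p a m = record
    { done = D ; stack = P ; rest = W ; parts = pm ; finished = trans (sym (+-identityʳ _)) l ; path = p ; apart = a }
  run f xs k (suc j) D [] [] pm l lk p a m = ⊥-elim (<⇒≱ short lk)
    where
    short : length xs < k
    short = ≤-trans (s≤s (≤-reflexive (trans (sym (≋-length pm)) (cong length (++-identityʳ D)))))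
              (≤-trans (s≤s (m≤m+n _ j)) (≤-reflexive (trans (sym (+-suc _ j)) l)))
  run (suc f) xs k (suc j) D [] (w ∷ W) pm l lk p a m =
    run f xs k (suc j) D (w ∷ []) W pm l lk tt (λ d r → a d (∈-there w r))
      (push-≤ (length W) 0 f m)
  run zero xs k (suc j) D (q ∷ P) W pm l lk p a m = ⊥-elim (n≮0 (≤-trans (m≤n+m _ (length W + length W)) m))
  run (suc f) xs k (suc j) D (q ∷ P) W pm l lk p a m with search (E? q) W
  ... | inj₁ (as , w , bs , refl , e) =
    run f xs k (suc j) D (w ∷ q ∷ P) (as ++ bs)
      (≋-trans (perm (D ▸ [ w ]₁ ▸ (q ∷ P) ▸ as ▸ bs ▸ ε) (v0 ∪ v1 ∪ v2 ∪ v3 ∪ v4) (v0 ∪ v2 ∪ v3 ∪ v1 ∪ v4) refl) pm)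
      l lk (E-sym e , p) (λ d r → a d (∈-⊑ (sub ([ w ]₁ ▸ as ▸ bs ▸ ε) (v1 ∪ v2) (v1 ∪ v0 ∪ v2) v0 refl) r))
      (subst (λ n → n + n + suc (suc (length P)) ≤ f) (sym (length-++ as))
         (push-≤ (length as + length bs) (suc (length P)) f
           (subst (λ n → n + n + suc (length P) ≤ suc f) (trans (length-++ as) (+-suc _ _)) m)))
  ... | inj₂ none =
    run f xs k j (q ∷ D) P W
      (≋-trans (perm (D ▸ [ q ]₁ ▸ P ▸ W ▸ ε) (v1 ∪ v0 ∪ v2 ∪ v3) (v0 ∪ v1 ∪ v2 ∪ v3) refl) pm)
      (trans (sym (+-suc _ j)) l) lk (Path-tail P p)
      (λ d r → [ (λ { refl → none r }) , (λ d′ → a d′ r) ]′ (∈-∷⁻ d))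
      (pop-≤ (length W + length W) (length P) f m)

  dfs : ∀ xs k → k ≤ length xs → State xs k
  dfs xs k lk = run _ xs k k [] [] xs ≋-refl refl lk tt (λ m → ⊥-elim (∉[] m)) ≤-refl

-- Even cycles in two-coloured graphs with twin classes

Cyc-cut : {A : Set} {E : A → A → Set} (pre : List A) {a e : A} (mid post : List A) →
  Cyc E (pre ++ a ∷ mid ++ e ∷ post) → E a e → Cyc E (pre ++ a ∷ e ∷ post)
Cyc-cut {E = E} pre {a} {e} mid post c d = Cyc-rotate (a ∷ e ∷ post) pre (d , proj₂ (Ch-split mid c′))
  where
  c′ : Ch E a (mid ++ e ∷ post ++ pre) a
  c′ = subst (λ zs → Ch E a zs a) (++-assoc mid (e ∷ post) pre) (Cyc-rotate pre (a ∷ mid ++ e ∷ post) c)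

cut-⊑ : {A : Set} (pre : List A) (a e : A) (mid post : List A) → pre ++ a ∷ e ∷ post ⊑ pre ++ a ∷ mid ++ e ∷ post
cut-⊑ pre a e mid post = sub (pre ▸ [ a ]₁ ▸ [ e ]₁ ▸ mid ▸ post ▸ ε) (v0 ∪ v1 ∪ v2 ∪ v4) (v0 ∪ v1 ∪ v3 ∪ v2 ∪ v4) v3 refl

-- a, z₂, z₄, …, then a jump of length three, then back along …, z₅, z₃ = e.
ladder : ∀ {A : Set} {F : A → A → Set} → (∀ {x y} → F x y → F y x) → ∀ k a b d e (r : List A) → k + k ≤ length r →
  (∀ pre {x y z} post → a ∷ b ∷ d ∷ e ∷ r ≡ pre ++ x ∷ y ∷ z ∷ post → F x z) →
  (∀ pre {x y z w} post → a ∷ b ∷ d ∷ e ∷ r ≡ pre ++ x ∷ y ∷ z ∷ w ∷ post → F x w) →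
  Σ[ ms ∈ List A ] (Ch F a ms e × length ms ≡ k + k × a ∷ ms ++ e ∷ [] ⊑ a ∷ d ∷ e ∷ r)
ladder s zero a b d e r l two three =
  [] , three [] r refl , refl , sub ([ a ]₁ ▸ [ d ]₁ ▸ [ e ]₁ ▸ r ▸ ε) (v0 ∪ v2) (v0 ∪ v1 ∪ v2 ∪ v3) (v1 ∪ v3) refl
ladder s (suc k) a b d e (f ∷ [])    l two three = case subst (_≤ 1) (cong suc (+-suc k k)) l of λ { (s≤s ()) }
ladder s (suc k) a b d e (f ∷ g ∷ r) l two three
  with ladder s k d e f g r (s≤s⁻¹ (s≤s⁻¹ (subst (_≤ suc (suc (length r))) (cong suc (+-suc k k)) l)))
         (λ pre post q → two (a ∷ b ∷ pre) post (cong (λ t → a ∷ b ∷ t) q))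
         (λ pre post q → three (a ∷ b ∷ pre) post (cong (λ t → a ∷ b ∷ t) q))
... | ms , c , lm , inc =
  d ∷ ms ++ g ∷ [] , (two [] (e ∷ f ∷ g ∷ r) refl , Ch-++ ms c (s (two (a ∷ b ∷ d ∷ []) r refl))) ,
  cong suc (trans (length-++ ms) (trans (+-comm (length ms) 1) (trans (cong suc lm) (sym (+-suc k k))))) ,
  ⊑-trans (≋⇒⊑ (perm ([ a ]₁ ▸ (d ∷ ms ++ g ∷ []) ▸ [ e ]₁ ▸ ε) (v0 ∪ v1 ∪ v2) (v0 ∪ v2 ∪ v1) refl))
    (⊑-trans (⊑-++ {xs = a ∷ e ∷ []} {a ∷ e ∷ []} {ys′ = d ∷ f ∷ g ∷ r} ⊑-refl inc)
      (≋⇒⊑ (perm ([ a ]₁ ▸ [ d ]₁ ▸ [ e ]₁ ▸ (f ∷ g ∷ r) ▸ ε) (v0 ∪ v2 ∪ v1 ∪ v3) (v0 ∪ v1 ∪ v2 ∪ v3) refl)))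

module TwoColoured {M : ℕ} (cls : Fin M → ℕ) (kol : Fin M → Fin M → Bool)
  (kol-sym : ∀ x y → kol x y ≡ kol y x) (kol-twin : ∀ {x x′} y → cls x ≡ cls x′ → kol x y ≡ kol x′ y) where

  V : Set
  V = Fin M

  -- Pairs inside a class are meant to carry an artificial colour; `Real` leaves them out, and only
  -- its cycles are cycles of the given colouring. Twins agree even towards vertices of their own
  -- class, so they are exchangeable in `E` as well as in `Real`.
  E Real : Bool → V → V → Set
  E c x y    = kol x y ≡ c
  Real c x y = kol x y ≡ c × cls x ≢ cls y

  E? : ∀ c x y → Dec (E c x y)
  E? c x y = kol x y Bool.≟ c

  Real? : ∀ c x y → Dec (Real c x y)
  Real? c x y = E? c x y ×-dec ¬? (cls x ℕₚ.≟ cls y)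

  E-sym : ∀ {c x y} → E c x y → E c y x
  E-sym {c} {x} {y} e = trans (kol-sym y x) e

  Real-sym : ∀ {c x y} → Real c x y → Real c y x
  Real-sym (e , n) = E-sym e , n ∘ sym

  E-twin : ∀ {c x x′ y} → cls x ≡ cls x′ → E c x y → E c x′ y
  E-twin {y = y} t e = trans (sym (kol-twin y t)) e

  Real-twin : ∀ {c x x′ y} → cls x ≡ cls x′ → Real c x y → Real c x′ y
  Real-twin t (e , n) = E-twin t e , n ∘ trans t

  other : ∀ {c x y} → ¬ E c x y → E (not c) x y
  other {c} {x} {y} n with kol x y | c
  ... | true  | true  = ⊥-elim (n refl)
  ... | true  | false = refl
  ... | false | true  = refl
  ... | false | false = ⊥-elim (n refl)

  NoCycle : Bool → ℕ → Set
  NoCycle c ℓ = ∀ zs → length zs ≡ ℓ → U zs → Cyc (Real c) zs → ⊥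

  -- Triples that wrap around the ends of the list are not inspected: the ladder in `chordless` does
  -- not use them either.
  chord? : ∀ c (zs : List V) →
    (Σ[ pre ∈ List V ] Σ[ x ∈ V ] Σ[ y ∈ V ] Σ[ z ∈ V ] Σ[ post ∈ List V ] (zs ≡ pre ++ x ∷ y ∷ z ∷ post × Real c x z)) ⊎
    (∀ pre {x y z} post → zs ≡ pre ++ x ∷ y ∷ z ∷ post → ¬ Real c x z)
  chord? c [] = inj₂ λ { [] _ () ; (_ ∷ _) _ () }
  chord? c (a ∷ []) = inj₂ λ { [] _ () ; (_ ∷ []) _ () ; (_ ∷ _ ∷ _) _ () }
  chord? c (a ∷ b ∷ []) = inj₂ λ { [] _ () ; (_ ∷ []) _ () ; (_ ∷ _ ∷ []) _ () ; (_ ∷ _ ∷ _ ∷ _) _ () }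
  chord? c (a ∷ b ∷ d ∷ r) with Real? c a d | chord? c (b ∷ d ∷ r)
  ... | yes q | _ = inj₁ ([] , a , b , d , r , refl , q)
  ... | no  _ | inj₁ (pre , x , y , z , post , eq , q) = inj₁ (a ∷ pre , x , y , z , post , cong (a ∷_) eq , q)
  ... | no  n | inj₂ h = inj₂ λ { [] post refl → n ; (_ ∷ pre) post eq → h pre post (∷-injectiveʳ eq) }

  -- A cycle of colour `c` on 2j + 2 vertices loses two of them through one chord over two vertices
  -- or two compatible chords over one vertex each. Where neither is available, the pairs at
  -- distances two and three form a ladder of the other colour on 2k + 2 = 2n vertices.
  module Shrink {k j : ℕ} (c : Bool) (k<j : k < j)
    (short : NoCycle c (j + j)) (othr : NoCycle (not c) (suc k + suc k)) where

    Big : List V → Set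
    Big zs = length zs ≡ suc (suc (j + j)) × U zs × Cyc (Real c) zs

    four : ∀ {zs} → Big zs → 4 ≤ length zs
    four (l , _) = subst (4 ≤_) (sym l) (s≤s (s≤s (+-mono-≤ (≤-trans (s≤s z≤n) k<j) (≤-trans (s≤s z≤n) k<j))))

    Big-rotate : ∀ xs ys → Big (xs ++ ys) → Big (ys ++ xs)
    Big-rotate xs ys (l , u , cy) =
      trans (≋-length (≋-swap ys xs)) l , U-⊑ (≋⇒⊑ (≋-swap ys xs)) u , Cyc-rotate xs ys cy

    no-cut : ∀ pre a e mid post → length mid ≡ 2 → Big (pre ++ a ∷ mid ++ e ∷ post) → ¬ Real c a e
    no-cut pre a e mid post lm (l , u , cy) r = short (pre ++ a ∷ e ∷ post) len (U-⊑ (cut-⊑ pre a e mid post) u) (Cyc-cut pre mid post cy r)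
      where
      len : length (pre ++ a ∷ e ∷ post) ≡ j + j
      len = suc-injective (suc-injective (trans (sym (trans (≋-length
        (perm (pre ▸ [ a ]₁ ▸ mid ▸ (e ∷ post) ▸ ε) (v0 ∪ v1 ∪ v2 ∪ v3) (v2 ∪ v0 ∪ v1 ∪ v3) refl))
        (trans (length-++ mid) (cong (_+ length (pre ++ a ∷ e ∷ post)) lm)))) l))

    -- Without a chord between vertices at distance two, all pairs at distance two or three have the other colour.
    chordless : ∀ zs → Big zs → (∀ pre {x y z} post → zs ≡ pre ++ x ∷ y ∷ z ∷ post → ¬ Real c x z) → ⊥
    chordless zs big no2 = build zs refl
      where
      cyc : ∀ pre {x y z} post → zs ≡ pre ++ x ∷ y ∷ z ∷ post → Real c y z
      cyc pre {x} {y} {z} post refl = proj₁ (proj₂ (Cyc-rotate pre (x ∷ y ∷ z ∷ post) (proj₂ (proj₂ big))))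
      three : ∀ pre {x y z w} post → zs ≡ pre ++ x ∷ y ∷ z ∷ w ∷ post → Real (not c) x w
      -- If `x` and `w` were twins, the cycle edge from `z` to `w` would make `z` adjacent to `x`, a
      -- chord over one vertex.
      three pre {x} {y} {z} {w} post eq = other notc , λ t → no2 pre (w ∷ post) eq (Real-twin (sym t) (Real-sym zw))
        where
        zw : Real c z w
        zw = cyc (pre ++ [ x ]₁) post (trans eq (sym (++-assoc pre [ x ]₁ _)))
        notc : ¬ E c x w
        notc e with cls x ℕₚ.≟ cls w
        ... | no  n = no-cut pre x w (y ∷ z ∷ []) post refl (subst Big eq big) (e , n)
        ... | yes t = no2 pre (w ∷ post) eq (Real-twin (sym t) (Real-sym zw))
      -- If `x` and `z` were twins, `x` would share with `z` the neighbour `w`, which is a chord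
      -- over two vertices.
      nottwin : ∀ {x y z} r → Big (x ∷ y ∷ z ∷ r) → cls x ≢ cls z
      nottwin [] b t = case four b of λ { (s≤s (s≤s (s≤s ()))) }
      nottwin {x} {y} {z} (w ∷ r) b t =
        no-cut [] x w (y ∷ z ∷ []) r refl b (Real-twin (sym t) (proj₁ (proj₂ (proj₂ (proj₂ (proj₂ b))))))
      two : ∀ pre {x y z} post → zs ≡ pre ++ x ∷ y ∷ z ∷ post → Real (not c) x z
      two pre {x} {y} {z} post eq = other notc , twin
        where
        twin : cls x ≢ cls z
        twin = nottwin (post ++ pre) (Big-rotate pre (x ∷ y ∷ z ∷ post) (subst Big eq big))
        notc : ¬ E c x z
        notc e = no2 pre post eq (e , twin)
      build : ∀ ys → zs ≡ ys → ⊥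
      build (a ∷ b ∷ d ∷ e ∷ r) refl =
        let (ms , ch , lm , inc) = ladder Real-sym k a b d e r k≤r two three
        in othr (a ∷ ms ++ e ∷ [])
             (cong suc (trans (length-++ ms) (trans (+-comm (length ms) 1) (trans (cong suc lm) (sym (+-suc k k))))))
             (U-⊑ (⊑-trans inc (cut-⊑ [] a d [ b ]₁ (e ∷ r))) (proj₁ (proj₂ big)))
             (Ch-++ ms ch (Real-sym (three [] r refl)))
        where
        k≤r : k + k ≤ length r
        k≤r = +-cancelˡ-≤ 2 _ _ (≤-trans (≤-reflexive (cong suc (sym (+-suc k k))))
               (≤-trans (+-mono-≤ k<j k<j) (≤-reflexive (sym (suc-injective (suc-injective (proj₁ big)))))))
      build []               refl = case four big of λ ()
      build (_ ∷ [])         refl = case four big of λ { (s≤s ()) }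
      build (_ ∷ _ ∷ [])     refl = case four big of λ { (s≤s (s≤s ())) }
      build (_ ∷ _ ∷ _ ∷ []) refl = case four big of λ { (s≤s (s≤s (s≤s ()))) }

    no-big : ∀ zs → ¬ Big zs
    no-big zs big with chord? c zs
    ... | inj₂ none = chordless zs big none
    ... | inj₁ (pre , x , y , z , post , refl , xz) = split (chord? c (ys ++ [ y ]₁))
      where
      ys = z ∷ (post ++ pre) ++ [ x ]₁
      shape : (z ∷ post) ++ pre ++ x ∷ y ∷ [] ≡ ys ++ [ y ]₁
      shape = trans (cong (z ∷_) (sym (++-assoc post pre (x ∷ y ∷ []))))
                (cong (z ∷_) (sym (++-assoc (post ++ pre) [ x ]₁ [ y ]₁)))
      big₁ : Big (ys ++ [ y ]₁)
      big₁ = subst Big shape (Big-rotate (pre ++ x ∷ y ∷ []) (z ∷ post)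
               (subst Big (sym (++-assoc pre (x ∷ y ∷ []) (z ∷ post))) big))
      -- Leaving out y still gives a cycle, so a further chord inside it would skip two vertices.
      cyc : Cyc (Real c) ys
      cyc = Cyc-rotate [ x ]₁ (z ∷ post ++ pre)
              (Cyc-cut [] [ y ]₁ (post ++ pre) (Cyc-rotate pre (x ∷ y ∷ z ∷ post) (proj₂ (proj₂ big))) xz)
      inner : ∀ p a b d q → ys ≡ p ++ a ∷ b ∷ d ∷ q → Real c a d → ⊥
      inner p a b d q eq r = short (p ++ a ∷ d ∷ q) len
        (U-⊑ (⊑-trans (subst (p ++ a ∷ d ∷ q ⊑_) (sym eq) (cut-⊑ p a d [ b ]₁ q)) (⊑-++ˡ ys [ y ]₁)) (proj₁ (proj₂ big₁)))
        (Cyc-cut p [ b ]₁ q (subst (Cyc (Real c)) eq cyc) r)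
        where
        len : length (p ++ a ∷ d ∷ q) ≡ j + j
        len = suc-injective (suc-injective (trans (trans (cong suc (sym (≋-length
                (perm (p ▸ [ a ]₁ ▸ [ b ]₁ ▸ (d ∷ q) ▸ ε) (v0 ∪ v1 ∪ v2 ∪ v3) (v2 ∪ v0 ∪ v1 ∪ v3) refl))))
                (trans (cong suc (sym (cong length eq))) (trans (+-comm 1 _) (sym (length-++ ys))))) (proj₁ big₁)))
      split : _ → ⊥
      split (inj₂ none) = chordless (ys ++ [ y ]₁) big₁ none
      split (inj₁ (p , a , b , d , q , eq , r)) with initLast q
      ... | q′ ∷ʳ′ t = inner p a b d q′ (∷ʳ-injectiveˡ ys _ (trans eq (sym (++-assoc p (a ∷ b ∷ d ∷ q′) [ t ]₁)))) r
      -- This chord ends at `d`, which is `y`, and skips `b`, which is `x`. The second search starts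
      -- from `d`: a chord found later in the list lies within `ys`.
      ... | [] = split₂ (chord? c (d ∷ p ++ a ∷ b ∷ []))
        where
        eq′ : ys ++ [ y ]₁ ≡ (p ++ a ∷ b ∷ []) ++ [ d ]₁
        eq′ = trans eq (sym (++-assoc p (a ∷ b ∷ []) [ d ]₁))
        ys≡ : ys ≡ p ++ a ∷ b ∷ []
        ys≡ = ∷ʳ-injectiveˡ ys _ eq′
        big₂ : Big (d ∷ p ++ a ∷ b ∷ [])
        big₂ = Big-rotate (p ++ a ∷ b ∷ []) [ d ]₁ (subst Big eq′ big₁)
        split₂ : _ → ⊥
        split₂ (inj₂ none) = chordless _ big₂ none
        split₂ (inj₁ (e ∷ p₂ , a₂ , b₂ , d₂ , q₂ , eq₂ , r₂)) = inner p₂ a₂ b₂ d₂ q₂ (trans ys≡ (∷-injectiveʳ eq₂)) r₂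
        split₂ (inj₁ ([] , a₂ , b₂ , d₂ , q₂ , eq₂ , r₂)) with ∷-injectiveˡ eq₂ | initLast q₂
        ... | refl | [] = case subst (4 ≤_) (cong length eq₂) (four big₂) of λ { (s≤s (s≤s (s≤s ()))) }
        -- Both chords meet at `d` and skip its two neighbours on the cycle, so they can be used
        -- together.
        ... | refl | q₃ ∷ʳ′ t = short (d ∷ d₂ ∷ q₃) len
              (U-⊑ (⊑-trans (cut-⊑ [] d d₂ [ b₂ ]₁ q₃) (subst (_⊑ d ∷ p ++ a ∷ b ∷ []) (cong (d ∷_) pa≡)
                (sub ([ d ]₁ ▸ p ▸ [ a ]₁ ▸ [ b ]₁ ▸ ε) (v0 ∪ v1 ∪ v2) (v0 ∪ v1 ∪ v2 ∪ v3) v3 refl))) (proj₁ (proj₂ big₂)))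
              (Cyc-cut [] [ b₂ ]₁ q₃ (subst (λ w → Cyc (Real c) (d ∷ w)) pa≡
                (Cyc-rotate [ a ]₁ (d ∷ p) (Cyc-cut [] [ b ]₁ p (Cyc-rotate (d ∷ p) (a ∷ b ∷ []) (proj₂ (proj₂ big₂))) r))) r₂)
          where
          pa≡ : p ++ [ a ]₁ ≡ b₂ ∷ d₂ ∷ q₃
          pa≡ = ∷ʳ-injectiveˡ (p ++ [ a ]₁) _ (trans (++-assoc p [ a ]₁ [ b ]₁) (∷-injectiveʳ eq₂))
          len : length (d ∷ d₂ ∷ q₃) ≡ j + j
          len = suc-injective (suc-injective (trans (cong (λ i → suc (suc (suc i))) (sym (trans (length-++ q₃) (+-comm (length q₃) 1))))
                  (trans (sym (cong length eq₂)) (proj₁ big₂))))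

  -- Descent from length 2j + 2 to 2j. It runs separately in each colour, since `Shrink` refers to
  -- the other colour only at length 2n.
  no-even : ∀ {k} → (∀ c → NoCycle c (suc k + suc k)) → ∀ i c → NoCycle c ((i + suc k) + (i + suc k))
  no-even h zero    c = h c
  no-even {k} h (suc i) c zs l u cy =
    Shrink.no-big c (m≤n+m (suc k) i) (no-even h i c) (h (not c)) zs
      (trans l (cong suc (+-suc (i + suc k) (i + suc k))) , u , cy)

-- Odd cycles: marked vertices with common outside neighbours

parity : ∀ l → (Σ[ i ∈ ℕ ] l ≡ i + i) ⊎ (Σ[ i ∈ ℕ ] l ≡ suc (i + i))
parity zero    = inj₁ (0 , refl)
parity (suc l) with parity l
... | inj₁ (i , refl) = inj₂ (i , refl)
... | inj₂ (i , refl) = inj₁ (suc i , cong suc (sym (+-suc i i)))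

long-arc : ∀ p q i m → (p + suc ((i + i) + suc q)) ≡ suc (m + m) → Σ[ j ∈ ℕ ] (p + q + 3 ≡ j + j × suc m ≡ j + i)
long-arc p q i m e = suc m ∸ i , double , m≡
  where
  2i≤ : i + i ≤ m + m
  2i≤ = linear (p + q + 1) (≤-reflexive e) (solve (p ∷ q ∷ i ∷ m ∷ []))
  half : ∀ i m → i + i ≤ m + m → i ≤ m
  half i m h with i ≤? m
  ... | yes a = a
  ... | no  n = ⊥-elim (<⇒≱ (+-mono-<-≤ (≰⇒> n) (<⇒≤ (≰⇒> n))) h)
  m≡ : suc m ≡ (suc m ∸ i) + i
  m≡ = sym (m∸n+n≡m (m≤n⇒m≤1+n (half i m 2i≤)))
  double : p + q + 3 ≡ (suc m ∸ i) + (suc m ∸ i)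
  double = +-cancelʳ-≡ (i + i) _ _ (trans (lem p q i) (trans (cong suc e) (trans (lem₂ m) (trans (cong₂ _+_ m≡ m≡) (lem₃ (suc m ∸ i) i)))))
    where
    lem : ∀ p q i → p + q + 3 + (i + i) ≡ suc (p + suc ((i + i) + suc q))
    lem = solve-∀
    lem₂ : ∀ m → suc (suc (m + m)) ≡ suc m + suc m
    lem₂ = solve-∀
    lem₃ : ∀ a i → a + i + (a + i) ≡ a + a + (i + i)
    lem₃ = solve-∀

walk-ee : ∀ κ e i → κ ≤ e → suc κ ≤ suc (e + i)
walk-ee κ e i h = s≤s (≤-trans h (m≤m+n e i))

walk-eo : ∀ κ e i m k → κ ≤ e → suc m ≤ k + i → suc κ + m ≤ e + i + k
walk-eo κ e i m k h g = linear 0 (h ⊕ g) (solve (κ ∷ e ∷ i ∷ m ∷ k ∷ []))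

walk-oe : ∀ κ e i m k → κ + m ≤ e + k → suc κ + m ≤ suc (e + i) + k
walk-oe κ e i m k h = linear i h (solve (κ ∷ e ∷ i ∷ m ∷ k ∷ []))

walk-oo : ∀ κ e i m k → k ≤ m → κ + m ≤ e + k → suc κ ≤ suc (e + i)
walk-oo κ e i m k g h = linear i (g ⊕ h) (solve (κ ∷ e ∷ i ∷ m ∷ k ∷ []))

walk-end : ∀ κ e m k → κ + m ≤ e + k → suc e ≤ m → suc κ ≤ k
walk-end κ e m k h g = linear 0 (h ⊕ g) (solve (κ ∷ e ∷ m ∷ k ∷ []))

fold-ee : ∀ e i → e + e + suc (suc (i + i)) ≡ suc (e + i) + suc (e + i)
fold-ee = solve-∀
fold-eo : ∀ e i → e + e + suc (i + i) ≡ suc ((e + i) + (e + i))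
fold-eo = solve-∀
fold-oe : ∀ e i → suc (e + e) + suc (suc (i + i)) ≡ suc (suc (e + i) + suc (e + i))
fold-oe = solve-∀
fold-oo : ∀ e i → suc (e + e) + suc (i + i) ≡ suc (e + i) + suc (e + i)
fold-oo = solve-∀

odd-pos : ∀ e a b m → (suc (e + e) + suc a) + b ≡ suc (m + m) → suc e ≤ m
odd-pos e a b m h with suc e ≤? m
... | yes p = p
... | no  n = ⊥-elim (1≰0 (linear (a + b) (s≤s⁻¹ (≰⇒> n) ⊕ s≤s⁻¹ (≰⇒> n) ⊕ ≤-reflexive h) (solve (e ∷ a ∷ b ∷ m ∷ []))))

-- Throughout, n is written suc k.
module Extremal {M : ℕ} (cls : Fin M → ℕ) (kol : Fin M → Fin M → Bool)
  (kol-sym : ∀ x y → kol x y ≡ kol y x) (kol-twin : ∀ {x x′} y → cls x ≡ cls x′ → kol x y ≡ kol x′ y)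
  (k : ℕ) (k≥1 : 1 ≤ k)
  (nc : ∀ c → TwoColoured.NoCycle cls kol kol-sym kol-twin c (suc k + suc k)) where

  open TwoColoured cls kol kol-sym kol-twin public

  even⊥ : ∀ c m zs → suc k ≤ m → length zs ≡ m + m → U zs → Cyc (Real c) zs → ⊥
  even⊥ c m zs h l = no-even nc (m ∸ suc k) c zs (trans l (cong₂ _+_ (sym (m∸n+n≡m h)) (sym (m∸n+n≡m h))))

  -- In an odd cycle without long even detours, vertices with pairwise common neighbours outside the cycle are
  -- never joined by a short odd arc, which leaves room for at most n − 1 of them.
  module Sparse (c : Bool) (m : ℕ) (k≤m : k ≤ m) (xs : List V) (odd : length xs ≡ suc (m + m)) (u : U xs)
    (cyc : Cyc (Real c) xs) (N : V → Bool)
    (common : ∀ {a b} → a ∈ xs → b ∈ xs → N a ≡ true → N b ≡ true → Σ[ z ∈ V ] (¬ (z ∈ xs) × Real c z a × Real c z b)) where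

    -- The outside vertex `z` closes either arc between `a` and `b`. With 2i + 1 vertices in `mid`
    -- the near arc gives a cycle on 2(i + 2) vertices; with 2i, the far arc gives one on 2(m + 1 -
    -- i). Both are even, hence shorter than 2n.
    gap : ∀ pre a mid b post → xs ≡ pre ++ a ∷ mid ++ b ∷ post → N a ≡ true → N b ≡ true →
      (∀ i → length mid ≡ i + i → suc m ≤ k + i) × (∀ i → length mid ≡ suc (i + i) → suc (suc i) ≤ k)
    gap pre a mid b post eq na nb = odd-arc , even-arc
      where
      a∈ : a ∈ xs
      a∈ = subst (a ∈_) (sym eq) (∈-mid pre a _)
      b∈ : b ∈ xs
      b∈ = subst (b ∈_) (sym eq) (∈-++ʳ pre (∈-there a (∈-mid mid b post)))
      z = proj₁ (common a∈ b∈ na nb)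
      z∉ = proj₁ (proj₂ (common a∈ b∈ na nb))
      za = proj₁ (proj₂ (proj₂ (common a∈ b∈ na nb)))
      zb = proj₂ (proj₂ (proj₂ (common a∈ b∈ na nb)))
      rot : Cyc (Real c) (a ∷ mid ++ b ∷ post ++ pre)
      rot = subst (λ ys → Cyc (Real c) (a ∷ ys)) (++-assoc mid (b ∷ post) pre)
              (Cyc-rotate pre (a ∷ mid ++ b ∷ post) (subst (Cyc (Real c)) eq cyc))
      inner : Ch (Real c) a mid b
      inner = proj₁ (Ch-split mid rot)
      outer : Ch (Real c) b (post ++ pre) a
      outer = proj₂ (Ch-split mid rot)
      uz : ∀ ys → ys ⊑ xs → U (z ∷ ys)
      uz ys h = U-∷ (z∉ ∘ ∈-⊑ h) (U-⊑ h u)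
      sub₁ : a ∷ mid ++ b ∷ [] ⊑ xs
      sub₁ = subst (a ∷ mid ++ b ∷ [] ⊑_) (sym eq)
               (sub (pre ▸ [ a ]₁ ▸ mid ▸ [ b ]₁ ▸ post ▸ ε) (v1 ∪ v2 ∪ v3) (v0 ∪ v1 ∪ v2 ∪ v3 ∪ v4) (v0 ∪ v4) refl)
      sub₂ : b ∷ (post ++ pre) ++ a ∷ [] ⊑ xs
      sub₂ = subst (b ∷ (post ++ pre) ++ a ∷ [] ⊑_) (sym eq)
               (sub (pre ▸ [ a ]₁ ▸ mid ▸ [ b ]₁ ▸ post ▸ ε) (v3 ∪ (v4 ∪ v0) ∪ v1) (v0 ∪ v1 ∪ v2 ∪ v3 ∪ v4) v2 refl)
      even-arc : ∀ i → length mid ≡ suc (i + i) → suc (suc i) ≤ k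
      even-arc i l with suc (suc i) ≤? k
      ... | yes p = p
      ... | no  n = ⊥-elim (even⊥ c (suc (suc i)) (z ∷ a ∷ mid ++ b ∷ []) (≰⇒> n)
              (cong suc (cong suc (trans (length-++ mid) (trans (cong (_+ 1) l) (lem i))))) (uz _ sub₁) (za , Ch-++ mid inner (Real-sym zb)))
        where
        lem : ∀ i → suc (i + i) + 1 ≡ i + suc (suc i)
        lem = solve-∀
      odd-arc : ∀ i → length mid ≡ i + i → suc m ≤ k + i
      odd-arc i l with long-arc (length pre) (length post) i m
                         (trans (sym (trans (length-++ pre) (cong (λ t → length pre + suc t) (trans (length-++ mid) (cong (_+ suc (length post)) l)))))
                                (trans (sym (cong length eq)) odd))
      ... | j , dbl , mj with suc k ≤? j
      ...   | no  n = subst (_≤ k + i) (sym mj) (+-monoˡ-≤ i (s≤s⁻¹ (≰⇒> n)))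
      ...   | yes p = ⊥-elim (even⊥ c j (z ∷ b ∷ (post ++ pre) ++ a ∷ []) p len (uz _ sub₂) (zb , Ch-++ (post ++ pre) outer (Real-sym za)))
        where
        len : length (z ∷ b ∷ (post ++ pre) ++ a ∷ []) ≡ j + j
        len = trans (cong (λ t → suc (suc t)) (trans (length-++ (post ++ pre)) (cong (_+ 1) (length-++ post))))
                (trans (lem (length pre) (length post)) dbl)
          where
          lem : ∀ p q → suc (suc (q + p + 1)) ≡ p + q + 3
          lem = solve-∀

    -- `front` runs from the first marked vertex up to, but excluding, the current one and contains
    -- `κ` marked vertices. At an even distance `κ` is at most half of it; at an odd distance the
    -- long arc that changed the parity lowers this bound by m - k.
    data Pos (front : List V) (κ : ℕ) : Set where
      evenP : ∀ e → length front ≡ e + e → κ ≤ e → Pos front κ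
      oddP  : ∀ e → length front ≡ suc (e + e) → κ + m ≤ e + k → Pos front κ

    Starts : List V → Set
    Starts []      = ⊤
    Starts (x ∷ _) = N x ≡ true

    next : ∀ pre front last mid x rest κ → xs ≡ pre ++ front ++ last ∷ mid ++ x ∷ rest → N last ≡ true → N x ≡ true →
      Pos front κ → Pos (front ++ last ∷ mid) (suc κ)
    next pre front last mid x rest κ eq nl nx pos
      with gap (pre ++ front) last mid x rest (trans eq (sym (++-assoc pre front _))) nl nx | parity (length mid)
    next pre front last mid x rest κ eq nl nx (evenP e l h) | oa , ea | inj₁ (i , lm) =
      oddP (e + i) (trans (length-++ front) (trans (cong₂ (λ a b → a + suc b) l lm) (fold-eo e i))) (walk-eo κ e i m k h (oa i lm))
    next pre front last mid x rest κ eq nl nx (evenP e l h) | oa , ea | inj₂ (i , lm) =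
      evenP (suc (e + i)) (trans (length-++ front) (trans (cong₂ (λ a b → a + suc b) l lm) (fold-ee e i))) (walk-ee κ e i h)
    next pre front last mid x rest κ eq nl nx (oddP e l h) | oa , ea | inj₁ (i , lm) =
      evenP (suc (e + i)) (trans (length-++ front) (trans (cong₂ (λ a b → a + suc b) l lm) (fold-oo e i))) (walk-oo κ e i m k k≤m h)
    next pre front last mid x rest κ eq nl nx (oddP e l h) | oa , ea | inj₂ (i , lm) =
      oddP (suc (e + i)) (trans (length-++ front) (trans (cong₂ (λ a b → a + suc b) l lm) (fold-oe e i))) (walk-oe κ e i m k h)

    finish : ∀ pre front last mid κ → xs ≡ pre ++ front ++ last ∷ mid → N last ≡ true → Starts front → Pos front κ → suc κ ≤ k
    finish pre front last mid κ eq nl st (oddP e l h) =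
      walk-end κ e m k h (odd-pos e (length mid) (length pre) m
        (trans (trans (+-comm _ (length pre)) (sym (trans (length-++ pre) (cong (length pre +_) (trans (length-++ front) (cong (_+ suc (length mid)) l))))))
               (trans (sym (cong length eq)) odd)))
    finish pre [] last mid κ eq nl st (evenP zero l h) = ≤-trans (s≤s h) k≥1
    -- The first and the last marked vertex are themselves subject to `gap`; at an even distance
    -- this bounds the distance, hence `κ`.
    finish pre (a ∷ front) last mid κ eq nl st (evenP (suc e) l h) =
      ≤-trans (s≤s h) (proj₂ (gap pre a front last mid eq st nl) e (trans (suc-injective l) (+-suc e e)))

    walk : ∀ rest pre front last mid κ → xs ≡ pre ++ front ++ last ∷ mid ++ rest → N last ≡ true → Starts front → Pos front κ →
      suc κ + count N rest ≤ k
    walk [] pre front last mid κ eq nl st pos rewrite +-identityʳ κ =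
      finish pre front last mid κ (trans eq (cong (λ t → pre ++ front ++ last ∷ t) (++-identityʳ mid))) nl st pos
    walk (x ∷ rest) pre front last mid κ eq nl st pos with N x in nx
    ... | true = subst (_≤ k) (sym (cong suc (+-suc κ (count N rest))))
      (walk rest pre (front ++ last ∷ mid) x [] (suc κ) (trans eq (cong (pre ++_) (sym (++-assoc front (last ∷ mid) (x ∷ rest))))) nx
        (starts front st) (next pre front last mid x rest κ eq nl nx pos))
      where
      starts : ∀ front → Starts front → Starts (front ++ last ∷ mid)
      starts []      _ = nl
      starts (_ ∷ _) s = s
    ... | false = walk rest pre front last (mid ++ [ x ]₁) κ
      (trans eq (cong (λ t → pre ++ front ++ last ∷ t) (sym (++-assoc mid [ x ]₁ rest)))) nl st pos

    begin-walk : ∀ rest pre → xs ≡ pre ++ rest → count N pre ≡ 0 → count N rest ≤ k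
    begin-walk []         pre eq z = z≤n
    begin-walk (x ∷ rest) pre eq z with N x in nx
    ... | true  = walk rest pre [] x [] 0 eq nx tt (evenP 0 refl z≤n)
    ... | false = begin-walk rest (pre ++ [ x ]₁) (trans eq (sym (++-assoc pre [ x ]₁ rest)))
                    (trans (count-++ N pre [ x ]₁) (cong₂ _+_ z (cong (λ b → b2n b + 0) nx)))

    few : count N xs ≤ k
    few = begin-walk xs [] refl refl

-- Longest cycles

indep-≤ : ∀ {A : Set} (B : A → Bool) (xs : List A) →
  (∀ pre {x y} post → xs ≡ pre ++ x ∷ y ∷ post → B x ≡ true → B y ≡ true → ⊥) →
  count B xs + count B xs ≤ suc (length xs)
indep-≤ B [] h = z≤n
indep-≤ B (x ∷ []) h with B x
... | true  = ≤-refl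
... | false = z≤n
indep-≤ B (x ∷ y ∷ xs) h with B x in bx | B y in by
... | true  | true  = ⊥-elim (h [] xs refl bx by)
... | true  | false rewrite +-suc (count B xs) (count B xs) = s≤s (s≤s (indep-≤ B xs λ pre post e → h (x ∷ y ∷ pre) post (cong (λ t → x ∷ y ∷ t) e)))
... | false | true  rewrite +-suc (count B xs) (count B xs) = s≤s (s≤s (indep-≤ B xs λ pre post e → h (x ∷ y ∷ pre) post (cong (λ t → x ∷ y ∷ t) e)))
... | false | false = m≤n⇒m≤1+n (m≤n⇒m≤1+n (indep-≤ B xs λ pre post e → h (x ∷ y ∷ pre) post (cong (λ t → x ∷ y ∷ t) e)))

escape-≤ : ∀ n l a y → n + n ≤ a + y → a + a ≤ suc l → suc (suc l) + 0 ≤ (n + n) + (n + n) → 1 ≤ y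
escape-≤ n l a zero    h₁ h₂ h₃ = ⊥-elim (1≰0 (linear 0 (h₁ ⊕ h₁ ⊕ h₂ ⊕ h₃) (solve (n ∷ l ∷ a ∷ []))))
escape-≤ n l a (suc y) h₁ h₂ h₃ = s≤s z≤n

clique-Cyc : ∀ {M} {E : Fin M → Fin M → Set} xs → 2 ≤ length xs → U xs →
  (∀ {a b} → a ∈ xs → b ∈ xs → a ≢ b → E a b) → Cyc E xs
clique-Cyc (x ∷ []) (s≤s ()) u h
clique-Cyc {M} {E} (x ∷ y ∷ ys) l u h =
  h (∈-here x _) (∈-there x (∈-here y ys)) (off [ x ]₁ (y ∷ ys) refl (∈-here x []) (∈-here y ys)) , go [ x ]₁ y ys refl (∈-here x [])
  where
  off : ∀ pre {a b} post → x ∷ y ∷ ys ≡ pre ++ post → a ∈ pre → b ∈ post → a ≢ b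
  off pre post e a b refl = ∉-both pre post (subst U e u) a b
  go : ∀ pre z zs → x ∷ y ∷ ys ≡ pre ++ z ∷ zs → x ∈ pre → Ch E z zs x
  go pre z []       e m = h (subst (z ∈_) (sym e) (∈-mid pre z [])) (∈-here x _) (off pre [ z ]₁ e m (∈-here z []) ∘ sym)
  go pre z (w ∷ zs) e m =
    h (subst (z ∈_) (sym e) (∈-mid pre z (w ∷ zs))) (subst (w ∈_) (sym e) (∈-++ʳ pre (∈-there z (∈-here w zs))))
      (off (pre ++ [ z ]₁) (w ∷ zs) e′ (∈-mid pre z []) (∈-here w zs)) , go (pre ++ [ z ]₁) w zs e′ (∈-++ˡ [ z ]₁ m)
    where
    e′ : x ∷ y ∷ ys ≡ (pre ++ [ z ]₁) ++ w ∷ zs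
    e′ = trans e (sym (++-assoc pre [ z ]₁ (w ∷ zs)))

indep-cyc-≤ : ∀ {A : Set} (B : A → Bool) (xs : List A) →
  (∀ pre {x y} post → xs ≡ pre ++ x ∷ y ∷ post → B x ≡ true → B y ≡ true → ⊥) →
  (∀ {x y} mid → xs ≡ x ∷ mid ++ [ y ]₁ → B x ≡ true → B y ≡ true → ⊥) → 2 ≤ length xs →
  count B xs + count B xs ≤ length xs
indep-cyc-≤ B (x ∷ xs) h g l with B x in bx | initLast xs
... | false | _ = indep-≤ B xs λ pre post e → h (x ∷ pre) post (cong (x ∷_) e)
... | true  | [] = case l of λ { (s≤s ()) }
... | true  | ys ∷ʳ′ y with B y in by
...   | true  = ⊥-elim (g ys refl bx by)
...   | false = subst₂ _≤_ (cong (λ a → a + a) cnt) (trans (cong suc (+-comm 1 (length ys))) (cong suc (sym (length-++ ys))))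
        (indep-≤ B (x ∷ ys) λ pre {a} {b} post e → h pre (post ++ [ y ]₁) (trans (cong (_++ [ y ]₁) e) (++-assoc pre (a ∷ b ∷ post) [ y ]₁)))
  where
  cnt : b2n (B x) + count B ys ≡ suc (count B (ys ++ [ y ]₁))
  cnt rewrite bx | count-++ B ys [ y ]₁ | by = cong suc (sym (+-identityʳ _))

half-≤ : ∀ L a b → a + b ≡ L → a + a ≤ L → L ≤ b + b
half-≤ L a b e h = linear 0 (≤-reflexive (sym e) ⊕ h ⊕ ≤-reflexive (sym e)) (solve (L ∷ a ∷ b ∷ []))

no-rest : ∀ L s r → L ≤ s + s → (s + r) + (s + r) ≤ L → r ≡ 0 × s + s ≡ L
no-rest L s zero    h g = refl , ≤-antisym (subst (λ z → z + z ≤ L) (+-identityʳ s) g) h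
no-rest L s (suc r) h g = ⊥-elim (1≰0 (linear (r + r + 1) (h ⊕ g) (solve (L ∷ s ∷ r ∷ []))))

short<n : ∀ L k → L ≤ suc (k + k) → L < suc k + suc k
short<n L k h = linear 0 h (solve (L ∷ k ∷ []))

rest-size : ∀ k L y → L + y ≡ (suc k + suc k) + (suc k + suc k) → L ≤ suc (k + k) → suc (suc k + suc k) ≤ y
rest-size k L y e h = linear 0 (≤-reflexive (sym e) ⊕ h) (solve (k ∷ L ∷ y ∷ []))




enough : ∀ k L j K → suc j + suc j ≡ L → L ≤ suc (k + k) → suc (suc k + suc k) ≤ suc (suc K) → j ≤ K
enough k L j K e h g = linear (j + 2) (≤-reflexive e ⊕ h ⊕ g) (solve (k ∷ L ∷ j ∷ K ∷ []))

count-absent : ∀ {M} (p : Fin M → Bool) xs → (∀ {v} → v ∈ xs → p v ≡ false) → count p xs ≡ 0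
count-absent p []       h = refl
count-absent p (x ∷ xs) h rewrite h (∈-here x xs) = count-absent p xs (h ∘ ∈-there x)

two-long : ∀ k j y → j ≤ k → suc (suc k + suc k) ≤ j + y → 1 ≤ y
two-long k j zero    h g = ⊥-elim (1≰0 (linear (k + 2) (h ⊕ g) (solve (k ∷ j ∷ []))))
two-long k j (suc y) h g = s≤s z≤n

evens odds : {A : Set} → List A → List A
evens (a ∷ b ∷ xs) = a ∷ evens xs
evens xs           = xs
odds (a ∷ b ∷ xs) = b ∷ odds xs
odds xs           = []

evens-odds : {A : Set} (xs : List A) → odds xs ++ evens xs ≋ xs
evens-odds []           = ≋-refl
evens-odds (x ∷ [])     = ≋-refl
evens-odds (x ∷ y ∷ xs) = ≋-trans (perm ([ y ]₁ ▸ odds xs ▸ [ x ]₁ ▸ evens xs ▸ ε) ((v0 ∪ v1) ∪ (v2 ∪ v3)) ((v2 ∪ v0) ∪ (v1 ∪ v3)) refl)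
                            (≋-++ {xs = x ∷ y ∷ []} ≋-refl (evens-odds xs))

two-steps : {A : Set} {F : A → A → Set} (j : ℕ) (a b : A) (mid : List A) (y z : A) → length mid ≡ j + j →
  (∀ pre {p q r} post → a ∷ b ∷ mid ++ y ∷ z ∷ [] ≡ pre ++ p ∷ q ∷ r ∷ post → F p r) →
  Ch F a (evens mid) y × Ch F b (odds mid) z
two-steps j a b [] y z l h = h [] [ z ]₁ refl , h [ a ]₁ [] refl
two-steps zero    a b (d ∷ [])      y z () h
two-steps (suc j) a b (d ∷ [])      y z l  h = case trans (suc-injective l) (+-suc j j) of λ ()
two-steps (suc j) a b (d ∷ e ∷ mid) y z l  h =
  let (p , q) = two-steps j d e mid y z (suc-injective (trans (suc-injective l) (+-suc j j))) (λ pre post eq → h (a ∷ b ∷ pre) post (cong (λ t → a ∷ b ∷ t) eq))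
  in (h [] (e ∷ mid ++ y ∷ z ∷ []) refl , p) , (h [ a ]₁ (mid ++ y ∷ z ∷ []) refl , q)

Ch-head : {A : Set} {E : A → A → Set} {x x′ y : A} (xs : List A) → (∀ {z} → E x z → E x′ z) → Ch E x xs y → Ch E x′ xs y
Ch-head []      f e       = f e
Ch-head (_ ∷ _) f (e , c) = f e , c

odd-half : ∀ a m → a + a ≤ suc (m + m) → a ≤ m
odd-half a m h with a ≤? m
... | yes p = p
... | no  n = ⊥-elim (1≰0 (linear 0 (≰⇒> n ⊕ ≰⇒> n ⊕ h) (solve (a ∷ m ∷ []))))

nbr-outside : ∀ k b y f → suc k + suc k ≤ suc b + y → b ≤ k → f ≡ 0 → suc k ≤ f + y
nbr-outside k b y f h g refl = linear 0 (h ⊕ g) (solve (k ∷ b ∷ y ∷ []))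

share : ∀ k a b y w → suc k ≤ a → suc k ≤ b → y ≤ suc (k + k) → a + b ≤ y + w → 1 ≤ w
share k a b y w h₁ h₂ h₃ h₄ = linear 0 (h₁ ⊕ h₂ ⊕ h₃ ⊕ h₄) (solve (k ∷ a ∷ b ∷ y ∷ w ∷ []))

left-over : ∀ k m y → suc (suc m + suc m) + y ≡ (suc k + suc k) + (suc k + suc k) → k ≤ m → y ≤ suc (k + k)
left-over k m y e h = linear 0 (≤-reflexive e ⊕ h ⊕ h) (solve (k ∷ m ∷ y ∷ []))

left-some : ∀ k m y → suc (suc m + suc m) + y ≡ (suc k + suc k) + (suc k + suc k) → 1 ≤ y
left-some k m (suc y) e = s≤s z≤n
left-some k m zero    e = ⊥-elim (even≢odd (suc k + suc k) (suc m) (trans (lem (suc k)) (trans (sym e) (lem₂ m))))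
  where
  lem : ∀ k → 2 * (k + k) ≡ k + k + (k + k)
  lem = solve-∀
  lem₂ : ∀ m → suc (suc m + suc m) + 0 ≡ suc (2 * suc m)
  lem₂ = solve-∀

unsnoc : {A : Set} (x : A) (xs : List A) → Σ[ ys ∈ List A ] Σ[ z ∈ A ] x ∷ xs ≡ ys ++ [ z ]₁
unsnoc x []       = [] , x , refl
unsnoc x (y ∷ xs) = let (ys , z , e) = unsnoc y xs in x ∷ ys , z , cong (x ∷_) e

halves⊥ : ∀ m a b → a + b ≡ suc (m + m) → a + a ≤ suc (m + m) → b + b ≤ suc (m + m) → ⊥
halves⊥ m a b e h g = 1+n≰n (≤-trans (≤-reflexive (sym e)) (+-mono-≤ (odd-half a m h) (odd-half b m g)))

odd-room : ∀ k m → suc (suc (k + k)) ≤ suc (suc m + suc m) → k ≤ m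
odd-room k m h with k ≤? m
... | yes p = p
... | no  n = ⊥-elim (1≰0 (linear 0 (h ⊕ ≰⇒> n ⊕ ≰⇒> n) (lem k m)))
  where
  lem : ∀ k m → suc (suc m + suc m) + k + k + 1 + 0 ≡ suc (suc (k + k)) + suc m + suc m + 0
  lem = solve-∀

module Climb {M : ℕ} (cls : Fin M → ℕ) (kol : Fin M → Fin M → Bool)
  (kol-sym : ∀ x y → kol x y ≡ kol y x) (kol-twin : ∀ {x x′} y → cls x ≡ cls x′ → kol x y ≡ kol x′ y)
  (k : ℕ) (k≥1 : 1 ≤ k)
  (nc : ∀ c → TwoColoured.NoCycle cls kol kol-sym kol-twin c (suc k + suc k))
  (size : M ≡ (suc k + suc k) + (suc k + suc k))
  (heavy : ∀ x x′ → x ≢ x′ → cls x ≡ cls x′ →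
    suc k + suc k ≤ count (λ y → does (TwoColoured.Real? cls kol kol-sym kol-twin (kol x x′) x y)) (allFin M)) where

  open Extremal cls kol kol-sym kol-twin k k≥1 nc public
  open Bipartite {M} (λ _ → true) cls public using (same; bad; badC; bad-++; bad-rev; bad-rotate; find)

  nb : Bool → V → V → Bool
  nb c x y = does (Real? c x y)

  nb⇒ : ∀ {c x y} → nb c x y ≡ true → Real c x y
  nb⇒ {c} {x} {y} = does⇒ (Real? c x y)

  -- badC counts the consecutive vertices of the same class.
  record Top (c : Bool) (xs : List V) : Set where
    field
      len≥2   : 2 ≤ length xs
      u       : U xs
      cyc     : Cyc (E c) xs
      longer  : ∀ c′ ys → length xs < length ys → U ys → Cyc (E c′) ys → ⊥
      flatter : ∀ ys → length ys ≡ length xs → badC ys < badC xs → U ys → Cyc (E c) ys → ⊥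

  Top-rotate : ∀ {c} xs ys → Top c (xs ++ ys) → Top c (ys ++ xs)
  Top-rotate {c} xs ys t = record
    { len≥2 = subst (2 ≤_) len len≥2 ; u = U-⊑ (≋⇒⊑ (≋-swap ys xs)) u ; cyc = Cyc-rotate xs ys cyc
    ; longer = λ c′ zs l → longer c′ zs (subst (_< length zs) (sym len) l)
    ; flatter = λ zs l b → flatter zs (trans l (sym len)) (subst (badC zs <_) (sym (bad-rotate xs ys)) b) }
    where
    open Top t
    len : length (xs ++ ys) ≡ length (ys ++ xs)
    len = ≋-length (≋-swap xs ys)

  length≤M : ∀ {xs : List V} → U xs → length xs ≤ M
  length≤M {xs} u with outside xs u
  ... | ys , e = ≤-trans (m≤m+n _ (length ys)) (≤-reflexive (trans (sym (length-++ xs)) (trans (≋-length e) length-all)))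

  -- `d` has at least 2n neighbours in the colour `c` of its own class. No two of them are
  -- consecutive in `rest`, so on a cycle with at most 4n vertices they do not all fit, and one
  -- outside can be inserted between `d` and `d′`.
  twins-front : ∀ {c} d d′ rest → Top c (d ∷ d′ ∷ rest) → cls d ≡ cls d′ → ⊥
  twins-front {c} d d′ rest t tw = found (search (λ w → Real? c d w) Y)
    where
    open Top t
    Y = proj₁ (outside (d ∷ d′ ∷ rest) u)
    Yeq : (d ∷ d′ ∷ rest) ++ Y ≋ allFin M
    Yeq = proj₂ (outside (d ∷ d′ ∷ rest) u)
    uY : U ((d ∷ d′ ∷ rest) ++ Y)
    uY = U-⊑ (≋⇒⊑ Yeq) U-all
    d≢ : d ≢ d′
    d≢ refl = ∉-both [ d ]₁ (d ∷ rest) u (∈-here d []) (∈-here d rest)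
    dd : kol d d′ ≡ c
    dd = proj₁ cyc
    chain : Ch (E c) d′ rest d
    chain = proj₂ cyc
    B = nb c d
    -- Reversing the segment between d and a pair of consecutive neighbours of d and d′ separates the twins.
    apart : ∀ pre {x y} post → rest ≡ pre ++ x ∷ y ∷ post → B x ≡ true → B y ≡ true → ⊥
    apart pre {x} {y} post refl bx by =
      flatter new (≋-length pm) fewer (U-⊑ (≋⇒⊑ pm) u)
        (proj₁ (nb⇒ {c} {d} bx) , Ch-++ (reverse pre) (Ch-rev (λ {a} {b} → E-sym {c} {a} {b}) pre c₁)
          (E-twin {c} {d} {d′} {y} tw (proj₁ (nb⇒ {c} {d} by)) , c₂))
      where
      new = d ∷ x ∷ reverse pre ++ d′ ∷ y ∷ post
      c₁ : Ch (E c) d′ pre x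
      c₁ = proj₁ (Ch-split pre chain)
      c₂ : Ch (E c) y post d
      c₂ = proj₂ (proj₂ (Ch-split pre chain))
      pm : new ≋ d ∷ d′ ∷ pre ++ x ∷ y ∷ post
      pm = perm ([ d ]₁ ▸ [ d′ ]₁ ▸ pre ▸ [ x ]₁ ▸ (y ∷ post) ▸ ε) (v0 ∪ v3 ∪ rv v2 ∪ v1 ∪ v4) (v0 ∪ v1 ∪ v2 ∪ v3 ∪ v4) refl
      dx : same d x ≡ false
      dx = dec-false (cls d ℕₚ.≟ cls x) (proj₂ (nb⇒ {c} {d} bx))
      dy : same d′ y ≡ false
      dy = dec-false (cls d′ ℕₚ.≟ cls y) (λ q → proj₂ (nb⇒ {c} {d} by) (trans tw q))
      dd″ : same d d′ ≡ true
      dd″ = dec-true (cls d ℕₚ.≟ cls d′) tw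
      fewer : badC new < badC (d ∷ d′ ∷ pre ++ x ∷ y ∷ post)
      fewer rewrite dx | dd″ | bad-++ {x} {d′} {d} (reverse pre) (y ∷ post) | bad-rev {d′} {x} pre | dy
                  | bad-++ {d′} {x} {d} pre (y ∷ post) =
        s≤s (+-monoʳ-≤ (bad d′ pre x) (m≤n+m _ (b2n (same x y))))
    Bd : B d ≡ false
    Bd = dec-false (Real? c d d) (λ r → proj₂ r refl)
    Bd′ : B d′ ≡ false
    Bd′ = dec-false (Real? c d d′) (λ r → proj₂ r tw)
    total : suc k + suc k ≤ count B rest + count B Y
    total = ≤-trans (subst (λ e → suc k + suc k ≤ count (nb e d) (allFin M)) dd (heavy d d′ d≢ tw))
              (≤-reflexive (trans (sym (≋at Yeq B)) (trans (count-++ B (d ∷ d′ ∷ rest) Y)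
                (cong (_+ count B Y) (trans (cong (λ b → b2n b + (b2n (B d′) + count B rest)) Bd) (cong (λ b → b2n b + count B rest) Bd′))))))
    some : 1 ≤ count B Y
    some = escape-≤ (suc k) (length rest) (count B rest) (count B Y) total (indep-≤ B rest apart)
             (subst₂ _≤_ (sym (+-identityʳ _)) size (length≤M u))
    found : Searched (Real c d) Y → ⊥
    found (inj₂ none) = let (w , w∈ , bw) = count-∈ B Y some in none w∈ (nb⇒ {c} {d} {w} bw)
    found (inj₁ (as , w , bs , eq , e , ne)) =
      longer c (d ∷ w ∷ d′ ∷ rest) ≤-refl
        (U-⊑ (≋⇒⊑ (perm ([ d ]₁ ▸ [ w ]₁ ▸ (d′ ∷ rest) ▸ ε) (v0 ∪ v1 ∪ v2) (v1 ∪ v0 ∪ v2) refl))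
          (U-∷ (λ m → ∉-both (d ∷ d′ ∷ rest) Y uY m (subst (w ∈_) (sym eq) (∈-mid as w bs))) u))
        (e , E-sym {c} {d′} {w} (E-twin {c} {d} {d′} {w} tw e) , chain)

  Top-real : ∀ {c xs} → Top c xs → Cyc (Real c) xs
  Top-real {c} {[]} t = Top.cyc t
  Top-real {c} {x ∷ xs} t with badC (x ∷ xs) in eb
  ... | zero  = real xs (Top.cyc t) eb
    where
    real : ∀ {y z} ys → Ch (E c) y ys z → bad y ys z ≡ 0 → Ch (Real c) y ys z
    real {y} {z} [] e b with same y z in s
    ... | false = e , ¬does⇒ (cls y ℕₚ.≟ cls z) s
    real {y} (w ∷ ys) (e , ch) b with same y w in s
    ... | false = (e , ¬does⇒ (cls y ℕₚ.≟ cls w) s) , real ys ch b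
  ... | suc b with find {x} {x} xs (subst (1 ≤_) (sym eb) (s≤s z≤n))
  ...   | inj₁ ([] , p , refl , s) = case Top.len≥2 t of λ { (s≤s ()) }
  ...   | inj₁ (y ∷ as , p , eq , s) =
    ⊥-elim (twins-front p x as (Top-rotate (x ∷ as) [ p ]₁ (subst (Top c) (trans eq (cong (λ z → z ∷ as ++ [ p ]₁) (sym (∷-injectiveˡ eq)))) t))
      (does⇒ (cls p ℕₚ.≟ cls x) s))
  ...   | inj₂ (as , p , q , bs , eq , s) =
    ⊥-elim (twins-front p q (bs ++ as) (Top-rotate as (p ∷ q ∷ bs) (subst (Top c) eq t)) (does⇒ (cls p ℕₚ.≟ cls q) s))

  module Short {c xs Y} (t : Top c xs) (Yeq : xs ++ Y ≋ allFin M) (short : length xs ≤ suc (k + k)) where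

    open Top t

    uXY : U (xs ++ Y)
    uXY = U-⊑ (≋⇒⊑ Yeq) U-all

    sizeY : suc (suc k + suc k) ≤ length Y
    sizeY = rest-size k (length xs) (length Y) (trans (sym (length-++ xs)) (trans (≋-length Yeq) (trans length-all size))) short

    Apart : List V → List V → Set
    Apart as bs = ∀ {a b} → a ∈ as → b ∈ bs → ¬ E c a b

    -- Connectivity in the form that detours use: `ps` stays inside `K`, while the ends `p` and `q`
    -- may be any vertices attached to `a` and `b`.
    Conn : List V → Set
    Conn K = ∀ {a b} → a ∈ K → b ∈ K →
      Σ[ ps ∈ List V ] (1 ≤ length ps × ps ⊑ K × (∀ {p q} → E c p a → E c b q → Ch (E c) p ps q))

    Conn-∷ : ∀ {K a r} → Conn K → a ∈ K → E c r a → Conn (r ∷ K)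
    Conn-∷ {K} {a₀} {r} f m e {a} {b} am bm = go (∈-∷⁻ am) (∈-∷⁻ bm)
      where
      go : (a ≡ r) ⊎ (a ∈ K) → (b ≡ r) ⊎ (b ∈ K) →
        Σ[ ps ∈ List V ] (1 ≤ length ps × ps ⊑ r ∷ K × (∀ {p q} → E c p a → E c b q → Ch (E c) p ps q))
      go (inj₁ refl) (inj₁ refl) = [ r ]₁ , ≤-refl , ⊑-++ˡ [ r ]₁ K , λ p q → p , q
      go (inj₁ refl) (inj₂ bk) = let (ps , l , s , ch) = f m bk in
        r ∷ ps , s≤s z≤n , ⊑-++ {xs = [ r ]₁} ⊑-refl s , λ p q → p , ch e q
      go (inj₂ ak) (inj₁ refl) = let (ps , l , s , ch) = f ak m in
        ps ++ [ r ]₁ , subst (1 ≤_) (sym (length-++ ps)) (≤-trans l (m≤m+n _ 1)) ,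
        ⊑-trans (⊑-++ {ys = [ r ]₁} s ⊑-refl) (≋⇒⊑ (≋-swap K [ r ]₁)) , λ p q → Ch-++ ps (ch p (E-sym {c} {r} {a₀} e)) q
      go (inj₂ ak) (inj₂ bk) = let (ps , l , s , ch) = f ak bk in ps , l , ⊑-trans s (⊑-++ʳ [ r ]₁ K) , ch

    touch? : ∀ K r → Dec (1 ≤ count (λ a → does (E? c r a)) K)
    touch? K r = 1 ≤? count (λ a → does (E? c r a)) K

    touch⇒ : ∀ K {r} → 1 ≤ count (λ a → does (E? c r a)) K → Σ[ a ∈ V ] (a ∈ K × E c r a)
    touch⇒ K {r} h = let (a , m , e) = count-∈ _ K h in a , m , does⇒ (E? c r a) e

    ⇒touch : ∀ K {r a} → a ∈ K → E c r a → 1 ≤ count (λ a → does (E? c r a)) K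
    ⇒touch K {r} {a} m e = ∈-count _ K m (dec-true (E? c r a) e)

    record Comp (Z : List V) : Set where
      field
        K R   : List V
        parts : K ++ R ≋ Z
        conn  : Conn K
        apart : Apart K R
        some  : 1 ≤ length K

    grow : ∀ f K R → length R ≤ f → Conn K → 1 ≤ length K → Comp (K ++ R)
    grow f K R l cn s with search (touch? K) R
    ... | inj₂ none = record { K = K ; R = R ; parts = ≋-refl ; conn = cn ; some = s
                             ; apart = λ {a} {b} ak br e → none br (⇒touch K ak (E-sym {c} {a} {b} e)) }
    grow zero K R l cn s | inj₁ (as , w , bs , refl , q) = ⊥-elim (n≮0 (≤-trans (≤-reflexive (trans (+-comm 1 _) (trans (+-assoc (length as) (length bs) 1) (cong (length as +_) (+-comm _ 1))))) (≤-trans (≤-reflexive (sym (length-++ as))) l)))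
    grow (suc f) K R l cn s | inj₁ (as , w , bs , refl , q) =
      let (a , ak , e) = touch⇒ K q
          C = grow f (w ∷ K) (as ++ bs) (s≤s⁻¹ (≤-trans (≤-reflexive (≋-length {xs = w ∷ as ++ bs} {as ++ w ∷ bs} (perm ([ w ]₁ ▸ as ▸ bs ▸ ε) (v0 ∪ v1 ∪ v2) (v1 ∪ v0 ∪ v2) refl))) l)) (Conn-∷ cn ak e) (s≤s z≤n)
      in record { K = Comp.K C ; R = Comp.R C ; conn = Comp.conn C ; apart = Comp.apart C ; some = Comp.some C
                ; parts = ≋-trans (Comp.parts C) (perm (K ▸ [ w ]₁ ▸ as ▸ bs ▸ ε) (v1 ∪ v0 ∪ v2 ∪ v3) (v0 ∪ v2 ∪ v1 ∪ v3) refl) }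

    -- Every edge across has the other colour, so alternating between the two sets gives a cycle
    -- longer than the longest one.
    alternate : ∀ m as bs → length as ≡ m → length bs ≡ m → length xs < m + m → U (as ++ bs) → Apart as bs → ⊥
    alternate m as bs la lb lt uab ap = longer (not c) (interleave as bs)
      (subst (length xs <_) (sym len) lt)
      (U-⊑ (≋⇒⊑ (interleave-≋ as bs)) uab)
      (interleave-Cyc as bs (pos (length as) (length xs) (subst (λ i → length xs < i + i) (sym la) lt)) (trans la (sym lb))
        (λ {a} {b} ma mb → let q = other {c} {a} {b} (ap ma mb) in q , E-sym {not c} {a} {b} q))
      where
      len : length (interleave as bs) ≡ m + m
      len = trans (≋-length (interleave-≋ as bs)) (trans (length-++ as) (cong₂ _+_ la lb))
      pos : ∀ a L → L < a + a → 1 ≤ a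
      pos zero    L h = ⊥-elim (n≮0 h)
      pos (suc a) L h = s≤s z≤n

    alternate′ : ∀ as bs → suc k ≤ length as → length xs < length bs + length bs → U (as ++ bs) → Apart as bs → ⊥
    alternate′ as bs la lb uab ap with length bs ≤? suc k
    ... | yes le = cutₐ (splitAt-length (length bs) as (≤-trans le la))
      where
      cutₐ : Prefix (length bs) as → ⊥
      cutₐ (ys , zs , refl , l) = alternate (length bs) ys bs l refl lb
        (U-⊑ (⊑-++ {ys = bs} (⊑-++ˡ ys zs) ⊑-refl) uab) (λ m → ap (∈-++ˡ zs m))
    ... | no  gt = cut₂ (splitAt-length (suc k) as la) (splitAt-length (suc k) bs (<⇒≤ (≰⇒> gt)))
      where
      cut₂ : Prefix (suc k) as → Prefix (suc k) bs → ⊥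
      cut₂ (ys , zs , refl , l) (ys′ , zs′ , refl , l′) = alternate (suc k) ys ys′ l l′ (short<n (length xs) k short)
        (U-⊑ (⊑-++ (⊑-++ˡ ys zs) (⊑-++ˡ ys′ zs′)) uab) (λ m m′ → ap (∈-++ˡ zs m) (∈-++ˡ zs′ m′))

    detour : ∀ {K x y post} → Conn K → (∀ {v} → v ∈ K → ¬ (v ∈ xs)) → x ∷ y ∷ post ≋ xs → Ch (E c) y post x →
      1 ≤ count (λ a → does (E? c x a)) K → 1 ≤ count (λ a → does (E? c y a)) K → U K → ⊥
    detour {K} {x} {y} {post} cn dis e ch nx ny uK =
      let (a , ak , ea) = touch⇒ K nx
          (b , bk , eb) = touch⇒ K ny
          (ps , l , s , path) = cn ak bk
      in longer c (x ∷ ps ++ y ∷ post)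
           (subst₂ _<_ (≋-length e) (sym (cong suc (length-++ ps))) (s≤s (+-monoˡ-≤ (suc (length post)) l)))
           (U-⊑ (≋⇒⊑ (perm ([ x ]₁ ▸ ps ▸ (y ∷ post) ▸ ε) (v0 ∪ v1 ∪ v2) (v1 ∪ v0 ∪ v2) refl))
             (U-++ ps (x ∷ y ∷ post) (U-⊑ s uK) (U-⊑ (≋⇒⊑ e) u) (λ p q → dis (∈-⊑ s p) (≋-∈ e q))))
           (Ch-++ ps (path ea (E-sym {c} {y} {b} eb)) ch)

    -- A component with at least n vertices. Two consecutive cycle vertices cannot both touch `K`,
    -- since a detour through `K` would lengthen the cycle. So at least half of the cycle, `S₀`, and
    -- the other outside vertices `R` send no edge of colour `c` to `K`. If `S₀ ++ R` exceeds half
    -- the cycle, it alternates with `K`.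
    module Large {K R : List V} (e : K ++ R ≋ Y) (cn : Conn K) (ap : Apart K R) (large : suc k ≤ length K) where

      uK : U (xs ++ K ++ R)
      uK = U-⊑ (⊑-++ {xs = xs} ⊑-refl (≋⇒⊑ e)) uXY

      far : V → Bool
      far x = not (does (touch? K x))

      S₀ : List V
      S₀ = filterᵇ far xs

      dis : ∀ {v} → v ∈ K → ¬ (v ∈ xs)
      dis vk vx = ∉-both xs (K ++ R) uK vx (∈-++ˡ R vk)

      half : length xs ≤ length S₀ + length S₀
      half = subst (λ s → length xs ≤ s + s) (sym (length-filter far xs))
        (half-≤ (length xs) (count (λ x → does (touch? K x)) xs) (count far xs) (count-partition (λ x → does (touch? K x)) xs)
          (indep-cyc-≤ (λ x → does (touch? K x)) xs
            (λ pre {x} {y} post eq bx by → detour cn dis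
              (subst (x ∷ y ∷ post ++ pre ≋_) (sym eq) (≋-swap (x ∷ y ∷ post) pre))
              (proj₂ (Cyc-rotate pre (x ∷ y ∷ post) (subst (Cyc (E c)) eq cyc)))
              (does⇒ (touch? K x) bx) (does⇒ (touch? K y) by) (U-++ˡ K R (U-++ʳ xs (K ++ R) uK)))
            (λ {x} {y} mid eq bx by → detour cn dis
              (subst (y ∷ x ∷ mid ≋_) (sym eq) (≋-swap [ y ]₁ (x ∷ mid)))
              (proj₁ (Ch-split mid (subst (Cyc (E c)) eq cyc)))
              (does⇒ (touch? K y) by) (does⇒ (touch? K x) bx) (U-++ˡ K R (U-++ʳ xs (K ++ R) uK)))
            len≥2))

      apS : Apart K S₀
      apS {a} {b} ak bs ea = let (bx , f) = ∈-filter⁻ far xs bs in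
        case trans (sym f) (cong not (dec-true (touch? K b) (⇒touch K ak (E-sym {c} {a} {b} ea)))) of λ ()

      uKS : U (K ++ S₀ ++ R)
      uKS = U-⊑ (⊑-trans (≋⇒⊑ (perm (K ▸ S₀ ▸ R ▸ ε) (v0 ∪ v1 ∪ v2) (v1 ∪ v0 ∪ v2) refl))
                  (⊑-++ {ys = K ++ R} (filter-⊑ far xs) ⊑-refl)) uK

      -- If no vertex of the other colour can be spared, K is everything off the cycle.
      tight : R ≡ [] → length S₀ + length S₀ ≡ length xs → ⊥
      tight refl eq = go S₀ refl (search (λ a → 1 ≤? count (λ b → does (bond? a b)) K) K)
        where
        bond? : ∀ a b → Dec (a ≢ b × ¬ E c a b)
        bond? a b = ¬? (a Fin.≟ b) ×-dec ¬? (E? c a b)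
        lenK : suc (suc k + suc k) ≤ length K
        lenK = subst (suc (suc k + suc k) ≤_) (trans (sym (≋-length e)) (cong length (++-identityʳ K))) sizeY
        UK : U K
        UK = U-++ˡ K [] (U-++ʳ xs (K ++ []) uK)
        bond : ∀ {a} → a ∈ K → 1 ≤ count (λ b → does (bond? a b)) K → ∀ s ss → S₀ ≡ s ∷ ss → ⊥
        bond {a} ak h s ss eS = with-b (count-∈ _ K h)
          where
          with-b : (Σ[ b ∈ V ] (b ∈ K × does (bond? a b) ≡ true)) → ⊥
          with-b (b , bk , d) = with-rest (U-⇒⊑ (a ∷ b ∷ []) K uab (pair-⊆ ak bk))
            where
            a≢b : a ≢ b
            a≢b = proj₁ (does⇒ (bond? a b) d)
            uab : U (a ∷ b ∷ [])
            uab = U-pair a≢b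
            with-rest : (Σ[ K′ ∈ List V ] (a ∷ b ∷ K′ ≋ K)) → ⊥
            with-rest (K′ , eK) = with-ks (splitAt-length (length ss) K′ (enough k (length xs) (length ss) (length K′)
                (trans (cong (λ z → length z + length z) (sym eS)) eq) short (subst (suc (suc k + suc k) ≤_) (sym (≋-length eK)) lenK)))
              where
              with-ks : Prefix (length ss) K′ → ⊥
              -- All of `S₀` alternates with one vertex more of `K`, where `b` and `a` are joined
              -- directly in the other colour: 2|S₀| + 1 vertices in all.
              with-ks (ks , zs , refl , lks) = longer (not c) (a ∷ s ∷ interleave ks ss ++ b ∷ [])
                (≤-reflexive (trans (cong suc (sym (trans (cong (λ z → length z + length z) (sym eS)) eq))) (sym (trans
                  (cong (λ z → suc (suc z)) (trans (length-++ (interleave ks ss)) (cong (_+ 1) (trans (≋-length (interleave-≋ ks ss)) (trans (length-++ ks) (cong (_+ length ss) lks))))))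
                  (lem (length ss))))))
                (U-⊑ (⊑-trans (≋⇒⊑ p₁) (⊑-trans (⊑-++ˡ (a ∷ b ∷ ks ++ s ∷ ss) zs) (≋⇒⊑ p₂))) uKS)
                (Ch-++ {E = E (not c)} (s ∷ interleave ks ss) {[]} (interleave-Ch (_∈ K) (_∈ S₀) nE ks ss lks ak (inS (∈-here s ss)) bk
                    (λ m → ≋-∈ eK (∈-there a (∈-there b (∈-++ˡ zs m)))) (λ m → inS (∈-there s m)))
                  (E-sym {not c} {a} {b} (other {c} {a} {b} (proj₂ (does⇒ (bond? a b) d)))))
                where
                lem : ∀ i → suc (suc (i + i + 1)) ≡ suc (suc i + suc i)
                lem = solve-∀
                inS : ∀ {v} → v ∈ s ∷ ss → v ∈ S₀
                inS {v} = subst (v ∈_) (sym eS)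
                nE : ∀ {x y} → x ∈ K → y ∈ S₀ → E (not c) x y × E (not c) y x
                nE {x} {y} mx my = let q = other {c} {x} {y} (apS mx my) in q , E-sym {not c} {x} {y} q
                p₁ : a ∷ s ∷ interleave ks ss ++ b ∷ [] ≋ a ∷ b ∷ ks ++ s ∷ ss
                p₁ = ≋-trans (perm ([ a ]₁ ▸ [ s ]₁ ▸ interleave ks ss ▸ [ b ]₁ ▸ ε) (v0 ∪ v1 ∪ v2 ∪ v3) (v2 ∪ v0 ∪ v1 ∪ v3) refl)
                       (≋-trans (≋-++ (interleave-≋ ks ss) ≋-refl)
                         (perm (ks ▸ ss ▸ [ a ]₁ ▸ [ s ]₁ ▸ [ b ]₁ ▸ ε) ((v0 ∪ v1) ∪ v2 ∪ v3 ∪ v4) (v2 ∪ v4 ∪ v0 ∪ v3 ∪ v1) refl))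
                p₂ : (a ∷ b ∷ ks ++ s ∷ ss) ++ zs ≋ K ++ S₀ ++ []
                p₂ = ≋-trans (perm ((a ∷ b ∷ []) ▸ ks ▸ (s ∷ ss) ▸ zs ▸ ε) ((v0 ∪ v1 ∪ v2) ∪ v3) ((v0 ∪ v1 ∪ v3) ∪ v2 ∪ nil) refl)
                       (≋-++ eK (subst (λ z → (s ∷ ss) ++ [] ≋ z ++ []) (sym eS) ≋-refl))
        go : ∀ S → S₀ ≡ S → Searched (λ a → 1 ≤ count (λ b → does (bond? a b)) K) K → ⊥
        go []       eS _ = ⊥-elim (n≮0 (≤-trans len≥2 (subst (length xs ≤_) (cong (λ z → length z + length z) eS) half)))
        go (s ∷ ss) eS (inj₁ (as , a , bs , eK , h)) = bond (subst (a ∈_) (sym eK) (∈-mid as a bs)) h s ss eS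
        go (s ∷ ss) eS (inj₂ none) = longer c K (≤-trans (short<n (length xs) k short) (<⇒≤ lenK)) UK
          (clique-Cyc K (≤-trans (s≤s (s≤s z≤n)) (≤-trans (s≤s (s≤s (m≤n+m 1 (k + k)))) (subst (λ z → suc (suc z) ≤ length K) (lem k) lenK))) UK
            (λ {a} {b} ak bk ne → decidable-stable (E? c a b) λ n → none ak (∈-count _ K bk (dec-true (bond? a b) (ne , n)))))
          where
          lem : ∀ k → k + suc k ≡ k + k + 1
          lem = solve-∀

      large⊥ : ⊥
      large⊥ with suc (length xs) ≤? length (S₀ ++ R) + length (S₀ ++ R)
      ... | yes p = alternate′ K (S₀ ++ R) large p uKS (λ a b → [ apS a , ap a ]′ (∈-++⁻ S₀ b))
      ... | no  n = split (no-rest (length xs) (length S₀) (length R) half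
                      (subst (λ z → z + z ≤ length xs) (length-++ S₀) (s≤s⁻¹ (≰⇒> n))))
        where
        empty : ∀ (R : List V) → length R ≡ 0 → R ≡ []
        empty [] _ = refl
        split : (length R ≡ 0 × length S₀ + length S₀ ≡ length xs) → ⊥
        split (r0 , eq) = tight (empty R r0) eq

    -- If `R` is small too, each of `J`, `K`, `R` has fewer than n vertices and together they have
    -- more than 2n. All edges between them have the other colour, so the rotation argument applies
    -- with these three sets as classes.
    three : ∀ J K R → J ++ K ++ R ≋ Y → Apart J K → Apart J R → Apart K R → length J ≤ k → length K ≤ k → suc k ≤ length J + length K → ⊥
    three J K R e jk jr kr lJ lK lJK with suc k ≤? length R
    ... | yes p = alternate′ R (J ++ K) p
          (≤-trans (short<n (length xs) k short) (subst (λ z → suc k + suc k ≤ z + z) (sym (length-++ J)) (+-mono-≤ lJK lJK)))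
          (U-⊑ (⊑-trans (≋⇒⊑ (≋-trans (perm (J ▸ K ▸ R ▸ ε) (v2 ∪ v0 ∪ v1) (v0 ∪ v1 ∪ v2) refl) e)) (⊑-++ʳ xs Y)) uXY)
          (λ {a} {b} ra m q → [ (λ bj → jr bj ra (E-sym {c} {a} {b} q)) , (λ bk → kr bk ra (E-sym {c} {a} {b} q)) ]′ (∈-++⁻ J m))
    ... | no  n = pick (splitAt-length (suc k + suc k) (J ++ K ++ R) (≤-trans (<⇒≤ sizeY) (≤-reflexive (sym (≋-length e)))))
      where
      lR : length R ≤ k
      lR = s≤s⁻¹ (≰⇒> n)
      uJKR : U (J ++ K ++ R)
      uJKR = U-⊑ (⊑-trans (≋⇒⊑ e) (⊑-++ʳ xs Y)) uXY
      in? : ∀ x (zs : List V) → Dec (1 ≤ count (x ==_) zs)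
      in? x zs = 1 ≤? count (x ==_) zs
      label : V → ℕ
      label x = if does (in? x J) then 0 else (if does (in? x K) then 1 else 2)
      labJ : ∀ {x} → x ∈ J → label x ≡ 0
      labJ {x} (mem m) rewrite dec-true (in? x J) m = refl
      labK : ∀ {x} → x ∈ K → label x ≡ 1
      labK {x} m rewrite dec-false (in? x J) (λ j → ∉-both J (K ++ R) uJKR (mem j) (∈-++ˡ R m)) | dec-true (in? x K) (once m) = refl
      labR : ∀ {x} → x ∈ R → label x ≡ 2
      labR {x} m rewrite dec-false (in? x J) (λ j → ∉-both J (K ++ R) uJKR (mem j) (∈-++ʳ K m))
                       | dec-false (in? x K) (λ j → ∉-both K R (U-++ʳ J (K ++ R) uJKR) (mem j) m) = refl
      lab : ∀ d x → Bool
      lab d x = does (label x ℕₚ.≟ d)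
      off : ∀ zs i d → (∀ {v} → v ∈ zs → label v ≡ i) → does (i ℕₚ.≟ d) ≡ false → count (lab d) zs ≡ 0
      off zs i d h f = count-absent (lab d) zs λ m → trans (cong (λ z → does (z ℕₚ.≟ d)) (h m)) f
      bound : ∀ d → count (lab d) J + (count (lab d) K + count (lab d) R) ≤ k
      bound 0 rewrite off K 1 0 labK refl | off R 2 0 labR refl | +-identityʳ (count (lab 0) J) = ≤-trans (count-≤-length _ J) lJ
      bound 1 rewrite off J 0 1 labJ refl | off R 2 1 labR refl | +-identityʳ (count (lab 1) K) = ≤-trans (count-≤-length _ K) lK
      bound 2 rewrite off J 0 2 labJ refl | off K 1 2 labK refl = ≤-trans (count-≤-length _ R) lR
      bound d@(suc (suc (suc _))) rewrite off J 0 d labJ refl | off K 1 d labK refl | off R 2 d labR refl = z≤n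
      join : ∀ {a b} → a ∈ J ++ K ++ R → b ∈ J ++ K ++ R → label a ≢ label b → E (not c) a b
      join {a} {b} ma mb ne with ∈-++⁻ J ma | ∈-++⁻ J mb
      ... | inj₁ aj | inj₁ bj = ⊥-elim (ne (trans (labJ aj) (sym (labJ bj))))
      ... | inj₁ aj | inj₂ mb′ = other {c} {a} {b} ([ jk aj , jr aj ]′ (∈-++⁻ K mb′))
      ... | inj₂ ma′ | inj₁ bj = E-sym {not c} {b} {a} (other {c} {b} {a} ([ jk bj , jr bj ]′ (∈-++⁻ K ma′)))
      ... | inj₂ ma′ | inj₂ mb′ with ∈-++⁻ K ma′ | ∈-++⁻ K mb′
      ...   | inj₁ ak | inj₁ bk = ⊥-elim (ne (trans (labK ak) (sym (labK bk))))
      ...   | inj₁ ak | inj₂ br = other {c} {a} {b} (kr ak br)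
      ...   | inj₂ ar | inj₁ bk = E-sym {not c} {b} {a} (other {c} {b} {a} (kr bk ar))
      ...   | inj₂ ar | inj₂ br = ⊥-elim (ne (trans (labR ar) (sym (labR br))))
      pick : Prefix (suc k + suc k) (J ++ K ++ R) → ⊥
      pick (ys , zs , eq , l) = pick₂ (splitAt-length (suc k) ys (subst (suc k ≤_) (sym l) (m≤m+n _ (suc k))))
        where
        pick₂ : Prefix (suc k) ys → ⊥
        pick₂ (as , bs , refl , la) = done (bipartite label as bs (s≤s z≤n) la lb (U-⊑ incl uJKR)
            (λ d → s≤s (≤-trans (⊑at incl (lab d)) (subst (_≤ k) (sym (trans (count-++ (lab d) J (K ++ R)) (cong (count (lab d) J +_) (count-++ (lab d) K R)))) (bound d))))
            (λ {x} {y} → E-sym {not c} {x} {y}) (λ ma mb → join (∈-⊑ incl (∈-++ˡ bs ma)) (∈-⊑ incl (∈-++ʳ as mb))))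
          where
          incl : as ++ bs ⊑ J ++ K ++ R
          incl = subst (as ++ bs ⊑_) (sym eq) (⊑-++ˡ (as ++ bs) zs)
          lb : length bs ≡ suc k
          lb = +-cancelˡ-≡ (suc k) _ _ (trans (cong (_+ length bs) (sym la)) (trans (sym (length-++ as)) l))
          done : (Σ[ ws ∈ List V ] (Cyc (E (not c)) ws × ws ≋ as ++ bs)) → ⊥
          done (ws , cy , pm) = longer (not c) ws
            (subst (length xs <_) (sym (trans (≋-length pm) l)) (short<n (length xs) k short))
            (U-⊑ (⊑-trans (≋⇒⊑ pm) incl) uJKR) cy

    -- Components are collected in `J` while it has fewer than n vertices. More than 2n vertices lie
    -- outside the cycle, so a component of size n or an overflow of `J` must occur.
    gather : ∀ f J Z → J ++ Z ≋ Y → Apart J Z → length J ≤ k → length Z ≤ f → ⊥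
    gather f J [] e ap lJ lf = case two-long k (length J) 0 lJ (subst (suc (suc k + suc k) ≤_) (trans (sym (≋-length e)) (length-++ J)) sizeY) of λ ()
    gather (suc f) J (v ∷ Z) e ap lJ lf = go (grow (length Z) [ v ]₁ Z ≤-refl single ≤-refl)
      where
      single : Conn [ v ]₁
      single am bm = [ v ]₁ , ≤-refl , ⊑-refl , λ {p} {q} ep eq →
        subst (E c p) (∈-single am) ep , subst (λ z → E c z q) (∈-single bm) eq
      go : Comp (v ∷ Z) → ⊥
      go C = cases (suc k ≤? length K) (suc k ≤? length J + length K)
        where
        open Comp C
        jk : Apart J K
        jk aj bk = ap aj (≋-∈ parts (∈-++ˡ R bk))
        jr : Apart J R
        jr aj br = ap aj (≋-∈ parts (∈-++ʳ K br))
        e₁ : J ++ K ++ R ≋ Y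
        e₁ = ≋-trans (≋-++ ≋-refl parts) e
        cases : Dec (suc k ≤ length K) → Dec (suc k ≤ length J + length K) → ⊥
        cases (yes p) _ = Large.large⊥ {K} {J ++ R} (≋-trans (perm (J ▸ K ▸ R ▸ ε) (v1 ∪ v0 ∪ v2) (v0 ∪ v1 ∪ v2) refl) e₁) conn
          (λ {a} {b} ak m q → [ (λ bj → jk bj ak (E-sym {c} {a} {b} q)) , (λ br → apart ak br q) ]′ (∈-++⁻ J m)) p
        cases (no n) (yes p) = three J K R e₁ jk jr apart lJ (s≤s⁻¹ (≰⇒> n)) p
        cases (no n) (no m) = gather f (J ++ K) R (subst (_≋ Y) (sym (++-assoc J K R)) e₁)
          (λ mm br q → [ (λ aj → jr aj br q) , (λ ak → apart ak br q) ]′ (∈-++⁻ J mm))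
          (subst (_≤ k) (sym (length-++ J)) (s≤s⁻¹ (≰⇒> m)))
          (s≤s⁻¹ (≤-trans (+-monoˡ-≤ (length R) some) (≤-trans (≤-reflexive (trans (sym (length-++ K)) (≋-length parts))) lf)))

    short⊥ : ⊥
    short⊥ = gather (length Y) [] Y ≋-refl (λ m → ⊥-elim (∉[] m)) z≤n ≤-refl

  -- `Z` serves as the vertex set of the odd longest cycle, with 2m + 3 vertices; its rotations and
  -- the walks in steps of two are compared with it by `≋`.
  module Long (c : Bool) (Z Y : List V) (Zeq : Z ++ Y ≋ allFin M) (m : ℕ) (k≤m : k ≤ m) (lZ : length Z ≡ suc (suc m + suc m)) where

    sizes : suc (suc m + suc m) + length Y ≡ (suc k + suc k) + (suc k + suc k)
    sizes = trans (cong (_+ length Y) (sym lZ)) (trans (sym (length-++ Z)) (trans (≋-length Zeq) (trans length-all size)))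

    uZY : U (Z ++ Y)
    uZY = U-⊑ (≋⇒⊑ Zeq) U-all

    apart : ∀ {xs v} → xs ≋ Z → v ∈ Y → ¬ (v ∈ xs)
    apart e y x = ∉-both Z Y uZY (≋-∈ e x) y

    grown : ∀ {xs ys c′} → Top c xs → xs ≋ Z → length ys ≡ suc (length Z) → U ys → Cyc (E c′) ys → ⊥
    grown t e l uy cy = Top.longer t _ _ (≤-reflexive (trans (cong suc (≋-length e)) (sym l))) uy cy

    chord⊥ : ∀ {p q r rest} → Top c (p ∷ q ∷ r ∷ rest) → p ∷ q ∷ r ∷ rest ≋ Z → Real c p r → ⊥
    chord⊥ {p} {q} {r} {rest} t e pr = even⊥ c (suc m) (p ∷ r ∷ rest) (s≤s k≤m) (suc-injective (trans (≋-length e) lZ))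
      (U-⊑ (cut-⊑ [] p r [ q ]₁ rest) (Top.u t)) (pr , proj₂ (proj₂ (Top-real t)))

    Big : V → Bool
    Big p = does (suc k ≤? count (nb c p) Y)

    -- Since `p` and `r` are twins, `p ∷ rest` is an odd cycle, and `r` lies outside it as a common
    -- neighbour of all neighbours of `p`. So at most n - 1 of these are on it, one more may be `q`,
    -- and of at least 2n neighbours n remain for `Y`.
    big : ∀ {p q r rest} → Top c (p ∷ q ∷ r ∷ rest) → p ∷ q ∷ r ∷ rest ≋ Z → cls p ≡ cls r → E c p r → suc k ≤ count (nb c p) Y
    big {p} {q} {r} {rest} t e tw pr = nbr-outside k (count B (p ∷ rest)) (count B Y) 0 total few refl
      where
      open Top t
      B = nb c p
      p≢r : p ≢ r
      p≢r refl = ∉-both [ p ]₁ (q ∷ p ∷ rest) u (∈-here p []) (∈-there q (∈-here p rest))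
      r∉ : ¬ (r ∈ p ∷ rest)
      r∉ m = [ (λ q → p≢r (sym q)) , ∉-both (p ∷ q ∷ r ∷ []) rest u (∈-there p (∈-there q (∈-here r []))) ]′ (∈-∷⁻ m)
      few : count B (p ∷ rest) ≤ k
      few = Sparse.few c m k≤m (p ∷ rest) (suc-injective (suc-injective (trans (≋-length e) (trans lZ (cong (λ z → suc (suc z)) (+-suc m m))))))
        (U-⊑ (sub ([ p ]₁ ▸ (q ∷ r ∷ []) ▸ rest ▸ ε) (v0 ∪ v2) (v0 ∪ v1 ∪ v2) v1 refl) u)
        (Ch-head rest (Real-twin (sym tw)) (proj₂ (proj₂ (Top-real t)))) B
        (λ {a} {b} _ _ na nb → r , r∉ , Real-twin {c} {p} {r} {a} tw (nb⇒ {c} {p} {a} na) , Real-twin {c} {p} {r} {b} tw (nb⇒ {c} {p} {b} nb))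
      Br : B r ≡ false
      Br = dec-false (Real? c p r) (λ h → proj₂ h tw)
      atmost : ∀ a b d → b2n a + (b2n d + (0 + b)) ≤ suc (b2n a + b)
      atmost a b true  rewrite +-suc (b2n a) b = ≤-refl
      atmost a b false = n≤1+n _
      total : suc k + suc k ≤ suc (count B (p ∷ rest)) + count B Y
      total = ≤-trans (subst (λ z → suc k + suc k ≤ count (nb z p) (allFin M)) pr (heavy p r p≢r tw))
        (≤-trans (≤-reflexive (trans (sym (≋at Zeq B)) (trans (count-++ B Z Y) (cong (_+ count B Y) (sym (≋at e B))))))
          (+-monoˡ-≤ (count B Y) (subst (λ z → b2n (B p) + (b2n (B q) + (b2n z + count B rest)) ≤ suc (b2n (B p) + count B rest)) (sym Br)
            (atmost (B p) (count B rest) (B q)))))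

    -- At most 2n - 1 vertices lie outside the cycle, so any two `Big` vertices have a common
    -- neighbour there.
    fewBig : ∀ {xs} → Top c xs → xs ≋ Z → count Big xs ≤ k
    fewBig {xs} t e = Sparse.few c (suc m) (m≤n⇒m≤1+n k≤m) xs (trans (≋-length e) lZ) (Top.u t) (Top-real t) Big common
      where
      pair⇒ : ∀ a b → (a ∧ b) ≡ true → a ≡ true × b ≡ true
      pair⇒ true true _ = refl , refl
      common : ∀ {a b} → a ∈ xs → b ∈ xs → Big a ≡ true → Big b ≡ true → Σ[ z ∈ V ] (¬ (z ∈ xs) × Real c z a × Real c z b)
      common {a} {b} _ _ ba bb =
        let (z , zY , h) = count-∈ (λ x → nb c a x ∧ nb c b x) Y
              (share k (count (nb c a) Y) (count (nb c b) Y) (length Y) _ (does⇒ (suc k ≤? count (nb c a) Y) ba) (does⇒ (suc k ≤? count (nb c b) Y) bb)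
                (left-over k m (length Y) sizes k≤m) (count-incl-excl (nb c a) (nb c b) Y))
            (h₁ , h₂) = pair⇒ (nb c a z) (nb c b z) h
        in z , apart e zY , Real-sym (nb⇒ {c} {a} {z} h₁) , Real-sym (nb⇒ {c} {b} {z} h₂)

    Step : V → V → Set
    Step p r = E (not c) p r ⊎ (cls p ≡ cls r × Big p ≡ true)

    step : ∀ {p q r rest} → Top c (p ∷ q ∷ r ∷ rest) → p ∷ q ∷ r ∷ rest ≋ Z → Step p r
    step {p} {q} {r} t e with E? c p r
    ... | no  n = inj₁ (other {c} {p} {r} n)
    ... | yes y with cls p ℕₚ.≟ cls r
    ...   | yes tw = inj₂ (tw , dec-true (suc k ≤? count (nb c p) Y) (big t e tw y))
    ...   | no  ne = ⊥-elim (chord⊥ t e (y , ne))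

    -- Moving in steps of two around the odd cycle visits every vertex.
    round : ∀ {F : V → V → Set} → (∀ {p q r rest} → Top c (p ∷ q ∷ r ∷ rest) → p ∷ q ∷ r ∷ rest ≋ Z → F p r) →
      ∀ {x₀ x₁ mid z} → Top c (x₀ ∷ x₁ ∷ mid ++ [ z ]₁) → x₀ ∷ x₁ ∷ mid ++ [ z ]₁ ≋ Z →
      Ch F x₁ (odds mid ++ x₀ ∷ evens mid) z × F z x₁
    round {F} f {x₀} {x₁} {mid} {z} t e = Ch-++ (odds mid) (proj₂ both) (proj₁ both) ,
      f {z} {x₀} {x₁} {mid} (Top-rotate (x₀ ∷ x₁ ∷ mid) [ z ]₁ t) (≋-trans (≋-swap [ z ]₁ (x₀ ∷ x₁ ∷ mid)) e)
      where
      lin : ∀ pre {p q r} post → x₀ ∷ x₁ ∷ mid ++ [ z ]₁ ≡ pre ++ p ∷ q ∷ r ∷ post → F p r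
      lin pre {p} {q} {r} post eq = f {p} {q} {r} {post ++ pre} (Top-rotate pre (p ∷ q ∷ r ∷ post) (subst (Top c) eq t))
        (≋-trans (≋-swap (p ∷ q ∷ r ∷ post) pre) (subst (_≋ Z) eq e))
      wrap : ∀ pre {p q} → x₀ ∷ x₁ ∷ mid ++ [ z ]₁ ≡ pre ++ p ∷ q ∷ [] → F p x₀
      wrap []      {p} {q} eq = case trans (cong length (sym eq)) (trans (≋-length e) (trans lZ (cong (λ i → suc (suc i)) (+-suc m m)))) of λ ()
      wrap (x ∷ pre) {p} {q} eq = subst (F p) (sym (∷-injectiveˡ eq))
        (f {p} {q} {x} {pre} (Top-rotate (x ∷ pre) (p ∷ q ∷ []) (subst (Top c) eq t)) (≋-trans (≋-swap (p ∷ q ∷ []) (x ∷ pre)) (subst (_≋ Z) eq e)))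
      closed : ∀ pre {p q r} post → x₀ ∷ x₁ ∷ mid ++ z ∷ x₀ ∷ [] ≡ pre ++ p ∷ q ∷ r ∷ post → F p r
      closed pre {p} {q} {r} post eq with initLast post
      ... | [] = subst (F p) (∷ʳ-injectiveʳ (x₀ ∷ x₁ ∷ mid ++ [ z ]₁) (pre ++ p ∷ q ∷ []) eq′) (wrap pre (∷ʳ-injectiveˡ (x₀ ∷ x₁ ∷ mid ++ [ z ]₁) (pre ++ p ∷ q ∷ []) eq′))
        where
        eq′ : (x₀ ∷ x₁ ∷ mid ++ [ z ]₁) ++ [ x₀ ]₁ ≡ (pre ++ p ∷ q ∷ []) ++ [ r ]₁
        eq′ = trans (cong (λ l → x₀ ∷ x₁ ∷ l) (++-assoc mid [ z ]₁ [ x₀ ]₁)) (trans eq (sym (++-assoc pre (p ∷ q ∷ []) [ r ]₁)))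
      ... | post′ ∷ʳ′ w = lin pre post′ (∷ʳ-injectiveˡ (x₀ ∷ x₁ ∷ mid ++ [ z ]₁) (pre ++ p ∷ q ∷ r ∷ post′)
              (trans (cong (λ l → x₀ ∷ x₁ ∷ l) (++-assoc mid [ z ]₁ [ x₀ ]₁)) (trans eq (sym (++-assoc pre (p ∷ q ∷ r ∷ post′) [ w ]₁)))))
      lmid : length mid ≡ m + m
      lmid = suc-injective (suc-injective (suc-injective (trans (cong (λ i → suc (suc i)) (trans (+-comm 1 (length mid)) (sym (length-++ mid))))
               (trans (≋-length e) (trans lZ (cong (λ i → suc (suc i)) (+-suc m m)))))))
      both : Ch F x₀ (evens mid) z × Ch F x₁ (odds mid) x₀
      both = two-steps m x₀ x₁ mid z x₀ lmid closed

    -- A step between twins is contracted by dropping its first vertex: whatever precedes it is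
    -- joined to the twin in the same colour. `σ` counts the dropped vertices, all of them `Big`.
    contract : ∀ {x y} xs → Ch Step x xs y → Σ[ ws ∈ List V ] Σ[ σ ∈ ℕ ]
      ((∀ {v} → E (not c) v x → Ch (E (not c)) v ws y) × ws ⊑ x ∷ xs × length ws + σ ≡ suc (length xs) × σ ≤ count Big (x ∷ xs))
    contract {x} {y} [] (inj₁ e)        = [ x ]₁ , 0 , (λ d → d , e) , ⊑-refl , refl , z≤n
    contract {x} {y} [] (inj₂ (tw , b)) = [] , 1 , (λ {v} d → E-sym {not c} {y} {v} (E-twin {not c} {x} {y} {v} tw (E-sym {not c} {v} {x} d))) ,
      (⊑! λ _ → z≤n) , refl , subst (λ z → 1 ≤ b2n z + 0) (sym b) ≤-refl
    contract {x} {y} (z ∷ xs) (inj₁ e , ch) =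
      let (ws , σ , f , s , l , n) = contract xs ch
      in x ∷ ws , σ , (λ d → d , f e) , ⊑-++ {xs = [ x ]₁} {[ x ]₁} ⊑-refl s , cong suc l , ≤-trans n (m≤n+m _ (b2n (Big x)))
    contract {x} {y} (z ∷ xs) (inj₂ (tw , b) , ch) =
      let (ws , σ , f , s , l , n) = contract xs ch
      in ws , suc σ , (λ {v} d → f (E-sym {not c} {z} {v} (E-twin {not c} {x} {z} {v} tw (E-sym {not c} {v} {x} d)))) , ⊑-trans s (⊑-++ʳ [ x ]₁ (z ∷ xs)) ,
         trans (+-suc (length ws) σ) (cong suc l) , subst (λ w → suc σ ≤ b2n w + count Big (z ∷ xs)) (sym b) (s≤s n)

    fill : ∀ {x z} (ws : List V) v w fs → U (w ∷ fs) → (∀ {a b} → a ∈ w ∷ fs → b ∈ w ∷ fs → a ≢ b → E (not c) a b) →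
      (∀ {a} → a ∈ w ∷ fs → E (not c) v a) → (∀ {a} → a ∈ w ∷ fs → E (not c) a x) → (∀ {v} → E (not c) v x → Ch (E (not c)) v ws z) →
      Ch (E (not c)) v (w ∷ fs ++ ws) z
    fill ws v w []        u h i j f = i (∈-here w []) , f (j (∈-here w []))
    fill ws v w (w′ ∷ fs) u h i j f = i (∈-here w _) ,
      fill ws w w′ fs (U-++ʳ [ w ]₁ (w′ ∷ fs) u) (λ a b → h (∈-there w a) (∈-there w b))
        (λ a → h (∈-here w _) (∈-there w a) λ { refl → ∉-both [ w ]₁ (w′ ∷ fs) u (∈-here w []) a }) (λ a → j (∈-there w a)) f

    -- An edge of colour `c` within `W`, from `W` to `q`, or from `W` to the last vertex `z` would
    -- lengthen the cycle. So the passage from `z` to `q` can be led through vertices of `W` in the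
    -- other colour. `W` has at least n of them, and contracting loses only `σ` ≤ n - 1, so `σ` + 1
    -- can be put in.
    module Twins {p q r rest} (t : Top c (p ∷ q ∷ r ∷ rest)) (e : p ∷ q ∷ r ∷ rest ≋ Z) (tw : cls p ≡ cls r) (pr : E c p r) where

      open Top t

      W : List V
      W = filterᵇ (nb c p) Y

      W-p : ∀ {w} → w ∈ W → E c p w
      W-p {w} m = proj₁ (nb⇒ {c} {p} {w} (proj₂ (∈-filter⁻ (nb c p) Y m)))

      W-r : ∀ {w} → w ∈ W → E c r w
      W-r {w} m = E-twin {c} {p} {r} {w} tw (W-p m)

      W-out : ∀ {w} → w ∈ W → ¬ (w ∈ p ∷ q ∷ r ∷ rest)
      W-out m = apart e (proj₁ (∈-filter⁻ (nb c p) Y m))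

      W-W : ∀ {a b} → a ∈ W → b ∈ W → a ≢ b → E (not c) a b
      W-W {a} {b} ma mb ne = other {c} {a} {b} λ ab →
        grown t e (cong suc (≋-length e)) (U-⊑ (≋⇒⊑ (perm ([ p ]₁ ▸ [ a ]₁ ▸ [ b ]₁ ▸ (r ∷ rest) ▸ ε) (v0 ∪ v1 ∪ v2 ∪ v3) (v1 ∪ v2 ∪ v0 ∪ v3) refl))
            (U-∷ (λ m → [ ne , (λ m′ → W-out ma (∈-⊑ small m′)) ]′ (∈-∷⁻ m)) (U-∷ (λ m → W-out mb (∈-⊑ small m)) (U-⊑ small u))))
          (W-p ma , ab , E-sym {c} {r} {b} (W-r mb) , proj₂ (proj₂ cyc))
        where
        small : p ∷ r ∷ rest ⊑ p ∷ q ∷ r ∷ rest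
        small = cut-⊑ [] p r [ q ]₁ rest

      W-q : ∀ {a} → a ∈ W → E (not c) a q
      W-q {a} m = other {c} {a} {q} λ aq →
        grown t e (cong suc (≋-length e)) (U-⊑ (≋⇒⊑ (perm ([ p ]₁ ▸ [ a ]₁ ▸ (q ∷ r ∷ rest) ▸ ε) (v0 ∪ v1 ∪ v2) (v1 ∪ v0 ∪ v2) refl)) (U-∷ (W-out m) u))
          (W-p m , aq , proj₂ cyc)

      W-z : ∀ mid {z a} → r ∷ rest ≡ mid ++ [ z ]₁ → a ∈ W → E (not c) z a
      W-z mid {z} {a} eq m = other {c} {z} {a} λ za →
        grown {ys = a ∷ p ∷ q ∷ mid ++ [ z ]₁} t e (cong suc (trans (cong (λ l → length (p ∷ q ∷ l)) (sym eq)) (≋-length e)))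
          (subst (λ l → U (a ∷ p ∷ q ∷ l)) eq (U-∷ (W-out m) u))
          (E-sym {c} {p} {a} (W-p m) , Ch-++ (q ∷ mid) (proj₁ (Ch-split (q ∷ mid) (subst (λ l → Ch (E c) p (q ∷ l) p) eq cyc))) za)

      twins⊥ : ⊥
      twins⊥ = go (unsnoc r rest)
        where
        go : (Σ[ mid ∈ List V ] Σ[ z ∈ V ] r ∷ rest ≡ mid ++ [ z ]₁) → ⊥
        go (mid , z , eq) = go₂ (contract (odds mid ++ p ∷ evens mid) (proj₁ (round step (subst (λ l → Top c (p ∷ q ∷ l)) eq t) e′)))
          where
          e′ : p ∷ q ∷ mid ++ [ z ]₁ ≋ Z
          e′ = subst (λ l → p ∷ q ∷ l ≋ Z) eq e
          pm : (q ∷ odds mid ++ p ∷ evens mid) ++ [ z ]₁ ≋ p ∷ q ∷ mid ++ [ z ]₁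
          pm = ≋-trans (perm ([ q ]₁ ▸ odds mid ▸ [ p ]₁ ▸ evens mid ▸ [ z ]₁ ▸ ε) ((v0 ∪ v1 ∪ v2 ∪ v3) ∪ v4) ((v2 ∪ v0) ∪ (v1 ∪ v3) ∪ v4) refl)
                 (≋-++ {xs = p ∷ q ∷ []} ≋-refl (≋-++ (evens-odds mid) ≋-refl))
          go₂ : (Σ[ ws ∈ List V ] Σ[ σ ∈ ℕ ] ((∀ {v} → E (not c) v q → Ch (E (not c)) v ws z) × ws ⊑ q ∷ odds mid ++ p ∷ evens mid ×
                  length ws + σ ≡ suc (length (odds mid ++ p ∷ evens mid)) × σ ≤ count Big (q ∷ odds mid ++ p ∷ evens mid))) → ⊥
          go₂ (ws , σ , f , s , l , n) = go₃ (splitAt-length (suc σ) W (≤-trans (s≤s σ≤k) (subst (suc k ≤_) (sym (length-filter (nb c p) Y)) (big t e tw pr))))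
            where
            σ≤k : σ ≤ k
            σ≤k = ≤-trans n (≤-trans (⊑at (⊑-trans (⊑-++ˡ (q ∷ odds mid ++ p ∷ evens mid) [ z ]₁) (≋⇒⊑ (≋-trans pm (subst (λ l → p ∷ q ∷ mid ++ [ z ]₁ ≋ p ∷ q ∷ l) (sym eq) ≋-refl)))) Big) (fewBig t e))
            len : ∀ fs → length fs ≡ suc σ → length (z ∷ fs ++ ws) ≡ suc (length Z)
            len fs lf = cong suc (trans (length-++ fs) (trans (cong (_+ length ws) lf) (trans (cong suc (trans (+-comm σ (length ws)) l))
              (trans (+-comm 1 _) (trans (sym (length-++ (q ∷ odds mid ++ p ∷ evens mid))) (≋-length (≋-trans pm e′)))))))
            go₃ : Prefix (suc σ) W → ⊥
            go₃ (w ∷ fs , zs , eW , lf) = grown {ys = z ∷ w ∷ fs ++ ws} t e (len (w ∷ fs) lf)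
              (U-⊑ (⊑-trans (≋⇒⊑ (perm ([ z ]₁ ▸ (w ∷ fs) ▸ ws ▸ ε) (v0 ∪ v1 ∪ v2) ((v2 ∪ v0) ∪ v1) refl))
                (⊑-++ (⊑-trans (⊑-++ {ys = [ z ]₁} {[ z ]₁} s ⊑-refl) (≋⇒⊑ (≋-trans pm e′)))
                  (⊑-trans (⊑-++ˡ (w ∷ fs) zs) (subst (_⊑ Y) eW (filter-⊑ (nb c p) Y))))) uZY)
              (fill ws z w fs (U-⊑ (⊑-++ˡ (w ∷ fs) zs) (subst U eW (U-⊑ (filter-⊑ (nb c p) Y) (U-++ʳ Z Y uZY))))
                (λ a b → W-W (inW a) (inW b)) (λ a → W-z mid eq (inW a)) (λ a → W-q (inW a)) f)
              where
              inW : ∀ {a} → a ∈ w ∷ fs → a ∈ W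
              inW {a} m = subst (a ∈_) (sym eW) (∈-++ˡ zs m)

    straight : ∀ {p q r rest} → Top c (p ∷ q ∷ r ∷ rest) → p ∷ q ∷ r ∷ rest ≋ Z → E (not c) p r
    straight {p} {q} {r} t e with E? c p r
    ... | no  n = other {c} {p} {r} n
    ... | yes y with cls p ℕₚ.≟ cls r
    ...   | yes tw = ⊥-elim (Twins.twins⊥ t e tw y)
    ...   | no  ne = ⊥-elim (chord⊥ t e (y , ne))

    -- Between two consecutive vertices satisfying `N` the vertex `y` could be inserted; `Top`
    -- forbids longer cycles of either colour, so the colour of `zs` does not matter.
    insert⊥ : ∀ {xs c′ y} (N : V → Bool) → Top c xs → xs ≋ Z → y ∈ Y → (∀ {x} → N x ≡ true → E c′ x y) →
      ∀ zs → zs ≋ Z → Cyc (E c′) zs → count N zs + count N zs ≤ length zs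
    insert⊥ {xs} {c′} {y} N t e yY h zs ez cy = indep-cyc-≤ N zs
      (λ pre {a} {b} post eq na nb → put (Cyc-rotate pre (a ∷ b ∷ post) (subst (Cyc (E c′)) eq cy)) (≋-trans (≋-swap (a ∷ b ∷ post) pre) (subst (_≋ Z) eq ez)) na nb)
      (λ {a} {b} mid eq na nb → put (Cyc-rotate (a ∷ mid) [ b ]₁ (subst (Cyc (E c′)) eq cy)) (≋-trans (≋-swap [ b ]₁ (a ∷ mid)) (subst (_≋ Z) eq ez)) nb na)
      (subst (2 ≤_) (sym (trans (≋-length ez) (trans lZ (cong (λ i → suc (suc i)) (+-suc m m))))) (s≤s (s≤s z≤n)))
      where
      put : ∀ {a b post} → Cyc (E c′) (a ∷ b ∷ post) → a ∷ b ∷ post ≋ Z → N a ≡ true → N b ≡ true → ⊥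
      put {a} {b} {post} (_ , ch) ea na nb = grown {ys = a ∷ y ∷ b ∷ post} t e (cong suc (≋-length ea))
        (U-⊑ (≋⇒⊑ (perm ([ a ]₁ ▸ [ y ]₁ ▸ (b ∷ post) ▸ ε) (v0 ∪ v1 ∪ v2) (v1 ∪ v0 ∪ v2) refl)) (U-∷ (apart ea yY) (U-⊑ (≋⇒⊑ ea) (U-++ˡ Z Y uZY))))
        (h na , E-sym {c′} {b} {y} (h nb) , ch)

    -- Steps of two arrange the same vertices into a cycle of the other colour. An outside vertex
    -- `y` exists because 4n is even. In each colour it sees at most half of an odd number of
    -- vertices, which leaves a vertex without a colour.
    odd⊥ : ∀ {x₀ x₁ mid z} → Top c (x₀ ∷ x₁ ∷ mid ++ [ z ]₁) → x₀ ∷ x₁ ∷ mid ++ [ z ]₁ ≋ Z → ⊥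
    odd⊥ {x₀} {x₁} {mid} {z} t e =
      let (y , yY , _) = count-∈ (λ _ → true) Y (subst (1 ≤_) (sym (count-true Y)) (left-some k m (length Y) sizes)) in clash y yY
      where
      S = (x₁ ∷ odds mid ++ x₀ ∷ evens mid) ++ [ z ]₁
      pm : S ≋ Z
      pm = ≋-trans (≋-trans (perm ([ x₁ ]₁ ▸ odds mid ▸ [ x₀ ]₁ ▸ evens mid ▸ [ z ]₁ ▸ ε) ((v0 ∪ v1 ∪ v2 ∪ v3) ∪ v4) ((v2 ∪ v0) ∪ (v1 ∪ v3) ∪ v4) refl)
             (≋-++ {xs = x₀ ∷ x₁ ∷ []} ≋-refl (≋-++ (evens-odds mid) ≋-refl))) e
      cyS : Cyc (E (not c)) S
      cyS = let (ch , zx) = round (λ {p} {q} {r} {rest} → straight {p} {q} {r} {rest}) t e in Ch-++ (odds mid ++ x₀ ∷ evens mid) ch zx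
      clash : ∀ y → y ∈ Y → ⊥
      clash y yY = halves⊥ (suc m) (count N Z) (count (not ∘ N) Z) (trans (count-partition N Z) lZ)
        (subst₂ (λ a b → a + a ≤ b) (≋at e N) (trans (≋-length e) lZ) (insert⊥ {c′ = c} N t e yY (λ {x} → does⇒ (E? c x y)) _ e (Top.cyc t)))
        (subst₂ (λ a b → a + a ≤ b) (≋at pm (not ∘ N)) (trans (≋-length pm) lZ) (insert⊥ {c′ = not c} (not ∘ N) t e yY (λ {x} → non x) S pm cyS))
        where
        N : V → Bool
        N x = does (E? c x y)
        non : ∀ x → not (N x) ≡ true → E (not c) x y
        non x h with E? c x y
        ... | no n = other {c} {x} {y} n

  top⊥ : ∀ {c xs} → Top c xs → ⊥
  top⊥ {c} {xs} t with length xs ≤? suc (k + k)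
  ... | yes p = Short.short⊥ t (proj₂ (outside xs (Top.u t))) p
  ... | no  n = long (parity (length xs))
    where
    big-half : ∀ k i → suc (suc (k + k)) ≤ i + i → suc k ≤ i
    big-half k i h with suc k ≤? i
    ... | yes p = p
    ... | no  m = ⊥-elim (1≰0 (linear 1 (h ⊕ s≤s⁻¹ (≰⇒> m) ⊕ s≤s⁻¹ (≰⇒> m)) (lem k i)))
      where
      lem : ∀ k i → i + i + k + k + 1 + 1 ≡ suc (suc (k + k)) + i + i + 0
      lem = solve-∀
    long : (Σ[ i ∈ ℕ ] length xs ≡ i + i) ⊎ (Σ[ i ∈ ℕ ] length xs ≡ suc (i + i)) → ⊥
    long (inj₁ (i , l)) = even⊥ c i xs (big-half k i (subst (suc (suc (k + k)) ≤_) l (≰⇒> n))) l (Top.u t) (Top-real t)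
    long (inj₂ (zero , l)) = n (subst (_≤ suc (k + k)) (sym l) (s≤s z≤n))
    long (inj₂ (suc m , l)) = shape xs l t
      where
      lxs : length xs ≡ suc (suc m + suc m)
      lxs = l
      shape : ∀ zs → length zs ≡ suc (suc m + suc m) → Top c zs → ⊥
      shape (x₀ ∷ [])           l t = case suc-injective l of λ ()
      shape (x₀ ∷ x₁ ∷ [])      l t = case trans (suc-injective (suc-injective l)) (+-suc m m) of λ ()
      shape (x₀ ∷ x₁ ∷ x₂ ∷ zs) l t = split (unsnoc x₂ zs)
        where
        k≤m : k ≤ m
        k≤m = odd-room k m (subst (suc (suc (k + k)) ≤_) lxs (≰⇒> n))
        split : (Σ[ mid ∈ List V ] Σ[ z ∈ V ] x₂ ∷ zs ≡ mid ++ [ z ]₁) → ⊥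
        split (mid , z , eq) = Long.odd⊥ c (x₀ ∷ x₁ ∷ mid ++ [ z ]₁) (proj₁ out) (proj₂ out) m k≤m (trans (cong (λ l → length (x₀ ∷ x₁ ∷ l)) (sym eq)) l)
          (subst (λ l → Top c (x₀ ∷ x₁ ∷ l)) eq t) ≋-refl
          where
          out : Σ[ Y ∈ List V ] (x₀ ∷ x₁ ∷ mid ++ [ z ]₁) ++ Y ≋ allFin M
          out = outside (x₀ ∷ x₁ ∷ mid ++ [ z ]₁) (subst (λ l → U (x₀ ∷ x₁ ∷ l)) eq (Top.u t))

  -- Recursion on the missing length `f` first and on the inner edges `b` second: `longer` and
  -- `flatter` hold because a better cycle would allow climbing on.
  climb : ∀ f b c xs → M ≤ length xs + f → badC xs ≤ b → 2 ≤ length xs → U xs → Cyc (E c) xs → ⊥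
  climb f b c xs hf hb l u cy = top⊥ (record { len≥2 = l ; u = u ; cyc = cy ; longer = lg f hf ; flatter = fl b hb })
    where
    lg : ∀ f → M ≤ length xs + f → ∀ c′ ys → length xs < length ys → U ys → Cyc (E c′) ys → ⊥
    lg zero    hf c′ ys lt uy cy′ = <⇒≱ lt (≤-trans (length≤M uy) (subst (M ≤_) (+-identityʳ _) hf))
    lg (suc f) hf c′ ys lt uy cy′ = climb f (badC ys) c′ ys
      (≤-trans hf (≤-trans (≤-reflexive (+-suc (length xs) f)) (+-monoˡ-≤ f lt))) ≤-refl (≤-trans l (<⇒≤ lt)) uy cy′
    fl : ∀ b → badC xs ≤ b → ∀ ys → length ys ≡ length xs → badC ys < badC xs → U ys → Cyc (E c) ys → ⊥
    fl zero    hb ys le lt uy cy′ = n≮0 (≤-trans lt hb)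
    fl (suc b) hb ys le lt uy cy′ = climb f b c ys (subst (λ z → M ≤ z + f) (sym le) hf) (s≤s⁻¹ (≤-trans lt hb)) (subst (2 ≤_) (sym le) l) uy cy′

  core⊥ : ∀ {x y : V} → x ≢ y → ⊥
  -- An edge run through forwards and backwards counts as a closed chain on two vertices and starts
  -- the ascent.
  core⊥ {x} {y} ne = climb M (badC (x ∷ y ∷ [])) (kol x y) (x ∷ y ∷ []) (m≤n+m M 2) ≤-refl ≤-refl
    (U-pair ne) (refl , kol-sym y x)

-- Small modules

filter-len : {A : Set} (p : A → Bool) (j : ℕ) (xs : List A) → j ≤ count p xs →
  Prefix j (filterᵇ p xs)
filter-len p j xs h = splitAt-length j (filterᵇ p xs) (subst (j ≤_) (sym (length-filter p xs)) h)

module Alternating {M : ℕ} {E : Fin M → Fin M → Set} (side : Fin M → Bool) (alt : ∀ {x y} → E x y → side x ≢ side y) where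

  swap : ∀ {b x y} → side x ≡ b → E x y → side y ≡ not b
  swap {b} {x} {y} s e with side y in q | b
  ... | true  | true  = ⊥-elim (alt e (trans s (sym q)))
  ... | true  | false = refl
  ... | false | true  = refl
  ... | false | false = ⊥-elim (alt e (trans s (sym q)))

  Starts : Bool → List (Fin M) → Set
  Starts b []      = ⊤
  Starts b (x ∷ _) = side x ≡ b

  starts-tail : ∀ {b x} xs → side x ≡ b → Path E (x ∷ xs) → Starts (not b) xs
  starts-tail []      s p       = tt
  starts-tail (y ∷ _) s (e , _) = swap s e

  final-side : ∀ j {x} xs → length xs ≡ j + j → side x ≡ true → Path E (x ∷ xs) → side (final x xs) ≡ true
  final-side zero    []           l s p = s
  final-side (suc j) []           () s p
  final-side (suc j) (_ ∷ [])     l s p = case trans (suc-injective l) (+-suc j j) of λ ()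
  final-side (suc j) (y ∷ z ∷ xs) l s (e , e′ , p) =
    final-side j xs (suc-injective (trans (suc-injective l) (+-suc j j))) (swap (swap s e) e′) p

  counts : ∀ j xs → length xs ≤ j + j → Starts true xs → Path E xs → count side xs ≤ j × count (not ∘ side) xs ≤ j
  counts j       []           l s p = z≤n , z≤n
  counts (suc j) (x ∷ [])     l s p rewrite s = s≤s z≤n , z≤n
  counts (suc j) (x ∷ y ∷ xs) l s (e , p) with counts j xs (s≤s⁻¹ (subst (suc (length xs) ≤_) (+-suc j j) (s≤s⁻¹ l))) (starts-tail xs (swap s e) p) (Path-tail xs p)
  ... | a , b rewrite s | swap s e = s≤s a , s≤s b

  trim : ∀ xs → Path E xs → Σ[ pre ∈ List (Fin M) ] Σ[ ys ∈ List (Fin M) ]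
    (xs ≡ pre ++ ys × Path E ys × Starts true ys × count side pre ≡ 0 × count (not ∘ side) pre ≤ 1)
  trim []       p = [] , [] , refl , tt , tt , refl , z≤n
  trim (x ∷ xs) p with side x in s
  ... | true  = [] , x ∷ xs , refl , p , s , refl , z≤n
  ... | false = [ x ]₁ , xs , refl , Path-tail xs p , starts-tail xs s p , cong (λ b → b2n b + 0) s , ≤-reflexive (cong (λ b → b2n (not b) + 0) s)

H-low : ∀ k t α ρ β → α + t ≡ suc k → t + (ρ + β) ≡ (suc k + suc k) + (suc k + suc k) → β ≤ suc (k + k) → suc (suc k) + α ≤ ρ
H-low k t α ρ β e f h = linear 0 (≤-reflexive (sym f) ⊕ h ⊕ ≤-reflexive e) (solve (k ∷ t ∷ α ∷ ρ ∷ β ∷ []))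

H-red : ∀ k t α ρ s → α + suc t ≡ suc k → suc (suc k) + α ≤ ρ → ρ ≤ suc (α + α) + s → t ≤ s
H-red k t α ρ s e h g = linear 1 (≤-reflexive e ⊕ h ⊕ g) (solve (k ∷ t ∷ α ∷ ρ ∷ s ∷ []))

H-us : ∀ k α ρ a c p s → a + suc c ≡ suc α → suc (suc k) + α ≤ ρ → ρ ≡ a + (p + s) → p ≤ α → α ≤ k → c ≤ s
H-us k α ρ a c p s e h refl g f = linear 2 (≤-reflexive e ⊕ h ⊕ g ⊕ f) (solve (k ∷ α ∷ a ∷ c ∷ p ∷ s ∷ []))

H-blue : ∀ k t α β a c p s → α + suc (suc t) ≡ suc k → a + c ≡ suc α → suc (suc k) + α ≤ β → β ≡ c + (p + s) → p ≤ suc α → suc (a + t) ≤ s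
H-blue k t α β a c p s e₁ e₂ h refl g = linear 0 (≤-reflexive e₁ ⊕ ≤-reflexive e₂ ⊕ h ⊕ g) (solve (k ∷ t ∷ α ∷ a ∷ c ∷ p ∷ s ∷ []))

module Modules {M : ℕ} (cls : Fin M → ℕ) (g : Fin M → Fin M → Bool) (g-sym : ∀ x y → g x y ≡ g y x)
  (g-twin : ∀ {x x′ y} → cls x ≡ cls x′ → cls x ≢ cls y → g x y ≡ g x′ y) (k : ℕ) (k≥1 : 1 ≤ k)
  (nc : ∀ c zs → length zs ≡ suc k + suc k → U zs → Cyc (λ x y → g x y ≡ c × cls x ≢ cls y) zs → ⊥)
  (size : M ≡ (suc k + suc k) + (suc k + suc k))
  (small : ∀ d → count (λ x → does (cls x ℕₚ.≟ d)) (allFin M) ≤ k) where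

  V : Set
  V = Fin M

  Edge : Bool → V → V → Set
  Edge c x y = g x y ≡ c × cls x ≢ cls y

  Edge? : ∀ c x y → Dec (Edge c x y)
  Edge? c x y = (g x y Bool.≟ c) ×-dec ¬? (cls x ℕₚ.≟ cls y)

  Edge-sym : ∀ {c x y} → Edge c x y → Edge c y x
  Edge-sym {c} {x} {y} (e , n) = trans (g-sym y x) e , n ∘ sym

  deg : Bool → V → ℕ
  deg c x = count (λ y → does (Edge? c x y)) (allFin M)

  -- Red is `true`, blue is `false`. Put α = n - |D|. As both degrees are below 2n, `ρ` and `β` are
  -- at least n + 1 + α. A red cycle then needs only a red path on 2α + 1 vertices alternating
  -- between the two neighbourhoods of `D`; a search that finds none separates enough vertices for a
  -- blue cycle.
  module Degrees (x x′ : V) (x≢ : x ≢ x′) (tw : cls x ≡ cls x′) (red : deg true x ≤ suc (k + k)) (blue : deg false x ≤ suc (k + k)) where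

    inD : V → Bool
    inD y = does (cls x ℕₚ.≟ cls y)

    D ND : List V
    D = filterᵇ inD (allFin M)
    ND = filterᵇ (not ∘ inD) (allFin M)

    side : V → Bool
    side y = g x y

    ND-cls : ∀ {y} → y ∈ ND → cls x ≢ cls y
    ND-cls {y} m e = case trans (sym (proj₂ (∈-filter⁻ (not ∘ inD) (allFin M) m))) (cong not (dec-true (cls x ℕₚ.≟ cls y) e)) of λ ()

    D-cls : ∀ {y} → y ∈ D → cls x ≡ cls y
    D-cls {y} m = does⇒ (cls x ℕₚ.≟ cls y) (proj₂ (∈-filter⁻ inD (allFin M) m))

    D-edge : ∀ {d y b} → d ∈ D → y ∈ ND → side y ≡ b → Edge b d y
    D-edge md my s = trans (sym (g-twin (D-cls md) (ND-cls my))) s , λ e → ND-cls my (trans (D-cls md) e)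

    cross : ∀ {u v} → u ∈ ND → v ∈ ND → side u ≢ side v → cls u ≢ cls v
    cross {u} {v} mu mv s e = s (trans (g-sym x u) (trans (g-twin e (ND-cls mu ∘ sym)) (g-sym v x)))

    Bi : V → V → Set
    Bi u v = g u v ≡ true × side u ≢ side v

    Bi? : ∀ u v → Dec (Bi u v)
    Bi? u v = (g u v Bool.≟ true) ×-dec ¬? (side u Bool.≟ side v)

    Bi-sym : ∀ {u v} → Bi u v → Bi v u
    Bi-sym {u} {v} (e , n) = trans (g-sym v u) e , n ∘ sym

    open Alternating {E = Bi} side proj₂
    open DFS {E = Bi} Bi? (λ {u} {v} → Bi-sym {u} {v})

    nonred : ∀ {u v} → u ∈ ND → v ∈ ND → side u ≢ side v → ¬ Bi u v → Edge false u v
    nonred {u} {v} mu mv s n with g u v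
    ... | true  = ⊥-elim (n (refl , s))
    ... | false = refl , cross mu mv s

    ρ β : ℕ
    ρ = count side ND
    β = count (not ∘ side) ND

    DND : D ++ ND ≋ allFin M
    DND = filter-split inD (allFin M)

    uDND : U (D ++ ND)
    uDND = U-⊑ (≋⇒⊑ DND) U-all

    total : length D + (ρ + β) ≡ (suc k + suc k) + (suc k + suc k)
    total = trans (cong (length D +_) (count-partition side ND)) (trans (sym (length-++ D)) (trans (≋-length DND) (trans length-all size)))

    D≤k : length D ≤ k
    D≤k = subst (_≤ k) (sym (length-filter inD (allFin M)))
      (≤-trans (count-mono inD _ (allFin M) (λ y e → dec-true (cls y ℕₚ.≟ cls x) (sym (does⇒ (cls x ℕₚ.≟ cls y) e)))) (small (cls x)))

    ρ≤ : ρ ≤ suc (k + k)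
    ρ≤ = ≤-trans (≤-reflexive (count-filter (not ∘ inD) side (allFin M))) (≤-trans (count-mono _ _ (allFin M) imp) red)
      where
      imp : ∀ y → (not (inD y) ∧ side y) ≡ true → does (Edge? true x y) ≡ true
      imp y h with inD y | g x y
      ... | false | true = refl

    β≤ : β ≤ suc (k + k)
    β≤ = ≤-trans (≤-reflexive (count-filter (not ∘ inD) (not ∘ side) (allFin M))) (≤-trans (count-mono _ _ (allFin M) imp) blue)
      where
      imp : ∀ y → (not (inD y) ∧ not (side y)) ≡ true → does (Edge? false x y) ≡ true
      imp y h with inD y | g x y
      ... | false | false = refl

    within : ∀ {zs : List V} → zs ⊑ ND → U (D ++ zs)
    within h = U-⊑ (⊑-++ {xs = D} ⊑-refl h) uDND

    -- The blue cycle d, β, p, β, …, β, d′, γ, u, γ, …, γ in which the p run through as and Ds.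
    blue-cycle : ∀ {α d d′ Ds} as us γ Γ b bs → D ≡ d ∷ d′ ∷ Ds → α + suc (suc (length Ds)) ≡ suc k → length as + suc (length Γ) ≡ suc α →
      length us ≡ length Γ → length bs ≡ length as + length Ds → as ++ us ++ (γ ∷ Γ) ++ b ∷ bs ⊑ ND →
      (∀ {v} → v ∈ (γ ∷ Γ) ++ b ∷ bs → side v ≡ false) → (∀ {u v} → u ∈ as → v ∈ b ∷ bs → Edge false u v) →
      (∀ {u v} → u ∈ us → v ∈ γ ∷ Γ → Edge false u v) → ⊥
    blue-cycle {α} {d} {d′} {Ds} as us γ Γ b bs eD eα ea lus lbs inc bl e₁ e₂ = nc false new len
      (U-⊑ (≋⇒⊑ pm) (within inc)) cyc
      where
      new = d ∷ (b ∷ interleave (as ++ Ds) bs) ++ d′ ∷ γ ∷ interleave us Γ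
      pm : new ≋ D ++ as ++ us ++ (γ ∷ Γ) ++ b ∷ bs
      pm = ≋-trans (≋-++ {xs = d ∷ b ∷ []} ≋-refl (≋-++ (interleave-≋ (as ++ Ds) bs) (≋-++ {xs = d′ ∷ γ ∷ []} ≋-refl (interleave-≋ us Γ))))
             (≋-trans (perm ([ d ]₁ ▸ [ b ]₁ ▸ as ▸ Ds ▸ bs ▸ ([ d′ ]₁ ++ γ ∷ us ++ Γ) ▸ ε)
                         ((v0 ∪ v1) ∪ ((v2 ∪ v3) ∪ v4) ∪ v5) (v5 ∪ ((v0 ∪ v3) ∪ (v2 ∪ v1 ∪ v4))) refl)
               (≋-trans (perm ([ d′ ]₁ ▸ [ γ ]₁ ▸ us ▸ Γ ▸ ([ d ]₁ ++ Ds) ▸ (as ++ b ∷ bs) ▸ ε)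
                          ((v0 ∪ v1 ∪ v2 ∪ v3) ∪ (v4 ∪ v5)) ((v0 ∪ v4) ∪ (v5 ∪ v2 ∪ (v1 ∪ v3))) refl)
                 (≋-trans (perm ([ d′ ]₁ ▸ [ d ]₁ ▸ Ds ▸ as ▸ (b ∷ bs) ▸ (us ++ γ ∷ Γ) ▸ ε)
                            ((v0 ∪ v1 ∪ v2) ∪ ((v3 ∪ v4) ∪ v5)) ((v1 ∪ v0 ∪ v2) ∪ (v3 ∪ (v5 ∪ v4))) refl)
                   (subst (λ z → (d ∷ d′ ∷ Ds) ++ as ++ (us ++ γ ∷ Γ) ++ b ∷ bs ≋ z ++ as ++ us ++ (γ ∷ Γ) ++ b ∷ bs) (sym eD)
                     (subst (λ z → (d ∷ d′ ∷ Ds) ++ as ++ z ≋ (d ∷ d′ ∷ Ds) ++ as ++ us ++ (γ ∷ Γ) ++ b ∷ bs) (sym (++-assoc us (γ ∷ Γ) (b ∷ bs))) ≋-refl)))))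
      len : length new ≡ suc k + suc k
      len = trans (≋-length (≋-++ {xs = d ∷ b ∷ []} ≋-refl (≋-++ (interleave-≋ (as ++ Ds) bs) (≋-++ {xs = d′ ∷ γ ∷ []} ≋-refl (interleave-≋ us Γ)))))
        (trans (cong (λ i → suc (suc i)) (trans (length-++ ((as ++ Ds) ++ bs)) (cong₂ (λ i j → i + suc (suc j))
            (trans (length-++ (as ++ Ds)) (cong₂ _+_ (length-++ as) lbs)) (trans (length-++ us) (cong (_+ length Γ) lus)))))
          (lem (length as) (length Ds) (length Γ) α k ea eα))
        where
        lem : ∀ a t c α k → a + suc c ≡ suc α → α + suc (suc t) ≡ suc k → suc (suc ((a + t) + (a + t) + suc (suc (c + c)))) ≡ suc k + suc k
        lem a t c α k e f = trans (lem₁ a t c) (trans (cong (λ z → z + z + (t + t)) (trans (cong suc e) (lem₀ α)))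
                              (trans (lem₂ α t) (cong₂ _+_ f f)))
          where
          lem₀ : ∀ α → suc (suc α) ≡ α + 2
          lem₀ α = +-comm 2 α
          lem₁ : ∀ a t c → suc (suc ((a + t) + (a + t) + suc (suc (c + c)))) ≡ suc (a + suc c) + suc (a + suc c) + (t + t)
          lem₁ = solve-∀
          lem₂ : ∀ α t → α + 2 + (α + 2) + (t + t) ≡ α + suc (suc t) + (α + suc (suc t))
          lem₂ = solve-∀
      inND : ∀ {zs : List V} {v} → zs ⊑ as ++ us ++ (γ ∷ Γ) ++ b ∷ bs → v ∈ zs → v ∈ ND
      inND h m = ∈-⊑ (⊑-trans h inc) m
      d-D : d ∈ D
      d-D = subst (d ∈_) (sym eD) (∈-here d _)
      d′-D : d′ ∈ D
      d′-D = subst (d′ ∈_) (sym eD) (∈-there d (∈-here d′ Ds))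
      Ds-D : ∀ {v} → v ∈ Ds → v ∈ D
      Ds-D {v} m = subst (v ∈_) (sym eD) (∈-there d (∈-there d′ m))
      both : ∀ {u v} → Edge false u v → Edge false u v × Edge false v u
      both {u} {v} e = e , Edge-sym {false} {u} {v} e
      B-e : ∀ {u v} → (u ∈ D) ⊎ (u ∈ as) → v ∈ b ∷ bs → Edge false u v × Edge false v u
      B-e (inj₁ mu) mv = both (D-edge mu (inND (⊑-trans (⊑-++ʳ (γ ∷ Γ) (b ∷ bs)) (⊑-trans (⊑-++ʳ us _) (⊑-++ʳ as _))) mv) (bl (∈-++ʳ (γ ∷ Γ) mv)))
      B-e (inj₂ mu) mv = both (e₁ mu mv)
      Γ-e : ∀ {u v} → (u ∈ D) ⊎ (u ∈ us) → v ∈ γ ∷ Γ → Edge false u v × Edge false v u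
      Γ-e (inj₁ mu) mv = both (D-edge mu (inND (⊑-trans (⊑-++ˡ (γ ∷ Γ) (b ∷ bs)) (⊑-trans (⊑-++ʳ us _) (⊑-++ʳ as _))) mv) (bl (∈-++ˡ (b ∷ bs) mv)))
      Γ-e (inj₂ mu) mv = both (e₂ mu mv)
      cyc : Cyc (Edge false) new
      cyc = Ch-++ (b ∷ interleave (as ++ Ds) bs)
        (interleave-Ch {E = Edge false} (λ u → (u ∈ D) ⊎ (u ∈ as)) (_∈ b ∷ bs) B-e (as ++ Ds) bs (trans (length-++ as) (sym lbs)) (inj₁ d-D) (∈-here b bs) (inj₁ d′-D)
          (λ m → [ inj₂ , (λ q → inj₁ (Ds-D q)) ]′ (∈-++⁻ as m)) (∈-there b))
        (interleave-Ch {E = Edge false} (λ u → (u ∈ D) ⊎ (u ∈ us)) (_∈ γ ∷ Γ) Γ-e us Γ lus (inj₁ d′-D) (∈-here γ Γ) (inj₁ d-D) inj₂ (∈-there γ))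

    -- The path has 2α + 1 vertices and both ends in the red neighbourhood of `D`. All of `D` and
    -- |D| - 1 further red neighbours complete it to 2α + 2|D| = 2n vertices.
    red-cycle : ∀ {α d Ds} y us → D ≡ d ∷ Ds → α + suc (length Ds) ≡ suc k → length us ≡ α + α → y ∷ us ⊑ ND → side y ≡ true → Path Bi (y ∷ us) → ⊥
    red-cycle {α} {d} {Ds} y us eD eα lus inc sy path = go (complement (y ∷ us) ND (λ v → ⊑at inc (v ==_)))
      where
      go : (Σ[ zs ∈ List V ] (y ∷ us) ++ zs ≋ ND) → ⊥
      go (zs , eZ) = go₂ (filter-len side (length Ds) zs (H-red k (length Ds) α ρ (count side zs) eα
          (H-low k (length D) α ρ β (trans (cong (λ z → α + length z) eD) eα) total β≤)
          (≤-trans (≤-reflexive (trans (sym (≋at eZ side)) (count-++ side (y ∷ us) zs))) (+-monoˡ-≤ _ (≤-trans (count-≤-length side (y ∷ us)) (≤-reflexive (cong suc lus)))))))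
        where
        go₂ : Prefix (length Ds) (filterᵇ side zs) → ⊥
        go₂ (rs , ws , eR , lrs) = nc true new len (U-⊑ (⊑-trans (≋⇒⊑ pm) (subst (λ z → (d ∷ Ds) ++ (y ∷ us) ++ rs ⊑ z ++ (y ∷ us) ++ rs) (sym eD) ⊑-refl))
                                   (within (⊑-trans (⊑-++ {xs = y ∷ us} ⊑-refl rs⊑) (≋⇒⊑ eZ)))) cyc
          where
          new = y ∷ us ++ d ∷ interleave rs Ds
          rs⊑ : rs ⊑ zs
          rs⊑ = ⊑-trans (⊑-++ˡ rs ws) (subst (_⊑ zs) eR (filter-⊑ side zs))
          pm : new ≋ (d ∷ Ds) ++ (y ∷ us) ++ rs
          pm = ≋-trans (≋-++ {xs = y ∷ us} ≋-refl (≋-++ {xs = [ d ]₁} ≋-refl (interleave-≋ rs Ds)))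
                 (perm ((y ∷ us) ▸ [ d ]₁ ▸ rs ▸ Ds ▸ ε) (v0 ∪ v1 ∪ v2 ∪ v3) ((v1 ∪ v3) ∪ v0 ∪ v2) refl)
          len : length new ≡ suc k + suc k
          len = trans (≋-length pm) (trans (length-++ (d ∷ Ds)) (trans (cong (suc (length Ds) +_) (trans (length-++ (y ∷ us)) (cong₂ (λ i j → suc i + j) lus lrs)))
                  (trans (lem (length Ds) α) (cong₂ _+_ eα eα))))
            where
            lem : ∀ t α → suc t + (suc (α + α) + t) ≡ α + suc t + (α + suc t)
            lem = solve-∀
          y-ND : ∀ {v} → v ∈ y ∷ us → v ∈ ND
          y-ND = ∈-⊑ inc
          d-D : d ∈ D
          d-D = subst (d ∈_) (sym eD) (∈-here d Ds)
          Ds-D : ∀ {v} → v ∈ Ds → v ∈ D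
          Ds-D {v} m = subst (v ∈_) (sym eD) (∈-there d m)
          rs-R : ∀ {v} → v ∈ rs → v ∈ ND × side v ≡ true
          rs-R {v} m = let (a , s) = ∈-filter⁻ side zs (subst (v ∈_) (sym eR) (∈-++ˡ ws m)) in ≋-∈ eZ (∈-++ʳ (y ∷ us) a) , s
          RD : ∀ {u v} → u ∈ ND × side u ≡ true → v ∈ D → Edge true u v × Edge true v u
          RD {u} {v} (mu , su) mv = let e = D-edge mv mu su in Edge-sym {true} {v} {u} e , e
          fin : final y us ∈ ND × side (final y us) ≡ true
          fin = y-ND (final-∈ y us) , final-side α us lus sy path
          tour : ∀ z zs → (∀ {v} → v ∈ z ∷ zs → v ∈ ND) → Path Bi (z ∷ zs) → Path (Edge true) (z ∷ zs)
          tour z []       h p       = tt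
          tour z (w ∷ zs) h (e , p) = (proj₁ e , cross (h (∈-here z _)) (h (∈-there z (∈-here w zs))) (proj₂ e)) , tour w zs (λ m → h (∈-there z m)) p
          cyc : Cyc (Edge true) new
          cyc = Ch-++ us (Path-Ch us (tour y us y-ND path) (proj₁ turn)) (proj₂ turn)
            where
            turn : Ch (Edge true) (final y us) (d ∷ interleave rs Ds) y
            turn = interleave-Ch {E = Edge true} (λ u → u ∈ ND × side u ≡ true) (_∈ D) RD rs Ds lrs fin d-D (y-ND (∈-here y us) , sy) rs-R Ds-D

    module Search {d d′ Ds} (eD : D ≡ d ∷ d′ ∷ Ds) (α : ℕ) (eα : α + suc (suc (length Ds)) ≡ suc k) where

      ρ-low : suc (suc k) + α ≤ ρ
      ρ-low = H-low k (length D) α ρ β (trans (cong (λ z → α + length z) eD) eα) total β≤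

      β-low : suc (suc k) + α ≤ β
      β-low = H-low k (length D) α β ρ (trans (cong (λ z → α + length z) eD) eα) (trans (cong (length D +_) (+-comm β ρ)) total) ρ≤

      st : State ND (suc α)
      st = dfs ND (suc α) (≤-trans (s≤s (m≤n+m α (suc k))) (≤-trans ρ-low (count-≤-length side ND)))

      open State st

      three-way : ∀ p → count p ND ≡ count p done + (count p stack + count p rest)
      three-way p = trans (sym (≋at parts p)) (trans (count-++ p done _) (cong (count p done +_) (count-++ p stack rest)))

      done-ND : ∀ {v} → v ∈ done → v ∈ ND
      done-ND m = ≋-∈ parts (∈-++ˡ _ m)

      rest-ND : ∀ {v} → v ∈ rest → v ∈ ND
      rest-ND m = ≋-∈ parts (∈-++ʳ done (∈-++ʳ stack m))

      ac : count side done + count (not ∘ side) done ≡ suc α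
      ac = trans (count-partition side done) finished

      differ : ∀ {u v} → side u ≡ true → side v ≡ false → side u ≢ side v
      differ su sv e = case trans (sym su) (trans e sv) of λ ()

      dr : ∀ {u v} → u ∈ done → v ∈ rest → side u ≡ true → side v ≡ false → Edge false u v
      dr mu mv su sv = nonred (done-ND mu) (rest-ND mv) (differ su sv) (apart mu mv)

      rd : ∀ {u v} → u ∈ rest → v ∈ done → side u ≡ true → side v ≡ false → Edge false u v
      rd {u} {v} mu mv su sv = nonred (rest-ND mu) (done-ND mv) (differ su sv) (λ e → apart mv mu (Bi-sym {u} {v} e))

      unnot : ∀ {b} → not b ≡ true → b ≡ false
      unnot {false} _ = refl

      assemble : ∀ {as γs us bs : List V} → as ⊑ filterᵇ side done → γs ⊑ filterᵇ (not ∘ side) done →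
        us ⊑ filterᵇ side rest → bs ⊑ filterᵇ (not ∘ side) rest → as ++ us ++ γs ++ bs ⊑ ND
      assemble {as} {γs} {us} {bs} h₁ h₂ h₃ h₄ = ⊑-trans (≋⇒⊑ (perm (as ▸ us ▸ γs ▸ bs ▸ ε) (v0 ∪ v1 ∪ v2 ∪ v3) ((v0 ∪ v2) ∪ (v1 ∪ v3)) refl))
        (⊑-trans (⊑-++ (⊑-trans (⊑-++ h₁ h₂) (≋⇒⊑ (filter-split side done))) (⊑-trans (⊑-++ h₃ h₄) (≋⇒⊑ (filter-split side rest))))
          (⊑-trans (sub (done ▸ stack ▸ rest ▸ ε) (v0 ∪ v2) (v0 ∪ v1 ∪ v2) v1 refl) (≋⇒⊑ parts)))

      -- A short stack leaves many vertices in `rest`. Finished red neighbours of `D` are blue to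
      -- the blue neighbours in `rest`, and finished blue ones are blue to the red neighbours there;
      -- `D` links the two kinds.
      cut-free : count side stack ≤ α → count (not ∘ side) stack ≤ suc α → ⊥
      cut-free ps pb = go (filterᵇ (not ∘ side) done) refl
        where
        t = length Ds
        room : suc (count side done + t) ≤ count (not ∘ side) rest
        room = H-blue k t α β (count side done) (count (not ∘ side) done) (count (not ∘ side) stack) (count (not ∘ side) rest) eα ac β-low (three-way (not ∘ side)) pb
        B-in : ∀ {ys zs v} → filterᵇ (not ∘ side) rest ≡ ys ++ zs → v ∈ ys → v ∈ rest × side v ≡ false
        B-in {ys} {zs} {v} e m = let (a , s) = ∈-filter⁻ (not ∘ side) rest (subst (v ∈_) (sym e) (∈-++ˡ zs m)) in a , unnot s
        go : ∀ γs → filterᵇ (not ∘ side) done ≡ γs → ⊥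
        -- No blue neighbour of `D` is finished: `γ` is borrowed from `rest`, and one of the α + 1
        -- finished vertices is left aside to keep the length.
        go [] eΓ = go₂ (filter-len side α done (≤-trans (n≤1+n α) (≤-reflexive (sym a≡)))) (filter-len (not ∘ side) (suc (suc α + t)) rest (subst (λ a → suc (a + t) ≤ count (not ∘ side) rest) a≡ room))
          where
          a≡ : count side done ≡ suc α
          a≡ = trans (sym (+-identityʳ _)) (trans (cong (count side done +_) (trans (cong length (sym eΓ)) (length-filter (not ∘ side) done))) ac)
          go₂ : Prefix α (filterᵇ side done) → Prefix (suc (suc α + t)) (filterᵇ (not ∘ side) rest) → ⊥
          go₂ (as , zs , eA , la) (γ ∷ b ∷ bs , ws , eB , lb) = blue-cycle {α} as [] γ [] b bs eD eα (trans (+-comm _ 1) (cong suc la)) refl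
            (trans (suc-injective (suc-injective lb)) (cong (_+ t) (sym la)))
            (assemble {as} {[]} {[]} {γ ∷ b ∷ bs} (subst (as ⊑_) (sym eA) (⊑-++ˡ as zs)) (⊑! λ _ → z≤n) (⊑! λ _ → z≤n) (subst (γ ∷ b ∷ bs ⊑_) (sym eB) (⊑-++ˡ (γ ∷ b ∷ bs) ws)))
            (λ m → proj₂ (B-in eB m))
            (λ {u} {v} mu mv → let (mu′ , su) = ∈-filter⁻ side done (subst (u ∈_) (sym eA) (∈-++ˡ zs mu)) ; (mv′ , sv) = B-in eB (∈-there γ mv) in dr mu′ mv′ su sv)
            (λ m _ → ⊥-elim (∉[] m))
        go (γ ∷ Γ) eΓ = go₂ (filter-len side (length Γ) rest (H-us k α ρ (count side done) (length Γ) (count side stack) (count side rest) a≡ ρ-low (three-way side) ps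
                          (s≤s⁻¹ (≤-trans (≤-trans (s≤s (m≤m+n α (suc t))) (≤-reflexive (sym (+-suc α (suc t))))) (≤-reflexive eα)))))
                        (filter-len (not ∘ side) (suc (count side done + t)) rest room)
          where
          a≡ : count side done + suc (length Γ) ≡ suc α
          a≡ = trans (cong (count side done +_) (trans (cong length (sym eΓ)) (length-filter (not ∘ side) done))) ac
          go₂ : Prefix (length Γ) (filterᵇ side rest) → Prefix (suc (count side done + t)) (filterᵇ (not ∘ side) rest) → ⊥
          go₂ (us , zs , eU , lu) (b ∷ bs , ws , eB , lb) = blue-cycle {α} (filterᵇ side done) us γ Γ b bs eD eα
            (trans (cong (_+ suc (length Γ)) (length-filter side done)) a≡) lu
            (trans (suc-injective lb) (cong (_+ t) (sym (length-filter side done))))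
            (assemble {filterᵇ side done} {γ ∷ Γ} {us} {b ∷ bs} ⊑-refl (subst (γ ∷ Γ ⊑_) (sym eΓ) ⊑-refl) (subst (us ⊑_) (sym eU) (⊑-++ˡ us zs)) (subst (b ∷ bs ⊑_) (sym eB) (⊑-++ˡ (b ∷ bs) ws)))
            (λ m → [ (λ q → proj₂ (Γ-in q)) , (λ q → proj₂ (B-in eB q)) ]′ (∈-++⁻ (γ ∷ Γ) m))
            (λ {u} {v} mu mv → let (mu′ , su) = ∈-filter⁻ side done mu ; (mv′ , sv) = B-in eB mv in dr mu′ mv′ su sv)
            (λ {u} {v} mu mv → let (mu′ , su) = ∈-filter⁻ side rest (subst (u ∈_) (sym eU) (∈-++ˡ zs mu)) ; (mv′ , sv) = Γ-in mv in rd mu′ mv′ su sv)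
            where
            Γ-in : ∀ {v} → v ∈ γ ∷ Γ → v ∈ done × side v ≡ false
            Γ-in {v} m = let (a , s) = ∈-filter⁻ (not ∘ side) done (subst (v ∈_) (sym eΓ) m) in a , unnot s

      search⊥ : ⊥
      search⊥ = go (trim stack path)
        where
        stack⊑ : stack ⊑ ND
        stack⊑ = ⊑-trans (sub (done ▸ stack ▸ rest ▸ ε) v1 (v0 ∪ v1 ∪ v2) (v0 ∪ v2) refl) (≋⇒⊑ parts)
        go : (Σ[ pre ∈ List V ] Σ[ ys ∈ List V ] (stack ≡ pre ++ ys × Path Bi ys × Starts true ys × count side pre ≡ 0 × count (not ∘ side) pre ≤ 1)) → ⊥
        go (pre , ys , eS , p , s , c₀ , c₁) with length ys ≤? α + α
        ... | yes le = cut-free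
              (subst (_≤ α) (trans (cong (_+ count side ys) (sym c₀)) (trans (sym (count-++ side pre ys)) (cong (count side) (sym eS)))) (proj₁ (counts α ys le s p)))
              (subst (_≤ suc α) (trans (sym (count-++ (not ∘ side) pre ys)) (cong (count (not ∘ side)) (sym eS))) (+-mono-≤ c₁ (proj₂ (counts α ys le s p))))
        ... | no  gt = long ys s p (subst (ys ⊑_) (sym eS) (⊑-++ʳ pre ys)) (≰⇒> gt)
          where
          long : ∀ ys → Starts true ys → Path Bi ys → ys ⊑ stack → α + α < length ys → ⊥
          long (y ∷ ys) s p inc lt = cut (splitAt-length (α + α) ys (s≤s⁻¹ lt))
            where
            cut : Prefix (α + α) ys → ⊥
            cut (us , zs , refl , l) = red-cycle {α} y us eD eα l (⊑-trans (⊑-++ˡ (y ∷ us) zs) (⊑-trans inc stack⊑)) s (Path-++ˡ (y ∷ us) p)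

    degrees⊥ : ⊥
    degrees⊥ = shape D refl
      where
      x-D : x ∈ D
      x-D = ∈-filter⁺ inD (allFin M) (∈-all x) (dec-true (cls x ℕₚ.≟ cls x) refl)
      x′-D : x′ ∈ D
      x′-D = ∈-filter⁺ inD (allFin M) (∈-all x′) (dec-true (cls x ℕₚ.≟ cls x′) tw)
      shape : ∀ L → D ≡ L → ⊥
      shape []            e = ∉[] (subst (x ∈_) e x-D)
      shape (d ∷ [])      e = x≢ (trans (∈-single (subst (x ∈_) e x-D)) (sym (∈-single (subst (x′ ∈_) e x′-D))))
      shape (d ∷ d′ ∷ Ds) e = Search.search⊥ e (suc k ∸ suc (suc (length Ds))) (m∸n+n≡m (m≤n⇒m≤1+n (subst (λ z → length z ≤ k) e D≤k)))

  deg-twin : ∀ {x x′} c → cls x ≡ cls x′ → deg c x ≡ deg c x′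
  deg-twin {x} {x′} c tw = ≤-antisym (count-mono _ _ (allFin M) (mono tw)) (count-mono _ _ (allFin M) (mono (sym tw)))
    where
    mono : ∀ {a b} → cls a ≡ cls b → ∀ y → does (Edge? c a y) ≡ true → does (Edge? c b y) ≡ true
    mono {a} {b} t y h = let (e , n) = does⇒ (Edge? c a y) h in dec-true (Edge? c b y) (trans (sym (g-twin t n)) e , λ q → n (trans t q))

  -- Inside a class every pair receives a colour in which the class has many neighbours.
  inner : V → Bool
  inner x = does (suc k + suc k ≤? deg true x)

  kol : V → V → Bool
  kol x y = if does (cls x ℕₚ.≟ cls y) then inner x else g x y

  kol-in : ∀ {x y} → cls x ≡ cls y → kol x y ≡ inner x
  kol-in {x} {y} e = cong (if_then inner x else g x y) (dec-true (cls x ℕₚ.≟ cls y) e)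

  kol-out : ∀ {x y} → cls x ≢ cls y → kol x y ≡ g x y
  kol-out {x} {y} n = cong (if_then inner x else g x y) (dec-false (cls x ℕₚ.≟ cls y) n)

  inner-twin : ∀ {x y} → cls x ≡ cls y → inner x ≡ inner y
  inner-twin e = cong (λ d → does (suc k + suc k ≤? d)) (deg-twin true e)

  kol-sym : ∀ x y → kol x y ≡ kol y x
  kol-sym x y = by (cls x ℕₚ.≟ cls y)
    where
    by : Dec (cls x ≡ cls y) → kol x y ≡ kol y x
    by (yes e) = trans (kol-in e) (trans (inner-twin e) (sym (kol-in (sym e))))
    by (no n)  = trans (kol-out n) (trans (g-sym x y) (sym (kol-out (n ∘ sym))))

  kol-twin : ∀ {x x′} y → cls x ≡ cls x′ → kol x y ≡ kol x′ y
  kol-twin {x} {x′} y t = by (cls x ℕₚ.≟ cls y)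
    where
    by : Dec (cls x ≡ cls y) → kol x y ≡ kol x′ y
    by (yes e) = trans (kol-in e) (trans (inner-twin t) (sym (kol-in (trans (sym t) e))))
    by (no n)  = trans (kol-out n) (trans (g-twin t n) (sym (kol-out (λ q → n (trans t q)))))

  open TwoColoured cls kol kol-sym kol-twin using (Real; Real?)

  heavy : ∀ x x′ → x ≢ x′ → cls x ≡ cls x′ → suc k + suc k ≤ count (λ y → does (Real? (kol x x′) x y)) (allFin M)
  heavy x x′ ne tw = subst (λ c → suc k + suc k ≤ count (λ y → does (Real? c x y)) (allFin M)) (sym (kol-in tw)) (by (suc k + suc k ≤? deg true x) (suc k + suc k ≤? deg false x))
    where
    up : ∀ {c} → suc k + suc k ≤ deg c x → suc k + suc k ≤ count (λ y → does (Real? c x y)) (allFin M)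
    up {c} h = ≤-trans h (count-mono _ _ (allFin M) λ y p → let (e , n) = does⇒ (Edge? c x y) p in dec-true (Real? c x y) (trans (kol-out n) e , n))
    by : Dec (suc k + suc k ≤ deg true x) → Dec (suc k + suc k ≤ deg false x) → suc k + suc k ≤ count (λ y → does (Real? (inner x) x y)) (allFin M)
    by (yes p) _ = subst (λ c → suc k + suc k ≤ count (λ y → does (Real? c x y)) (allFin M)) (sym (dec-true (suc k + suc k ≤? deg true x) p)) (up p)
    by (no n) (yes p) = subst (λ c → suc k + suc k ≤ count (λ y → does (Real? c x y)) (allFin M)) (sym (dec-false (suc k + suc k ≤? deg true x) n)) (up p)
    by (no n) (no m) = ⊥-elim (Degrees.degrees⊥ x x′ ne tw (lower n) (lower m))
      where
      lower : ∀ {d} → ¬ (suc k + suc k ≤ d) → d ≤ suc (k + k)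
      lower {d} n = subst (d ≤_) (+-suc k k) (s≤s⁻¹ (≰⇒> n))

  modules⊥ : ∀ {x y : V} → x ≢ y → ⊥
  modules⊥ = Climb.core⊥ cls kol kol-sym kol-twin k k≥1
    (λ c zs l u cy → nc c zs l u (Cyc-map (λ {a} {b} (e , n) → trans (sym (kol-out n)) e , n) zs cy)) size heavy

-- Gallai partitions

module Partition {N q : ℕ} (c : Colouring N q) (gallai : Gallai c) where

  V : Set
  V = Fin N

  col′ : V → V → Fin q
  col′ = col c

  tri : ∀ {x y z} → x ≢ y → y ≢ z → x ≢ z → col′ x y ≢ col′ y z → col′ y z ≢ col′ x z → col′ x y ≡ col′ x z
  tri {x} {y} {z} n₁ n₂ n₃ a b = decidable-stable (col′ x y Fin.≟ col′ x z) λ d → gallai (x , y , z , n₁ , n₂ , n₃ , a , b , d)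

  -- A colour that occurs in `R` but does not connect it. The edge from `u` to `w` witnesses the
  -- occurrence and later makes the component of `u` non-trivial.
  record Cut (R : List V) : Set where
    field
      i       : Fin q
      S T     : List V
      parts   : S ++ T ≋ R
      s t u w : V
      s∈      : s ∈ S
      t∈      : t ∈ T
      apart   : ∀ {x y} → x ∈ S → y ∈ T → col′ x y ≢ i
      u∈      : u ∈ R
      w∈      : w ∈ R
      u≢w     : u ≢ w
      edge    : col′ u w ≡ i

  Within : Fin q → Fin q → List V → Set
  Within r b R = ∀ {x y} → x ∈ R → y ∈ R → x ≢ y → col′ x y ≡ r ⊎ col′ x y ≡ b

  -- Connectedness expressed by invariants instead of walks.
  Conn : Fin q → List V → Set
  Conn i K = ∀ (f : V → ℕ) → (∀ {a b} → a ∈ K → b ∈ K → col′ a b ≡ i → f a ≡ f b) → ∀ {a b} → a ∈ K → b ∈ K → f a ≡ f b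

  record Comp (i : Fin q) (v : V) (R : List V) : Set where
    field
      K Z   : List V
      parts : K ++ Z ≋ R
      v∈    : v ∈ K
      conn  : Conn i K
      apart : ∀ {x y} → x ∈ K → y ∈ Z → col′ x y ≢ i

  private
    touch? : ∀ i K r → Dec (1 ≤ count (λ a → does (col′ r a Fin.≟ i)) K)
    touch? i K r = 1 ≤? count (λ a → does (col′ r a Fin.≟ i)) K

  nbr? : ∀ i v K → (Σ[ a ∈ V ] (a ∈ K × col′ v a ≡ i)) ⊎ (∀ {a} → a ∈ K → col′ v a ≢ i)
  nbr? i v K with search (λ a → col′ v a Fin.≟ i) K
  ... | inj₁ (as , a , bs , refl , e) = inj₁ (a , ∈-mid as a bs , e)
  ... | inj₂ h = inj₂ h

  flip-col : ∀ {x y i} → col′ x y ≢ i → col′ y x ≢ i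
  flip-col {x} {y} n e = n (trans (col-sym c x y) e)

  grow : ∀ f i v K Z → length Z ≤ f → v ∈ K → Conn i K → Comp i v (K ++ Z)
  grow f i v K Z l m cn with search (touch? i K) Z
  ... | inj₂ none = record { K = K ; Z = Z ; parts = ≋-refl ; v∈ = m ; conn = cn
                           ; apart = λ {x} {y} xk yz e → none yz (∈-count _ K xk (dec-true (col′ y x Fin.≟ i) (trans (col-sym c y x) e))) }
  grow zero i v K Z l m cn | inj₁ (as , w , bs , refl , h) = case subst (_≤ 0) (length-++ as) l of λ l′ → case ≤-trans (m≤n+m _ (length as)) l′ of λ ()
  grow (suc f) i v K Z l m cn | inj₁ (as , w , bs , refl , h) =
    let (a , ak , e) = count-∈ (λ a → does (col′ w a Fin.≟ i)) K h
        C = grow f i v (w ∷ K) (as ++ bs) (s≤s⁻¹ (≤-trans (≤-reflexive (≋-length {xs = w ∷ as ++ bs} {as ++ w ∷ bs} (perm ([ w ]₁ ▸ as ▸ bs ▸ ε) (v0 ∪ v1 ∪ v2) (v1 ∪ v0 ∪ v2) refl))) l))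
              (∈-there w m) (more a ak (does⇒ (col′ w a Fin.≟ i) e))
    in record { K = Comp.K C ; Z = Comp.Z C ; v∈ = Comp.v∈ C ; conn = Comp.conn C ; apart = Comp.apart C
              ; parts = ≋-trans (Comp.parts C) (perm (K ▸ [ w ]₁ ▸ as ▸ bs ▸ ε) (v1 ∪ v0 ∪ v2 ∪ v3) (v0 ∪ v2 ∪ v1 ∪ v3) refl) }
    where
    more : ∀ a → a ∈ K → col′ w a ≡ i → Conn i (w ∷ K)
    more a ak e f h {x} {y} mx my = go (∈-∷⁻ mx) (∈-∷⁻ my)
      where
      onK : ∀ {x y} → x ∈ K → y ∈ K → f x ≡ f y
      onK = cn f (λ p r → h (∈-there w p) (∈-there w r))
      go : (x ≡ w) ⊎ (x ∈ K) → (y ≡ w) ⊎ (y ∈ K) → f x ≡ f y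
      go (inj₁ refl) (inj₁ refl) = refl
      go (inj₁ refl) (inj₂ yk)   = trans (h (∈-here w K) (∈-there w ak) e) (onK ak yk)
      go (inj₂ xk)   (inj₁ refl) = trans (onK xk ak) (sym (h (∈-here w K) (∈-there w ak) e))
      go (inj₂ xk)   (inj₂ yk)   = onK xk yk

  component : ∀ i {v} R → v ∈ R → Comp i v R
  component i {v} R m = let (Z , e) = remove R m
                            C = grow (length Z) i v [ v ]₁ Z ≤-refl (∈-here v []) single
                        in record { K = Comp.K C ; Z = Comp.Z C ; v∈ = Comp.v∈ C ; conn = Comp.conn C ; apart = Comp.apart C
                                  ; parts = ≋-trans (Comp.parts C) e }
    where
    single : Conn i [ v ]₁
    single f h a b = cong f (trans (∈-single a) (sym (∈-single b)))

  -- For an edge ab of colour `i` in `K`, the triangle a, b, y has no other edge of colour `i`, so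
  -- its two edges at `y` agree. The colour towards `y` is thus an invariant in the sense of `Conn`.
  uniform : ∀ {i K y a b} → Conn i K → (∀ {x} → x ∈ K → col′ x y ≢ i) → ¬ (y ∈ K) → a ∈ K → b ∈ K → col′ a y ≡ col′ b y
  uniform {i} {K} {y} cn ap y∉ ma mb = Finₚ.toℕ-injective (cn (λ x → toℕ (col′ x y)) (λ p r e → cong toℕ (same p r e)) ma mb)
    where
    same : ∀ {a b} → a ∈ K → b ∈ K → col′ a b ≡ i → col′ a y ≡ col′ b y
    same {a} {b} p r e with a Fin.≟ b
    ... | yes refl = refl
    ... | no  n = decidable-stable (col′ a y Fin.≟ col′ b y) λ d → ap p
          (trans (sym (tri n (λ { refl → y∉ r }) (λ { refl → y∉ p }) (λ h → ap r (trans (sym h) e)) (d ∘ sym))) e)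

  -- If `Z` were empty, the indicator function of `S` would be an invariant and hence constant on
  -- all of `R`.
  cut-comp : ∀ {R} (C : Cut R) → U R → ∀ {v} (D : Comp (Cut.i C) v R) → Σ[ z ∈ V ] z ∈ Comp.Z D
  cut-comp {R} C uR D = some (Comp.Z D) refl
    where
    open Cut C
    uST : U (S ++ T)
    uST = U-⊑ (≋⇒⊑ parts) uR
    inK : Comp.Z D ≡ [] → ∀ {x} → x ∈ R → x ∈ Comp.K D
    inK eZ {x} m = [ id , (λ z → ⊥-elim (∉[] (subst (x ∈_) eZ z))) ]′ (∈-++⁻ (Comp.K D) (≋-∈ (≋-sym (Comp.parts D)) m))
    f : V → ℕ
    f x = b2n (does (1 ≤? count (x ==_) S))
    on-S : ∀ {x} → x ∈ S → f x ≡ 1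
    on-S {x} (mem m) = cong b2n (dec-true (1 ≤? count (x ==_) S) m)
    on-T : ∀ {x} → x ∈ T → f x ≡ 0
    on-T {x} m = cong b2n (dec-false (1 ≤? count (x ==_) S) (λ h → ∉-both S T uST (mem h) m))
    side : ∀ {x} → x ∈ Comp.K D → (x ∈ S) ⊎ (x ∈ T)
    side m = ∈-++⁻ S (≋-∈ (≋-sym parts) (≋-∈ (Comp.parts D) (∈-++ˡ (Comp.Z D) m)))
    level : ∀ {a b} → a ∈ Comp.K D → b ∈ Comp.K D → col′ a b ≡ i → f a ≡ f b
    level {a} {b} ma mb e with side ma | side mb
    ... | inj₁ p | inj₁ r = trans (on-S p) (sym (on-S r))
    ... | inj₁ p | inj₂ r = ⊥-elim (apart p r e)
    ... | inj₂ p | inj₁ r = ⊥-elim (flip-col (apart r p) e)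
    ... | inj₂ p | inj₂ r = trans (on-T p) (sym (on-T r))
    some : ∀ Z → Comp.Z D ≡ Z → Σ[ z ∈ V ] z ∈ Z
    some (z ∷ Z) eZ = z , ∈-here z Z
    some []      eZ = ⊥-elim (case trans (sym (on-S s∈)) (trans (Comp.conn D f level (inK eZ (≋-∈ parts (∈-++ˡ T s∈))) (inK eZ (≋-∈ parts (∈-++ʳ S t∈)))) (on-T t∈)) of λ ())

  -- Gallai: a set with three colours has a disconnected one; the vertex v joins a set for which this is known.
  -- The double negation is harmless, since only monochromatic cycles, a decidable property, are sought in the end.
  cut-or-two : ∀ v R → U (v ∷ R) → (Cut (v ∷ R) → ⊥) → (∀ r b → Within r b (v ∷ R) → ⊥) → ⊥
  cut-or-two v [] uvR cut⊥ two⊥ = two⊥ (col′ v v) (col′ v v) λ a b n → ⊥-elim (n (trans (∈-single a) (sym (∈-single b))))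
  cut-or-two v R@(v′ ∷ R′) uvR cut⊥ two⊥ = cut-or-two v′ R′ uR old-cut old-two
    where
    uR : U R
    uR = U-++ʳ [ v ]₁ R uvR
    v∉ : ∀ {x} → x ∈ R → v ≢ x
    v∉ m refl = ∉-both [ v ]₁ R uvR (∈-here v []) m
    off? : ∀ r b x → Dec (col′ v x ≢ r × col′ v x ≢ b)
    off? r b x = ¬? (col′ v x Fin.≟ r) ×-dec ¬? (col′ v x Fin.≟ b)
    either : ∀ {j r b : Fin q} → ¬ (j ≢ r × j ≢ b) → j ≡ r ⊎ j ≡ b
    either {j} {r} {b} h with j Fin.≟ r | j Fin.≟ b
    ... | yes e | _     = inj₁ e
    ... | no  _ | yes e = inj₂ e
    ... | no  m | no  n = ⊥-elim (h (m , n))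
    swap⊎ : ∀ {x y r b} → col′ x y ≡ r ⊎ col′ x y ≡ b → col′ y x ≡ r ⊎ col′ y x ≡ b
    swap⊎ {x} {y} = [ (λ e → inj₁ (trans (col-sym c y x) e)) , (λ e → inj₂ (trans (col-sym c y x) e)) ]′
    extend : ∀ r b → Within r b R → (∀ {x} → x ∈ R → col′ v x ≡ r ⊎ col′ v x ≡ b) → Within r b (v ∷ R)
    extend r b h g {x} {y} mx my n with ∈-∷⁻ mx | ∈-∷⁻ my
    ... | inj₁ refl | inj₁ refl = ⊥-elim (n refl)
    ... | inj₁ refl | inj₂ y∈   = g y∈
    ... | inj₂ x∈   | inj₁ refl = swap⊎ (g x∈)
    ... | inj₂ x∈   | inj₂ y∈   = h x∈ y∈ n

    -- If `v` sees `x` in a third colour, any `y` that `v` sees differently is isolated in that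
    -- colour. If there is no such `y`, then `v` is isolated in colour `r`, which is therefore cut
    -- or absent; in the latter case the third colour takes its place.
    old-two : ∀ r b → Within r b R → ⊥
    old-two r b h = new (search (off? r b) R)
      where
      new : Searched (λ x → col′ v x ≢ r × col′ v x ≢ b) R → ⊥
      new (inj₂ none) = two⊥ r b (extend r b h (λ m → either (none m)))
      new (inj₁ (as , x , bs , eR , xr , xb)) = further (search (λ y → ¬? (col′ v y Fin.≟ col′ v x)) R)
        where
        x∈ : x ∈ R
        x∈ = subst (x ∈_) (sym eR) (∈-mid as x bs)
        further : Searched (λ y → col′ v y ≢ col′ v x) R → ⊥
        further (inj₁ (as , y , bs , eR , ne)) = cut⊥ (record
          { i = col′ v x ; S = [ y ]₁ ; T = v ∷ as ++ bs
          ; parts = subst (λ z → [ y ]₁ ++ v ∷ as ++ bs ≋ v ∷ z) (sym eR) (perm ([ v ]₁ ▸ [ y ]₁ ▸ as ▸ bs ▸ ε) (v1 ∪ v0 ∪ v2 ∪ v3) (v0 ∪ v2 ∪ v1 ∪ v3) refl)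
          ; s = y ; t = v ; u = v ; w = x ; s∈ = ∈-here y [] ; t∈ = ∈-here v _ ; u∈ = ∈-here v R ; w∈ = ∈-there v x∈ ; u≢w = v∉ x∈ ; edge = refl
          ; apart = λ ms mt → sep ms (∈-∷⁻ mt) })
          where
          uy : U (y ∷ as ++ bs)
          uy = U-⊑ (subst (y ∷ as ++ bs ⊑_) (sym eR) (≋⇒⊑ (perm ([ y ]₁ ▸ as ▸ bs ▸ ε) (v0 ∪ v1 ∪ v2) (v1 ∪ v0 ∪ v2) refl))) uR
          sep : ∀ {a b} → a ∈ [ y ]₁ → (b ≡ v) ⊎ (b ∈ as ++ bs) → col′ a b ≢ col′ v x
          sep {a} {b} ma mb e with ∈-single ma
          sep {a} {b} ma (inj₁ refl) e | refl = flip-col ne e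
          sep {a} {b} ma (inj₂ m) e | refl = [ (λ q → xr (trans (sym e) q)) , (λ q → xb (trans (sym e) q)) ]′
            (h (subst (y ∈_) (sym eR) (∈-mid as y bs)) (subst (b ∈_) (sym eR) (∈-⊑ (sub (as ▸ [ y ]₁ ▸ bs ▸ ε) (v0 ∪ v2) (v0 ∪ v1 ∪ v2) v1 refl) m))
              λ { refl → ∉-both [ y ]₁ (as ++ bs) uy (∈-here y []) m })
        further (inj₂ none) = two⊥ (col′ v x) b (extend (col′ v x) b sides (λ m → inj₁ (decidable-stable (_ Fin.≟ _) (none m))))
          where
          sides : Within (col′ v x) b R
          sides {y} {z} my mz n with h my mz n
          ... | inj₂ e = inj₂ e
          ... | inj₁ e = ⊥-elim (cut⊥ (record { i = r ; S = [ v ]₁ ; T = R ; parts = ≋-refl ; s = v ; t = y ; u = y ; w = z ; s∈ = ∈-here v [] ; t∈ = my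
                ; u∈ = ∈-there v my ; w∈ = ∈-there v mz ; u≢w = n ; edge = e
                ; apart = λ ms mt e → case ∈-single ms of λ { refl → xr (trans (sym (decidable-stable (_ Fin.≟ _) (none mt))) e) } }))

    -- If `v` sends only `i` to `R`, it is isolated in the colour of the edge from `s` to `t`.
    -- Otherwise let `K` be the component of some `y` seen from `v` in another colour `g`: all edges
    -- between `K` and the remaining vertices have colour `i` or `g`, so every third colour is cut.
    old-cut : Cut R → ⊥
    old-cut C = go (search (λ y → ¬? (col′ v y Fin.≟ i)) R)
      where
      open Cut C
      -- A part of `R` closed under colour `i` and without an edge of that colour to `v` would
      -- remain separated after `v` has joined.
      attached : ∀ {K Z y} → K ++ Z ≋ R → y ∈ K → (∀ {a b} → a ∈ K → b ∈ Z → col′ a b ≢ i) → Σ[ t ∈ V ] (t ∈ K × col′ v t ≡ i)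
      attached {K} {Z} {y} e ky ap with nbr? i v K
      ... | inj₁ r = r
      ... | inj₂ none = ⊥-elim (cut⊥ (record { i = i ; S = K ; T = v ∷ Z
              ; parts = ≋-trans (perm (K ▸ [ v ]₁ ▸ Z ▸ ε) (v0 ∪ v1 ∪ v2) (v1 ∪ v0 ∪ v2) refl) (≋-++ {xs = [ v ]₁} ≋-refl e)
              ; s = y ; t = v ; u = u ; w = w ; s∈ = ky ; t∈ = ∈-here v Z ; u∈ = ∈-there v u∈ ; w∈ = ∈-there v w∈ ; u≢w = u≢w ; edge = edge
              ; apart = λ ma mb → [ (λ { refl → flip-col (none ma) }) , ap ma ]′ (∈-∷⁻ mb) }))
      go : Searched (λ y → col′ v y ≢ i) R → ⊥
      go (inj₂ none) = cut⊥ (record { i = col′ s t ; S = [ v ]₁ ; T = R ; parts = ≋-refl ; s = v ; t = s ; u = s ; w = t ; s∈ = ∈-here v [] ; t∈ = s-R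
        ; u∈ = ∈-there v s-R ; w∈ = ∈-there v t-R ; u≢w = λ { refl → ∉-both S T (U-⊑ (≋⇒⊑ parts) uR) s∈ t∈ } ; edge = refl
        ; apart = λ ms mt e → case ∈-single ms of λ { refl → apart s∈ t∈ (trans (sym e) (decidable-stable (_ Fin.≟ _) (none mt))) } })
        where
        s-R : s ∈ R
        s-R = ≋-∈ parts (∈-++ˡ T s∈)
        t-R : t ∈ R
        t-R = ≋-∈ parts (∈-++ʳ S t∈)
      go (inj₁ (as , y , bs , eR , ne)) = two⊥ i g all-two
        where
        g = col′ v y
        D : Comp i y R
        D = component i R (subst (y ∈_) (sym eR) (∈-mid as y bs))
        K Z : List V
        K = Comp.K D
        Z = Comp.Z D
        uKZ : U (K ++ Z)
        uKZ = U-⊑ (≋⇒⊑ (Comp.parts D)) uR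
        KR : ∀ {x} → x ∈ K → x ∈ R
        KR m = ≋-∈ (Comp.parts D) (∈-++ˡ Z m)
        ZR : ∀ {x} → x ∈ Z → x ∈ R
        ZR m = ≋-∈ (Comp.parts D) (∈-++ʳ K m)
        apt : ∀ {x z} → x ∈ K → z ∈ Z → x ≢ z
        apt x z refl = ∉-both K Z uKZ x z
        -- Each component Z meets has a vertex t that v sees in colour i, and K sees it in colour g.
        Probe : V → Set
        Probe z = Σ[ t ∈ V ] (t ∈ Z × col′ v t ≡ i × (∀ {x} → x ∈ K → col′ x t ≡ g × col′ x z ≡ g))
        probe : ∀ {z} → z ∈ Z → Probe z
        probe {z} mz = visit (component i Z mz)
          where
          visit : Comp i z Z → Probe z
          visit F = meet (attached {Comp.K F} {K ++ Comp.Z F}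
                 (≋-trans (perm (Comp.K F ▸ K ▸ Comp.Z F ▸ ε) (v0 ∪ v1 ∪ v2) (v1 ∪ v0 ∪ v2) refl) (≋-trans (≋-++ {xs = K} ≋-refl (Comp.parts F)) (Comp.parts D)))
                 (Comp.v∈ F) (λ ma mb → [ (λ k → flip-col (Comp.apart D k (inZ ma))) , Comp.apart F ma ]′ (∈-++⁻ K mb)))
            where
            inZ : ∀ {x} → x ∈ Comp.K F → x ∈ Z
            inZ m = ≋-∈ (Comp.parts F) (∈-++ˡ (Comp.Z F) m)
            meet : (Σ[ t ∈ V ] (t ∈ Comp.K F × col′ v t ≡ i)) → Probe z
            meet (t , tF , vt) = t , inZ tF , vt , λ {x} m → xt m ,
                trans (trans (col-sym c x z) (trans (uniform (Comp.conn F) (λ p → flip-col (Comp.apart D m (inZ p))) (λ xk → apt m (inZ xk) refl) (Comp.v∈ F) tF) (col-sym c t x))) (xt m)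
              where
              -- In the triangle v, y, t only the edge from `v` to `t` has colour `i`, so the other
              -- two agree.
              yt : col′ y t ≡ g
              yt = decidable-stable (col′ y t Fin.≟ g) λ d → ne (trans (tri (v∉ (KR (Comp.v∈ D))) (apt (Comp.v∈ D) (inZ tF)) (v∉ (ZR (inZ tF))) (d ∘ sym) (λ e → Comp.apart D (Comp.v∈ D) (inZ tF) (trans e vt))) vt)
              xt : ∀ {x} → x ∈ K → col′ x t ≡ g
              xt m = trans (uniform (Comp.conn D) (λ p → Comp.apart D p (inZ tF)) (λ tk → apt tk (inZ tF) refl) m (Comp.v∈ D)) yt
        toK : ∀ {x} → x ∈ K → ∀ z → z ∈ Z → Probe z → col′ v x ≡ i ⊎ col′ v x ≡ g
        toK {x} m z mz (t , tZ , vt , h) = either λ { (n₁ , n₂) →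
          n₁ (trans (tri (v∉ (KR m)) (apt m tZ) (v∉ (ZR tZ)) (λ e → n₂ (trans e (proj₁ (h m)))) (λ e → ne (trans (sym (proj₁ (h m))) (trans e vt)))) vt) }
        vK : ∀ {x} → x ∈ K → col′ v x ≡ i ⊎ col′ v x ≡ g
        vK m = via (cut-comp C uR D)
          where
          via : (Σ[ z ∈ V ] z ∈ Z) → _
          via (z , mz) = toK m z mz (probe mz)
        KZ : ∀ {x z} → x ∈ K → z ∈ Z → Probe z → col′ x z ≡ g
        KZ m mz (t , tZ , vt , h) = proj₂ (h m)
        sides : ∀ {x z j} → j ≢ i → j ≢ g → x ∈ K → (z ≡ v) ⊎ (z ∈ Z) → col′ x z ≢ j
        sides {x} n₁ n₂ mx (inj₁ refl) e = [ (λ q → n₁ (trans (sym e) (trans (col-sym c x v) q))) , (λ q → n₂ (trans (sym e) (trans (col-sym c x v) q))) ]′ (vK mx)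
        sides n₁ n₂ mx (inj₂ mz) e = n₂ (trans (sym e) (KZ mx mz (probe mz)))
        all-two : Within i g (v ∷ R)
        all-two {a} {b} ma mb n = either λ { (n₁ , n₂) → cut⊥ (record { i = col′ a b ; S = K ; T = v ∷ Z
          ; parts = ≋-trans (perm (K ▸ [ v ]₁ ▸ Z ▸ ε) (v0 ∪ v1 ∪ v2) (v1 ∪ v0 ∪ v2) refl) (≋-++ {xs = [ v ]₁} ≋-refl (Comp.parts D))
          ; s = y ; t = v ; u = a ; w = b ; s∈ = Comp.v∈ D ; t∈ = ∈-here v Z ; u∈ = ma ; w∈ = mb ; u≢w = n ; edge = refl
          ; apart = λ mx mz → sides n₁ n₂ mx (∈-∷⁻ mz) }) }

  record Split (W : List V) : Set where
    field
      π        : V → V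
      r b      : Fin q
      x₁ x₂    : V
      x₁∈      : x₁ ∈ W
      x₂∈      : x₂ ∈ W
      distinct : π x₁ ≢ π x₂
      two      : ∀ {x y} → x ∈ W → y ∈ W → π x ≢ π y → col′ x y ≡ r ⊎ col′ x y ≡ b
      modular  : ∀ {x x′ y} → x ∈ W → x′ ∈ W → y ∈ W → π x ≡ π x′ → π x ≢ π y → col′ x y ≡ col′ x′ y

  private
    -- `R` holds one representative of each class, fixed by `π`, and determines all colours between
    -- classes; the dichotomy `cut-or-two` is applied to `R`.
    record Labels (W R : List V) (π : V → V) : Set where
      field
        len    : 2 ≤ length R
        uR     : U R
        inR    : ∀ {x} → x ∈ W → π x ∈ R
        onto   : ∀ {x} → x ∈ R → x ∈ W × π x ≡ x
        mod    : ∀ {x y} → x ∈ W → y ∈ W → π x ≢ π y → col′ x y ≡ col′ (π x) (π y)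

    -- A component of a disconnected colour is a module, so its classes can be merged.
    module Merge {W R π} (L : Labels W R π) (C : Cut R) where

      open Labels L
      open Cut C using (i; u; w; u∈; w∈; u≢w; edge)

      D : Comp i u R
      D = component i R u∈

      open Comp D using (K; Z; parts; v∈; conn; apart)

      uKZ : U (K ++ Z)
      uKZ = U-⊑ (≋⇒⊑ parts) uR

      K? : ∀ x → Dec (1 ≤ count (x ==_) K)
      K? x = 1 ≤? count (x ==_) K

      w-K : w ∈ K
      w-K = [ id , (λ m → ⊥-elim (apart v∈ m edge)) ]′ (∈-++⁻ K (≋-∈ (≋-sym parts) w∈))

      big : 2 ≤ length K
      big = ≤-trans (m≤m+n 2 _) (≤-reflexive (≋-length (proj₂ (U-⇒⊑ (u ∷ w ∷ []) K
        (U-pair u≢w) (pair-⊆ v∈ w-K)))))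

      π₁ : V → V
      π₁ x = if does (K? (π x)) then u else π x

      π-in : ∀ {x} → π x ∈ K → π₁ x ≡ u
      π-in {x} (mem m) = cong (if_then u else π x) (dec-true (K? (π x)) m)

      π-out : ∀ {x} → ¬ (π x ∈ K) → π₁ x ≡ π x
      π-out {x} n = cong (if_then u else π x) (dec-false (K? (π x)) (n ∘ mem))

      in-Z : ∀ {x} → x ∈ W → ¬ (π x ∈ K) → π x ∈ Z
      in-Z m n = [ (λ k → ⊥-elim (n k)) , id ]′ (∈-++⁻ K (≋-∈ (≋-sym parts) (inR m)))

      out-K : ∀ {x} → x ∈ Z → ¬ (x ∈ K)
      out-K z k = ∉-both K Z uKZ k z

      look : ∀ {x z} → x ∈ K → z ∈ Z → col′ x z ≡ col′ u z
      look m z = uniform conn (λ p → apart p z) (out-K z) m v∈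

      merged : Labels W (u ∷ Z) π₁
      merged = record
        { len = s≤s (nonempty (cut-comp C uR D))
        ; uR = U-∷ (λ z → out-K z v∈) (U-++ʳ K Z uKZ)
        ; inR = λ {x} m → inR′ m (K? (π x))
        ; onto = λ m → onto′ (∈-∷⁻ m)
        ; mod = λ {x} {y} mx my n → mod′ mx my n (K? (π x)) (K? (π y)) }
        where
        nonempty : (Σ[ z ∈ V ] z ∈ Z) → 1 ≤ length Z
        nonempty (z , mem m) = ≤-trans m (count-≤-length _ Z)
        inR′ : ∀ {x} → x ∈ W → Dec (1 ≤ count (π x ==_) K) → π₁ x ∈ u ∷ Z
        inR′ m (yes k) = subst (_∈ u ∷ Z) (sym (π-in (mem k))) (∈-here u Z)
        inR′ m (no n)  = subst (_∈ u ∷ Z) (sym (π-out (n ∘ once))) (∈-there u (in-Z m (n ∘ once)))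
        onto′ : ∀ {x} → (x ≡ u) ⊎ (x ∈ Z) → x ∈ W × π₁ x ≡ x
        onto′ (inj₁ refl) = let (m , e) = onto u∈ in m , π-in (subst (_∈ K) (sym e) v∈)
        onto′ (inj₂ z)    = let (m , e) = onto (≋-∈ parts (∈-++ʳ K z)) in m , trans (π-out (λ k → out-K z (subst (_∈ K) e k))) e
        mod′ : ∀ {x y} → x ∈ W → y ∈ W → π₁ x ≢ π₁ y → Dec (1 ≤ count (π x ==_) K) → Dec (1 ≤ count (π y ==_) K) →
          col′ x y ≡ col′ (π₁ x) (π₁ y)
        mod′ mx my n (yes a) (yes b) = ⊥-elim (n (trans (π-in (mem a)) (sym (π-in (mem b)))))
        mod′ {x} {y} mx my n (yes a) (no b) = trans (mod mx my (λ e → b (subst (λ z → 1 ≤ count (z ==_) K) e a)))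
          (trans (look (mem a) (in-Z my (b ∘ once))) (sym (cong₂ col′ (π-in (mem a)) (π-out (b ∘ once)))))
        mod′ {x} {y} mx my n (no a) (yes b) = trans (mod mx my (λ e → a (subst (λ z → 1 ≤ count (z ==_) K) (sym e) b)))
          (trans (trans (col-sym c (π x) (π y)) (trans (look (mem b) (in-Z mx (a ∘ once))) (col-sym c u (π x))))
            (sym (cong₂ col′ (π-out (a ∘ once)) (π-in (mem b)))))
        mod′ mx my n (no a) (no b) = trans (mod mx my (λ e → n (trans (π-out (a ∘ once)) (trans e (sym (π-out (b ∘ once)))))))
          (sym (cong₂ col′ (π-out (a ∘ once)) (π-out (b ∘ once))))

      smaller : suc (length (u ∷ Z)) ≤ length R
      smaller = ≤-trans (+-monoˡ-≤ (length Z) big) (≤-reflexive (trans (sym (length-++ K)) (≋-length parts)))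

    -- Each merge lowers the number of representatives but leaves at least two, because the
    -- component is not all of `R`. So a quotient with only two colours is reached.
    refine : ∀ f {W} R {π} → length R ≤ f → Labels W R π → (Split W → ⊥) → ⊥
    refine f [] lf L k = case Labels.len L of λ ()
    refine (suc f) {W} (v ∷ R) {π} lf L k = cut-or-two v R (Labels.uR L)
      (λ C → refine f (Cut.u C ∷ Comp.Z (Merge.D L C)) (s≤s⁻¹ (≤-trans (Merge.smaller L C) lf)) (Merge.merged L C) k)
      (λ r b h → finish R L r b h)
      where
      finish : ∀ R → Labels W (v ∷ R) π → ∀ r b → Within r b (v ∷ R) → ⊥
      finish []       L r b h = case Labels.len L of λ { (s≤s ()) }
      finish (x ∷ R) L r b h = k (record
        { π = π ; r = r ; b = b ; x₁ = v ; x₂ = x ; x₁∈ = proj₁ (onto v∈) ; x₂∈ = proj₁ (onto x∈)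
        ; distinct = λ e → ∉-both [ v ]₁ (x ∷ R) uR (∈-here v []) (subst (_∈ x ∷ R) (trans (sym (proj₂ (onto x∈))) (trans (sym e) (proj₂ (onto v∈)))) (∈-here x R))
        ; two = λ mx my n → [ (λ e → inj₁ (trans (mod mx my n) e)) , (λ e → inj₂ (trans (mod mx my n) e)) ]′ (h (inR mx) (inR my) n)
        ; modular = λ {x} {x′} {y} mx mx′ my e n → trans (mod mx my n) (trans (cong (λ z → col′ z (π y)) e) (sym (mod mx′ my (λ q → n (trans e q))))) })
        where
        open Labels L
        v∈ : v ∈ v ∷ x ∷ R
        v∈ = ∈-here v _
        x∈ : x ∈ v ∷ x ∷ R
        x∈ = ∈-there v (∈-here x R)

  gallai-partition : ∀ W → U W → 2 ≤ length W → (Split W → ⊥) → ⊥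
  gallai-partition W u l = refine (length W) W {id} ≤-refl (record { len = l ; uR = u ; inR = id ; onto = λ m → m , refl ; mod = λ _ _ _ → refl })

-- The upper bound

lookup-map : {A B : Set} (f : A → B) (xs : List A) → tabulate (f ∘ lookup xs) ≡ map f xs
lookup-map f []       = refl
lookup-map f (x ∷ xs) = cong (f x ∷_) (lookup-map f xs)

map-lookup : {A : Set} (xs : List A) → map (lookup xs) (allFin (length xs)) ≡ xs
map-lookup xs = trans (map-tabulate id (lookup xs)) (trans (lookup-map id xs) (map-id xs))

count-map : {A B : Set} (p : B → Bool) (f : A → B) (xs : List A) → count p (map f xs) ≡ count (p ∘ f) xs
count-map p f []       = refl
count-map p f (x ∷ xs) = cong (b2n (p (f x)) +_) (count-map p f xs)

Cyc-image : {A B : Set} {E : B → B → Set} (f : A → B) (xs : List A) → Cyc (λ x y → E (f x) (f y)) xs → Cyc E (map f xs)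
Cyc-image {E = E} f (x ∷ xs) = go xs
  where
  go : ∀ {a b} ys → Ch (λ x y → E (f x) (f y)) a ys b → Ch E (f a) (map f ys) (f b)
  go []       e       = e
  go (y ∷ ys) (e , c) = e , go ys c

U-map : ∀ {M N} (f : Fin M → Fin N) → (∀ {i j} → f i ≡ f j → i ≡ j) → ∀ xs → U xs → U (map f xs)
U-map f inj []       u = uniq λ _ → z≤n
U-map f inj (x ∷ xs) u = U-∷ notin (U-map f inj xs (U-++ʳ [ x ]₁ xs u))
  where
  back : ∀ ys → f x ∈ map f ys → x ∈ ys
  back (y ∷ ys) m with ∈-∷⁻ m
  ... | inj₁ e  = subst (_∈ y ∷ ys) (sym (inj e)) (∈-here y ys)
  ... | inj₂ m′ = ∈-there y (back ys m′)
  notin : ¬ (f x ∈ map f xs)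
  notin m = ∉-both [ x ]₁ xs u (∈-here x []) (back xs m)

module Tags {A : Set} {q : ℕ} (tag : A → Fin q) where

  has : Fin q → A → Bool
  has i x = tag x == i

  tally : List (Fin q) → List A → ℕ
  tally []       xs = 0
  tally (i ∷ is) xs = count (has i) xs + tally is xs

  tally-[] : ∀ is → tally is [] ≡ 0
  tally-[] []       = refl
  tally-[] (i ∷ is) = tally-[] is

  tally-∷ : ∀ is x xs → tally is (x ∷ xs) ≡ count (tag x ==_) is + tally is xs
  tally-∷ []       x xs = refl
  tally-∷ (i ∷ is) x xs rewrite tally-∷ is x xs = lem (b2n (tag x == i)) (count (has i) xs) (count (tag x ==_) is) (tally is xs)
    where
    lem : ∀ a b c d → a + b + (c + d) ≡ a + c + (b + d)
    lem = solve-∀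

  tally-all : ∀ is → is ≋ allFin q → ∀ xs → tally is xs ≡ length xs
  tally-all is e []       = tally-[] is
  tally-all is e (x ∷ xs) = trans (tally-∷ is x xs) (cong₂ _+_ (trans (≋at e (tag x ==_)) (count-all (tag x))) (tally-all is e xs))

  tally-≤ : ∀ {k} xs → (∀ i → count (has i) xs ≤ k) → ∀ is → tally is xs ≤ k * length is
  tally-≤ {k} xs h []       = z≤n
  tally-≤ {k} xs h (i ∷ is) = ≤-trans (+-mono-≤ (h i) (tally-≤ xs h is)) (≤-reflexive (sym (*-suc k (length is))))

size₁ : ∀ k kq w o → w + o ≡ kq + (suc k + suc k + 2) → o ≤ kq → suc k + suc k + 2 ≤ w
size₁ k kq w o e h = linear 0 (≤-reflexive (sym e) ⊕ h) (solve (k ∷ kq ∷ w ∷ o ∷ []))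

size₂ : ∀ k l w o r b → w + o ≡ k * suc (suc l) + (suc k + suc k + 2) → o ≤ r + (b + k * l) → (suc k + suc k) + (suc k + suc k) ≤ w + (r + b)
size₂ k l w o r b e h = linear 0 (≤-reflexive (sym e) ⊕ h) (solve (k ∷ l ∷ w ∷ o ∷ r ∷ b ∷ []))

path-room : ∀ k a t b w p s → a + suc t ≡ k → (suc k + suc k) + (suc k + suc k) ≤ w + (suc t + b) → b ≤ suc t → w ≡ suc k + (p + s) → s ≤ k → suc (suc (suc (a + a))) ≤ p
path-room k a t b w p s e h g refl f = linear 0 (≤-reflexive e ⊕ ≤-reflexive e ⊕ h ⊕ g ⊕ f) (solve (k ∷ a ∷ t ∷ b ∷ p ∷ s ∷ []))

spare-room : ∀ k a t w z → a + suc t ≡ k → suc k + suc k + 2 ≤ w → w ≡ suc (suc (suc (a + a))) + z → t ≤ z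
spare-room k a t w z e h refl = linear (t + 3) (≤-reflexive e ⊕ ≤-reflexive e ⊕ h) (solve (k ∷ a ∷ t ∷ z ∷ []))

-- Here `q` is the number of colours and `k` stands for n - 1, so `size` reads N = (n - 1)q + 2n +
-- 2.
module Upper {N q : ℕ} (c : Colouring N q) (gallai : Gallai c) (k : ℕ) (k≥1 : 1 ≤ k)
  (nc : ∀ i zs → length zs ≡ suc k + suc k → U zs → Cyc (λ x y → col c x y ≡ i) zs → ⊥)
  (size : N ≡ k * q + (suc k + suc k + 2)) where

  open Partition c gallai

  E : Fin q → V → V → Set
  E i x y = col′ x y ≡ i

  E-sym : ∀ {i x y} → E i x y → E i y x
  E-sym {i} {x} {y} e = trans (col-sym c y x) e

  record Peeled (W O : List V) (tag : V → Fin q) : Set where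
    field
      parts  : W ++ O ≋ allFin N
      tagged : ∀ {o w} → o ∈ O → w ∈ W → col′ o w ≡ tag o
      large  : suc k ≤ length W

  module Stage {W O tag} (st : Peeled W O tag) where

    open Peeled st
    open Tags tag

    uWO : U (W ++ O)
    uWO = U-⊑ (≋⇒⊑ parts) U-all

    total : length W + length O ≡ k * q + (suc k + suc k + 2)
    total = trans (sym (length-++ W)) (trans (≋-length parts) (trans length-all size))

    few : ∀ i → count (has i) O ≤ k
    few i with suc k ≤? count (has i) O
    ... | no  n = s≤s⁻¹ (≰⇒> n)
    ... | yes p = ⊥-elim (go (filter-len (has i) (suc k) O p) (splitAt-length (suc k) W large))
      where
      go : Prefix (suc k) (filterᵇ (has i) O) → Prefix (suc k) W → ⊥
      go (ts , zs , eT , lt) (ws , ys , eW , lw) = nc i (interleave ws ts)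
        (trans (≋-length (interleave-≋ ws ts)) (trans (length-++ ws) (cong₂ _+_ lw lt)))
        (U-⊑ (⊑-trans (≋⇒⊑ (interleave-≋ ws ts)) (⊑-++ (subst (ws ⊑_) (sym eW) (⊑-++ˡ ws ys))
          (⊑-trans (⊑-++ˡ ts zs) (subst (_⊑ O) eT (filter-⊑ (has i) O))))) uWO)
        (interleave-Cyc ws ts (subst (1 ≤_) (sym lw) (s≤s z≤n)) (trans lw (sym lt)) both)
        where
        both : ∀ {a b} → a ∈ ws → b ∈ ts → E i a b × E i b a
        both {a} {b} ma mb =
          let (m , h) = ∈-filter⁻ (has i) O (subst (b ∈_) (sym eT) (∈-++ˡ zs mb))
              e = trans (tagged m (subst (a ∈_) (sym eW) (∈-++ˡ ys ma))) (==⇒≡ h)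
          in E-sym e , e

    W-size : suc k + suc k + 2 ≤ length W
    W-size = size₁ k (k * q) (length W) (length O) total
      (≤-trans (≤-reflexive (sym (tally-all (allFin q) ≋-refl O))) (≤-trans (tally-≤ O few (allFin q)) (≤-reflexive (cong (k *_) length-all))))

    W-size₂ : ∀ {r b} → r ≢ b → (suc k + suc k) + (suc k + suc k) ≤ length W + (count (has r) O + count (has b) O)
    W-size₂ {r} {b} ne = go (outside (r ∷ b ∷ []) (U-pair ne))
      where
      go : (Σ[ is ∈ List (Fin q) ] (r ∷ b ∷ is ≋ allFin q)) → (suc k + suc k) + (suc k + suc k) ≤ length W + (count (has r) O + count (has b) O)
      go (is , e) = size₂ k (length is) (length W) (length O) (count (has r) O) (count (has b) O)
        (trans total (cong (λ z → k * z + (suc k + suc k + 2)) (sym (trans (≋-length e) length-all))))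
        (≤-trans (≤-reflexive (sym (tally-all (r ∷ b ∷ is) e O))) (+-monoʳ-≤ (count (has r) O) (+-monoʳ-≤ (count (has b) O) (tally-≤ O few is))))

    module Split-stage (S : Split W) (small : ∀ {v} → v ∈ W → count (λ x → Split.π S v == Split.π S x) W ≤ k) where

      open Split S using (π; modular; two)

      cls : V → ℕ
      cls x = toℕ (π x)

      W⊑ : ∀ {zs} → zs ⊑ W → U zs
      W⊑ h = U-⊑ (⊑-trans h (⊑-++ˡ W O)) uWO

      small′ : ∀ d → count (λ x → does (cls x ℕₚ.≟ d)) W ≤ k
      small′ d with 1 ≤? count (λ x → does (cls x ℕₚ.≟ d)) W
      ... | no  n = ≤-trans (s≤s⁻¹ (≰⇒> n)) z≤n
      ... | yes p = let (v , m , e) = count-∈ _ W p in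
        ≤-trans (count-mono _ _ W λ x h → dec-true (π v Fin.≟ π x) (Finₚ.toℕ-injective (trans (does⇒ (cls v ℕₚ.≟ d) e) (sym (does⇒ (cls x ℕₚ.≟ d) h))))) (small m)

      two-sets : ∀ b as bs → as ++ bs ⊑ W → length as ≡ suc k → length bs ≡ suc k → (∀ {x y} → x ∈ as → y ∈ bs → cls x ≢ cls y → E b x y) → ⊥
      two-sets b as bs inc la lb h = go (bipartite cls as bs (s≤s z≤n) la lb (W⊑ inc) (λ d → s≤s (≤-trans (⊑at inc _) (small′ d))) {E b} E-sym h)
        where
        go : (Σ[ zs ∈ List V ] (Cyc (E b) zs × zs ≋ as ++ bs)) → ⊥
        go (zs , cy , pm) = nc b zs (trans (≋-length pm) (trans (length-++ as) (cong₂ _+_ la lb))) (W⊑ (⊑-trans (≋⇒⊑ pm) inc)) cy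

      one-colour : ∀ r → (∀ {x y} → x ∈ W → y ∈ W → π x ≢ π y → col′ x y ≡ r) → ⊥
      one-colour r h = go (splitAt-length (suc k) W large)
        where
        go : Prefix (suc k) W → ⊥
        go (as , zs , eW , la) = go₂ (splitAt-length (suc k) zs (+-cancelˡ-≤ (suc k) _ _ (≤-trans (m≤m+n _ 2) (≤-trans W-size (≤-reflexive (trans (cong length eW) (trans (length-++ as) (cong (_+ length zs) la))))))))
          where
          go₂ : Prefix (suc k) zs → ⊥
          go₂ (bs , ys , eZ , lb) = two-sets r as bs inc la lb λ mx my n → h (∈-⊑ inc (∈-++ˡ bs mx)) (∈-⊑ inc (∈-++ʳ as my)) (n ∘ cong toℕ)
            where
            inc : as ++ bs ⊑ W
            inc = subst (as ++ bs ⊑_) (sym (trans eW (cong (as ++_) eZ))) (⊑-++ {xs = as} {as} ⊑-refl (⊑-++ˡ bs ys))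

      -- A vertex tagged r lets a long path of colour r be closed up.
      tagged-colour : ∀ r b → (∀ {x y} → x ∈ W → y ∈ W → π x ≢ π y → col′ x y ≡ r ⊎ col′ x y ≡ b) → r ≢ b →
        count (has b) O ≤ count (has r) O → ∀ t₁ Ts → filterᵇ (has r) O ≡ t₁ ∷ Ts → ⊥
      tagged-colour r b tw r≢b le t₁ Ts eT = go (suc k ≤? length rest)
        where
        open DFS {E = E r} (λ x y → col′ x y Fin.≟ r) E-sym
        open State (dfs W (suc k) large) renaming (parts to dfs-parts)
        T≡ : suc (length Ts) ≡ count (has r) O
        T≡ = trans (cong length (sym eT)) (length-filter (has r) O)
        a : ℕ
        a = k ∸ suc (length Ts)
        a≡ : a + suc (length Ts) ≡ k
        a≡ = m∸n+n≡m (subst (_≤ k) (sym T≡) (few r))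
        T-in : ∀ {v} → v ∈ t₁ ∷ Ts → v ∈ O × tag v ≡ r
        T-in {v} m = let (p , h) = ∈-filter⁻ (has r) O (subst (v ∈_) (sym eT) m) in p , ==⇒≡ h
        both : ∀ {u v} → u ∈ W → v ∈ t₁ ∷ Ts → E r u v × E r v u
        both mu mv = let (p , h) = T-in mv ; e = trans (tagged p mu) h in E-sym e , e
        go : Dec (suc k ≤ length rest) → ⊥
        go (yes p) = hole (splitAt-length (suc k) rest p)
          where
          hole : Prefix (suc k) rest → ⊥
          hole (bs , ys , eR , lb) = two-sets b done bs inc finished lb λ {x} {y} mx my n →
              [ (λ e → ⊥-elim (apart mx (inR my) e)) , id ]′ (tw (∈-⊑ inc (∈-++ˡ bs mx)) (∈-⊑ inc (∈-++ʳ done my)) (n ∘ cong toℕ))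
            where
            bs⊑ : bs ⊑ rest
            bs⊑ = subst (bs ⊑_) (sym eR) (⊑-++ˡ bs ys)
            inR : ∀ {v} → v ∈ bs → v ∈ rest
            inR = ∈-⊑ bs⊑
            inc : done ++ bs ⊑ W
            inc = ⊑-trans (⊑-++ {xs = done} {done} ⊑-refl (⊑-trans bs⊑ (⊑-++ʳ stack rest))) (≋⇒⊑ dfs-parts)
        -- At most 2n - 1 vertices of `W` are off the stack. With t tagged vertices of colour `r`
        -- and at most as many of colour `b`, at least 2n + 1 - 2t = 2a + 3 vertices are on it,
        -- where a = n - 1 - t.
        go (no n) = close stack path (⊑-trans (sub (done ▸ stack ▸ rest ▸ ε) v1 (v0 ∪ v1 ∪ v2) (v0 ∪ v2) refl) (≋⇒⊑ dfs-parts))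
          (path-room k a (length Ts) (count (has b) O) (length W) (length stack) (length rest) a≡
            (subst (λ z → (suc k + suc k) + (suc k + suc k) ≤ length W + (z + count (has b) O)) (sym T≡) (W-size₂ r≢b))
            (subst (count (has b) O ≤_) (sym T≡) le)
            (trans (sym (≋-length dfs-parts)) (trans (length-++ done) (cong₂ _+_ finished (length-++ stack)))) (s≤s⁻¹ (≰⇒> n)))
          where
          close : ∀ P → Path (E r) P → P ⊑ W → suc (suc (suc (a + a))) ≤ length P → ⊥
          close (y ∷ P) p inc l = cut (splitAt-length (suc (suc (a + a))) P (s≤s⁻¹ l))
            where
            cut : (Σ[ us ∈ List V ] Σ[ zs ∈ List V ] (P ≡ us ++ zs × length us ≡ suc (suc (a + a)))) → ⊥
            cut (us , zs , refl , lu) = cut₂ (complement (y ∷ us) W (λ v → ⊑at inc₁ (v ==_)))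
              where
              inc₁ : y ∷ us ⊑ W
              inc₁ = ⊑-trans (⊑-++ˡ (y ∷ us) zs) inc
              cut₂ : (Σ[ ws ∈ List V ] (y ∷ us) ++ ws ≋ W) → ⊥
              cut₂ (ws , eW) = cut₃ (splitAt-length (length Ts) ws (spare-room k a (length Ts) (length W) (length ws) a≡ W-size
                  (trans (sym (≋-length eW)) (trans (length-++ (y ∷ us)) (cong (λ z → suc z + length ws) lu)))))
                where
                cut₃ : Prefix (length Ts) ws → ⊥
                -- The t vertices tagged `r` alternate with t - 1 vertices of `W` off the path, and
                -- (2a + 3) + t + (t - 1) = 2n.
                cut₃ (rs , xs , eS , lr) = nc r new len (U-⊑ (⊑-trans (≋⇒⊑ pm) (⊑-++ inc₂ (subst (_⊑ O) eT (filter-⊑ (has r) O)))) uWO)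
                    (Ch-++ us (Path-Ch us (Path-++ˡ (y ∷ us) p) (proj₁ turn)) (proj₂ turn))
                  where
                  new = y ∷ us ++ t₁ ∷ interleave rs Ts
                  pm : new ≋ ((y ∷ us) ++ rs) ++ t₁ ∷ Ts
                  pm = ≋-trans (≋-++ {xs = y ∷ us} ≋-refl (≋-++ {xs = [ t₁ ]₁} ≋-refl (interleave-≋ rs Ts)))
                         (perm ((y ∷ us) ▸ [ t₁ ]₁ ▸ rs ▸ Ts ▸ ε) (v0 ∪ v1 ∪ v2 ∪ v3) ((v0 ∪ v2) ∪ v1 ∪ v3) refl)
                  inc₂ : (y ∷ us) ++ rs ⊑ W
                  inc₂ = ⊑-trans (⊑-++ {xs = y ∷ us} {y ∷ us} ⊑-refl (subst (rs ⊑_) (sym eS) (⊑-++ˡ rs xs))) (≋⇒⊑ eW)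
                  len : length new ≡ suc k + suc k
                  len = trans (≋-length pm) (trans (length-++ ((y ∷ us) ++ rs)) (trans (cong (_+ suc (length Ts)) (trans (length-++ (y ∷ us)) (cong₂ (λ i j → suc i + j) lu lr)))
                          (trans (lem a (length Ts)) (cong₂ (λ i j → suc i + suc j) a≡ a≡))))
                    where
                    lem : ∀ a t → suc (suc (suc (a + a))) + t + suc t ≡ suc (a + suc t) + suc (a + suc t)
                    lem = solve-∀
                  turn : Ch (E r) (final y us) (t₁ ∷ interleave rs Ts) y
                  turn = interleave-Ch {E = E r} (_∈ W) (_∈ t₁ ∷ Ts) both rs Ts lr (∈-⊑ inc₁ (final-∈ y us)) (∈-here t₁ Ts) (∈-⊑ inc₁ (∈-here y us))
                    (λ m → ∈-⊑ inc₂ (∈-++ʳ (y ∷ us) m)) (∈-there t₁)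

      -- `Modules` requires exactly 4n vertices, so `W` is replaced by a prefix `W′`, numbered by
      -- position, in which classes can only be smaller. Colour `r` becomes `true` and `b` becomes
      -- `false`.
      untagged : ∀ r b → (∀ {x y} → x ∈ W → y ∈ W → π x ≢ π y → col′ x y ≡ r ⊎ col′ x y ≡ b) → r ≢ b →
        (suc k + suc k) + (suc k + suc k) ≤ length W → ⊥
      untagged r b tw r≢b l = go (splitAt-length ((suc k + suc k) + (suc k + suc k)) W l)
        where
        on : ∀ W′ → W′ ⊑ W → length W′ ≡ (suc k + suc k) + (suc k + suc k) → ∀ {i j : Fin (length W′)} → i ≢ j → ⊥
        on W′ inc l = Modules.modules⊥ (λ i → cls (vtx i)) g
            (λ i j → cong (λ z → does (z Fin.≟ r)) (col-sym c (vtx i) (vtx j)))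
            (λ {i} {i′} {j} e n → cong (λ z → does (z Fin.≟ r)) (modular (in-W i) (in-W i′) (in-W j) (Finₚ.toℕ-injective e) (n ∘ cong toℕ)))
            k k≥1 cycles l
            (λ d → ≤-trans (≤-reflexive (trans (sym (count-map (λ x → does (cls x ℕₚ.≟ d)) vtx (allFin _))) (cong (count (λ x → does (cls x ℕₚ.≟ d))) (map-lookup W′))))
              (≤-trans (⊑at inc _) (small′ d)))
          where
          vtx : Fin (length W′) → V
          vtx = lookup W′
          in-W : ∀ i → vtx i ∈ W
          in-W i = ∈-⊑ inc (lookup-∈ W′ i)
          g : Fin (length W′) → Fin (length W′) → Bool
          g i j = does (col′ (vtx i) (vtx j) Fin.≟ r)
          colour : Bool → Fin q
          colour true  = r
          colour false = b
          right : ∀ {x i j} → g i j ≡ x × cls (vtx i) ≢ cls (vtx j) → E (colour x) (vtx i) (vtx j)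
          right {true}  {i} {j} (e , n) = does⇒ (col′ (vtx i) (vtx j) Fin.≟ r) e
          right {false} {i} {j} (e , n) = [ (λ h → ⊥-elim (¬does⇒ (col′ (vtx i) (vtx j) Fin.≟ r) e h)) , id ]′ (tw (in-W i) (in-W j) (n ∘ cong toℕ))
          cycles : ∀ x zs → length zs ≡ suc k + suc k → U zs → Cyc (λ i j → g i j ≡ x × cls (vtx i) ≢ cls (vtx j)) zs → ⊥
          cycles x zs lz uz cy = nc (colour x) (map vtx zs) (trans (length-map vtx zs) lz)
            (U-map vtx (lookup-injective W′ (W⊑ inc)) zs uz)
            (Cyc-image vtx zs (Cyc-map (λ {i} {j} → right {x} {i} {j}) zs cy))
        go : Prefix ((suc k + suc k) + (suc k + suc k)) W → ⊥
        go ([] , zs , eW , ())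
        go (x ∷ [] , zs , eW , l′) = case trans (suc-injective l′) (cong (_+ (suc k + suc k)) (+-suc k k)) of λ ()
        go (W′@(x ∷ y ∷ _) , zs , eW , l′) = on W′ (subst (W′ ⊑_) (sym eW) (⊑-++ˡ W′ zs)) l′ {Fin.zero} {Fin.suc Fin.zero} (λ ())

      stage⊥ : ⊥
      stage⊥ with Split.r S Fin.≟ Split.b S
      ... | yes e = one-colour (Split.r S) λ mx my n → [ id , (λ h → trans h (sym e)) ]′ (two mx my n)
      ... | no  n = go (filterᵇ (has r) O) (filterᵇ (has b) O) refl refl (≤-total (count (has b) O) (count (has r) O))
        where
        open Split S using (r; b)
        zeroed : ∀ i → filterᵇ (has i) O ≡ [] → count (has i) O ≡ 0
        zeroed i e = trans (sym (length-filter (has i) O)) (cong length e)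
        none : count (has r) O ≡ 0 → count (has b) O ≡ 0 → ⊥
        none e₁ e₂ = untagged r b two n (≤-trans (W-size₂ n) (≤-reflexive (trans (cong (length W +_) (cong₂ _+_ e₁ e₂)) (+-identityʳ _))))
        go : ∀ Tr Tb → filterᵇ (has r) O ≡ Tr → filterᵇ (has b) O ≡ Tb → count (has b) O ≤ count (has r) O ⊎ count (has r) O ≤ count (has b) O → ⊥
        go (t ∷ Tr) Tb e₁ e₂ (inj₁ le) = tagged-colour r b two n le t Tr e₁
        go Tr (t ∷ Tb) e₁ e₂ (inj₂ le) = tagged-colour b r (λ mx my d → [ inj₂ , inj₁ ]′ (two mx my d)) (n ∘ sym) le t Tb e₂
        go [] Tb e₁ e₂ (inj₁ le) = none (zeroed r e₁) (n≤0⇒n≡0 (subst (count (has b) O ≤_) (zeroed r e₁) le))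
        go Tr [] e₁ e₂ (inj₂ le) = none (n≤0⇒n≡0 (subst (count (has r) O ≤_) (zeroed b e₂) le)) (zeroed b e₂)

  -- A class with at least n vertices replaces W; the rest of W joins the tagged vertices.
  process : ∀ f {W O tag} → length W ≤ f → Peeled W O tag → ⊥
  process zero    lf st = case ≤-trans (Peeled.large st) lf of λ ()
  process (suc f) {W} {O} {tag} lf st = gallai-partition W (U-++ˡ W O (Stage.uWO st))
    (≤-trans (s≤s k≥1) large) λ S → go S (search (λ v → suc k ≤? count (λ x → Split.π S v == Split.π S x) W) W)
    where
    open Peeled st
    go : (S : Split W) → Searched (λ v → suc k ≤ count (λ x → Split.π S v == Split.π S x) W) W → ⊥
    go S (inj₂ none) = Stage.Split-stage.stage⊥ st S λ m → s≤s⁻¹ (≰⇒> (none m))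
    go S (inj₁ (as , v , bs , eW , big)) = process f (s≤s⁻¹ (≤-trans smaller lf)) (record
        { parts = ≋-trans (perm (X ▸ Xᶜ ▸ O ▸ ε) (v0 ∪ (v1 ∪ v2)) ((v0 ∪ v1) ∪ v2) refl) (≋-trans (≋-++ (filter-split cl W) ≋-refl) parts)
        ; tagged = tagged′ ; large = subst (suc k ≤_) (sym (length-filter cl W)) big })
      where
      open Split S
      cl : V → Bool
      cl x = π v == π x
      X Xᶜ : List V
      X = filterᵇ cl W
      Xᶜ = filterᵇ (not ∘ cl) W
      v-W : v ∈ W
      v-W = subst (v ∈_) (sym eW) (∈-mid as v bs)
      W? : ∀ x → Dec (1 ≤ count (x ==_) W)
      W? x = 1 ≤? count (x ==_) W
      -- A vertex leaving `W` sees the class of `v` in one colour, namely its colour towards `v`;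
      -- vertices left out earlier keep their tags.
      tag′ : V → Fin q
      tag′ x = if does (W? x) then col′ x v else tag x
      tagged′ : ∀ {o w} → o ∈ Xᶜ ++ O → w ∈ X → col′ o w ≡ tag′ o
      tagged′ {o} {w} mo mw with ∈-++⁻ Xᶜ mo | ∈-filter⁻ cl W mw
      ... | inj₁ m | (wW , we) = let (oW , oe) = ∈-filter⁻ (not ∘ cl) W m in
        trans (trans (col-sym c o w) (trans (modular wW v-W oW (sym (==⇒≡ we)) (λ e → case trans (sym oe) (cong not (dec-true (π v Fin.≟ π o) (trans (==⇒≡ we) e))) of λ ())) (col-sym c v o)))
          (sym (cong (if_then col′ o v else tag o) (dec-true (W? o) (once oW))))
      ... | inj₂ m | (wW , we) = trans (tagged m wW)
          (sym (cong (if_then col′ o v else tag o) (dec-false (W? o) (λ h → ∉-both W O (Stage.uWO st) (mem h) m))))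
      apart-one : ∀ {x} → x ∈ W → π v ≢ π x → 1 ≤ count (not ∘ cl) W
      apart-one {x} m n = ∈-count (not ∘ cl) W m (cong not (dec-false (π v Fin.≟ π x) n))
      other-class : Dec (π v ≡ π x₁) → 1 ≤ count (not ∘ cl) W
      other-class (no n)  = apart-one x₁∈ n
      other-class (yes e) = apart-one x₂∈ (λ e′ → distinct (trans (sym e) e′))
      smaller : suc (length X) ≤ length W
      smaller = subst₂ _≤_ (cong suc (sym (length-filter cl W))) (count-partition cl W)
        (≤-trans (≤-reflexive (+-comm 1 (count cl W))) (+-monoʳ-≤ (count cl W) (other-class (π v Fin.≟ π x₁))))

  upper⊥ : ⊥
  upper⊥ = process (length (allFin N)) {allFin N} {[]} {λ x → col′ x x} ≤-refl (record
    { parts = ≋! λ p → cong (count p) (++-identityʳ (allFin N)) ; tagged = λ m → ⊥-elim (∉[] m)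
    ; large = subst (suc k ≤_) (sym (trans length-all size)) (≤-trans (m≤m+n _ (suc k)) (≤-trans (m≤m+n _ 2) (m≤n+m _ (k * q)))) })

-- Decidability and the lower bound

-- The search below meets every function only up to pointwise equality, so the predicate has to be
-- invariant under it.
Respects : ∀ {m N} → ((Fin m → Fin N) → Set) → Set
Respects P = ∀ {f g} → (∀ i → f i ≡ g i) → P f → P g

search-functions : ∀ m {N} (P : (Fin m → Fin N) → Set) → Respects P → (∀ f → Dec (P f)) → Dec (∃ P)
search-functions zero P resp P? with P? (λ ())
... | yes p = yes (_ , p)
... | no  n = no λ (f , p) → n (resp (λ ()) p)
search-functions (suc m) P resp P? with Finₚ.any? (λ a → search-functions m (λ g → P (a ◂ g))
    (λ e → resp (λ { Fin.zero → refl ; (Fin.suc i) → e i })) (λ g → P? (a ◂ g)))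
... | yes (a , g , p) = yes (_ , p)
... | no  n = no λ (f , p) → n (f Fin.zero , f ∘ Fin.suc , resp (λ { Fin.zero → refl ; (Fin.suc i) → refl }) p)

module _ {N k : ℕ} (m : ℕ) (c : Colouring N k) where

  private
    Mono : (Fin m → Fin N) → Set
    Mono v = Injective _≡_ _≡_ v × Σ[ r ∈ Fin k ] (∀ i j → CycleAdj m i j → col c (v i) (v j) ≡ r)

    Mono-resp : Respects Mono
    Mono-resp e (inj , r , h) = (λ {i} {j} q → inj (trans (e i) (trans q (sym (e j))))) , r ,
      λ i j a → trans (sym (cong₂ (col c) (e i) (e j))) (h i j a)

    imp? : ∀ {P Q : Set} → Dec P → Dec Q → Dec (P → Q)
    imp? (no n)  _       = yes λ p → ⊥-elim (n p)
    imp? (yes p) (yes q) = yes λ _ → q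
    imp? (yes p) (no n)  = no λ f → n (f p)

    adj? : ∀ i j → Dec (CycleAdj m i j)
    adj? i j = (suc (toℕ i) ℕₚ.≟ toℕ j) ⊎-dec ((suc (toℕ i) ℕₚ.≟ m) ×-dec (toℕ j ℕₚ.≟ 0))

    injective? : ∀ (v : Fin m → Fin N) → Dec (Injective _≡_ _≡_ v)
    injective? v with Finₚ.all? (λ i → Finₚ.all? (λ j → imp? (v i Fin.≟ v j) (i Fin.≟ j)))
    ... | yes h = yes λ {i} {j} → h i j
    ... | no  n = no λ h → n λ i j → h

  hasMonoCycle? : Dec (HasMonoCycle m c)
  hasMonoCycle? = search-functions m Mono Mono-resp λ v →
    injective? v ×-dec Finₚ.any? (λ r → Finₚ.all? (λ i → Finₚ.all? (λ j → imp? (adj? i j) (col c (v i) (v j) Fin.≟ r))))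

gallai? : ∀ {N k} (c : Colouring N k) → Dec (Gallai c)
gallai? c = ¬? (Finₚ.any? λ x → Finₚ.any? λ y → Finₚ.any? λ z →
  ¬? (x Fin.≟ y) ×-dec ¬? (y Fin.≟ z) ×-dec ¬? (x Fin.≟ z) ×-dec
  ¬? (col c x y Fin.≟ col c y z) ×-dec ¬? (col c y z Fin.≟ col c x z) ×-dec ¬? (col c x y Fin.≟ col c x z))

module _ (N k m : ℕ) where

  private
    pair : Fin N → Fin N → Fin (N * N)
    pair = Fin.combine

    Symmetric : (Fin (N * N) → Fin k) → Set
    Symmetric f = ∀ i j → f (pair i j) ≡ f (pair j i)

    colouring : ∀ f → Symmetric f → Colouring N k
    colouring f s = record { col = λ i j → f (pair i j) ; sym = s }

    Avoids : (Fin (N * N) → Fin k) → Set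
    Avoids f = Σ[ s ∈ Symmetric f ] (Gallai (colouring f s) × ¬ HasMonoCycle m (colouring f s))

    transport : ∀ (c d : Colouring N k) → (∀ i j → col c i j ≡ col d i j) → Gallai c × ¬ HasMonoCycle m c → Gallai d × ¬ HasMonoCycle m d
    transport c d e (g , n) =
      (λ (x , y , z , a₁ , a₂ , a₃ , b₁ , b₂ , b₃) → g (x , y , z , a₁ , a₂ , a₃ ,
        (λ q → b₁ (trans (sym (e x y)) (trans q (e y z)))) , (λ q → b₂ (trans (sym (e y z)) (trans q (e x z)))) , (λ q → b₃ (trans (sym (e x y)) (trans q (e x z)))))) ,
      λ (v , inj , r , h) → n (v , inj , r , λ i j a → trans (e _ _) (h i j a))

    avoids? : ∀ f → Dec (Avoids f)
    avoids? f with Finₚ.all? (λ i → Finₚ.all? (λ j → f (pair i j) Fin.≟ f (pair j i)))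
    ... | no  n = no λ (s , _) → n s
    ... | yes s with gallai? (colouring f s) ×-dec ¬? (hasMonoCycle? m (colouring f s))
    ...   | yes p = yes (s , p)
    ...   | no  n = no λ (_ , p) → n p

  -- Coded as functions on `Fin (N * N)`, the colourings form a finite search space, and the
  -- property fails exactly if one of them avoids the cycle. This makes the least N available
  -- constructively.
  arrows? : Dec (Arrows N k m)
  arrows? with search-functions (N * N) Avoids
    (λ {f} {g} e (s , p) → let s′ = λ i j → trans (sym (e _)) (trans (s i j) (e _)) in s′ , transport (colouring f s) (colouring g s′) (λ i j → e _) p) avoids?
  ... | yes (f , s , g , n) = no λ h → n (h (colouring f s) g)
  ... | no  none = yes λ c g → decidable-stable (hasMonoCycle? m c) λ n →
        let f : Fin (N * N) → Fin k
            f p = col c (proj₁ (Fin.remQuot {N} N p)) (proj₂ (Fin.remQuot {N} N p))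
            e : ∀ i j → f (pair i j) ≡ col c i j
            e i j = cong (λ z → col c (proj₁ z) (proj₂ z)) (Finₚ.remQuot-combine {N} i j)
            s : Symmetric f
            s i j = trans (e i j) (trans (col-sym c i j) (sym (e j i)))
        in none (f , s , transport c (colouring f s) (λ i j → sym (e i j)) (g , n))

least : (P : ℕ → Set) → (∀ N → Dec (P N)) → ∀ f s → P (s + f) →
  Σ[ N ∈ ℕ ] (s ≤ N × N ≤ s + f × P N × (∀ M → s ≤ M → P M → N ≤ M))
least P P? f s p with P? s
... | yes ps = s , ≤-refl , m≤m+n s f , ps , λ M h _ → h
least P P? zero    s p | no n = ⊥-elim (n (subst P (+-identityʳ s) p))
least P P? (suc f) s p | no n with least P P? f (suc s) (subst P (+-suc s f) p)
... | N , sN , N≤ , pN , low = N , <⇒≤ sN , ≤-trans N≤ (≤-reflexive (sym (+-suc s f))) , pN , low′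
  where
  low′ : ∀ M → s ≤ M → P M → N ≤ M
  low′ M h pM with m≤n⇒m<n∨m≡n h
  ... | inj₁ lt   = low M lt pM
  ... | inj₂ refl = ⊥-elim (n pM)

-- The extremal colouring and the lower bound

⊔-repeats : ∀ x y z → (x ⊔ y ≡ y ⊔ z) ⊎ (y ⊔ z ≡ x ⊔ z) ⊎ (x ⊔ y ≡ x ⊔ z)
⊔-repeats x y z with ≤-total x y | ≤-total y z | ≤-total x z
... | inj₁ a | inj₁ b | _      = inj₂ (inj₁ (trans (m≤n⇒m⊔n≡n b) (sym (m≤n⇒m⊔n≡n (≤-trans a b)))))
... | inj₁ a | inj₂ b | _      = inj₁ (trans (m≤n⇒m⊔n≡n a) (sym (m≥n⇒m⊔n≡m b)))
... | inj₂ a | _      | inj₁ b = inj₂ (inj₁ (trans (m≤n⇒m⊔n≡n (≤-trans a b)) (sym (m≤n⇒m⊔n≡n b))))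
... | inj₂ a | _      | inj₂ b = inj₂ (inj₂ (trans (m≥n⇒m⊔n≡m a) (sym (m≥n⇒m⊔n≡m b))))

-- The first 2n − 1 vertices have class 0 and later blocks of n − 1 = d vertices the classes 1, 2, …;
-- an edge receives the class of its larger end.
module Blocks (e k N : ℕ) (k≥1 : 1 ≤ k) (N≤ : N ≤ suc e * k + suc (suc e)) where

  private
    d n : ℕ
    d = suc e
    n = suc d

  cl : ℕ → ℕ
  -- Truncated subtraction puts all x < n + d = 2n - 1 into class 0; every later class has d = n - 1
  -- members.
  cl x = (x ∸ n) / d

  cl<k : ∀ {x} → x < N → cl x < k
  cl<k {x} h = m<n*o⇒m/o<n {n = k} {d} (m<n+o⇒m∸n<o x n {k * d} {{>-nonZero (*-mono-≤ k≥1 (s≤s (z≤n {e})))}}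
    (≤-trans h (≤-trans N≤ (≤-reflexive (trans (+-comm (d * k) n) (cong (n +_) (*-comm d k)))))))

  ⊔<N : ∀ (i j : Fin N) → toℕ i ⊔ toℕ j < N
  ⊔<N i j = ⊔-lub (Finₚ.toℕ<n i) (Finₚ.toℕ<n j)

  blocks : Colouring N k
  blocks = record
    { col = λ i j → fromℕ< (cl<k (⊔<N i j))
    ; sym = λ i j → Finₚ.fromℕ<-cong _ _ (cong cl (⊔-comm (toℕ i) (toℕ j))) (cl<k (⊔<N i j)) (cl<k (⊔<N j i)) }

  -- The largest vertex of a triangle decides the colour of two of its edges.
  blocks-gallai : Gallai blocks
  blocks-gallai (x , y , z , _ , _ , _ , a , b , d) with ⊔-repeats (toℕ x) (toℕ y) (toℕ z)
  ... | inj₁ h        = a (Finₚ.fromℕ<-cong _ _ (cong cl h) _ _)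
  ... | inj₂ (inj₁ h) = b (Finₚ.fromℕ<-cong _ _ (cong cl h) _ _)
  ... | inj₂ (inj₂ h) = d (Finₚ.fromℕ<-cong _ _ (cong cl h) _ _)

  module _ (v : Fin (2 * n) → Fin N) (inj : Injective _≡_ _≡_ v) where

    same-vertex : ∀ {i j} → toℕ (v i) ≡ toℕ (v j) → toℕ i ≡ toℕ j
    same-vertex q = cong toℕ (inj (Finₚ.toℕ-injective q))

    next : ∀ i → Σ[ j ∈ Fin (2 * n) ] CycleAdj (2 * n) i j
    next i with suc (toℕ i) <? 2 * n
    ... | yes p = fromℕ< p , inj₁ (sym (Finₚ.toℕ-fromℕ< p))
    ... | no  q = Fin.zero , inj₂ (≤-antisym (Finₚ.toℕ<n i) (≮⇒≥ q) , refl)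

    -- One cycle edge at each vertex already shows that all 2n vertices are among the first 2n - 1.
    no-zero-cycle : (∀ i j → CycleAdj (2 * n) i j → cl (toℕ (v i) ⊔ toℕ (v j)) ≡ 0) → ⊥
    no-zero-cycle h = collide (Finₚ.pigeonhole {n + d} {2 * n} (≤-reflexive (trans (sym (+-suc n d)) (cong (n +_) (sym (+-identityʳ n))))) (λ i → fromℕ< (below i)))
      where
      below : ∀ i → toℕ (v i) < n + d
      below i = ≤-trans (s≤s (≤-trans (m≤m⊔n _ (toℕ (v j))) (m≤n+m∸n _ n)))
        (≤-trans (≤-reflexive (sym (+-suc n _))) (+-monoʳ-≤ n (m/n≡0⇒m<n (h i j (proj₂ (next i))))))
        where
        j = proj₁ (next i)
      collide : Σ[ i ∈ Fin (2 * n) ] Σ[ j ∈ Fin (2 * n) ] (i Fin.< j × fromℕ< (below i) ≡ fromℕ< (below j)) → ⊥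
      collide (i , j , lt , q) = <⇒≢ lt (same-vertex (Finₚ.fromℕ<-injective _ _ (below i) (below j) q))

    left right : Fin n → Fin (2 * n)
    left  i = fromℕ< (*-monoʳ-< 2 (Finₚ.toℕ<n i))
    right i = fromℕ< (≤-trans (≤-reflexive (sym (*-suc 2 (toℕ i)))) (*-monoʳ-≤ 2 (Finₚ.toℕ<n i)))

    top : Fin n → ℕ
    top i = toℕ (v (left i)) ⊔ toℕ (v (right i))

    left≡ : ∀ i → toℕ (left i) ≡ 2 * toℕ i
    left≡ i = Finₚ.toℕ-fromℕ< (*-monoʳ-< 2 (Finₚ.toℕ<n i))

    right≡ : ∀ i → toℕ (right i) ≡ suc (2 * toℕ i)
    right≡ i = Finₚ.toℕ-fromℕ< (≤-trans (≤-reflexive (sym (*-suc 2 (toℕ i)))) (*-monoʳ-≤ 2 (Finₚ.toℕ<n i)))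

    -- Equal larger ends are one vertex, hence one position of the cycle, and the positions 2i and
    -- 2i + 1 belong to a single i.
    top-injective : ∀ i j → top i ≡ top j → toℕ i ≡ toℕ j
    top-injective i j q with ⊔-sel (toℕ (v (left i))) (toℕ (v (right i))) | ⊔-sel (toℕ (v (left j))) (toℕ (v (right j)))
    ... | inj₁ a | inj₁ b = *-cancelˡ-≡ _ _ 2 (trans (sym (left≡ i)) (trans (same-vertex (trans (sym a) (trans q b))) (left≡ j)))
    ... | inj₁ a | inj₂ b = ⊥-elim (even≢odd (toℕ i) (toℕ j) (trans (sym (left≡ i)) (trans (same-vertex (trans (sym a) (trans q b))) (right≡ j))))
    ... | inj₂ a | inj₁ b = ⊥-elim (even≢odd (toℕ j) (toℕ i) (trans (sym (left≡ j)) (trans (sym (same-vertex (trans (sym a) (trans q b)))) (right≡ i))))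
    ... | inj₂ a | inj₂ b = *-cancelˡ-≡ _ _ 2 (suc-injective (trans (sym (right≡ i)) (trans (same-vertex (trans (sym a) (trans q b))) (right≡ j))))

    -- The larger ends of n disjoint edges would be n members of one block.
    no-later-cycle : ∀ r → (∀ i → cl (top i) ≡ suc r) → ⊥
    no-later-cycle r h with Finₚ.pigeonhole {d} {n} ≤-refl (λ i → fromℕ< (m%n<n (top i ∸ n) d))
    ... | i , j , lt , q = <⇒≢ lt (top-injective i j (begin
      top i                 ≡⟨ sym (m+[n∸m]≡n (late i)) ⟩
      n + (top i ∸ n)       ≡⟨ cong (n +_) (trans (m≡m%n+[m/n]*n (top i ∸ n) d) (trans (cong₂ (λ a b → a + b * d) rem (trans (h i) (sym (h j)))) (sym (m≡m%n+[m/n]*n (top j ∸ n) d)))) ⟩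
      n + (top j ∸ n)       ≡⟨ m+[n∸m]≡n (late j) ⟩
      top j                 ∎))
      where
      open ≡-Reasoning
      rem : (top i ∸ n) % d ≡ (top j ∸ n) % d
      rem = Finₚ.fromℕ<-injective _ _ (m%n<n (top i ∸ n) d) (m%n<n (top j ∸ n) d) q
      late : ∀ i → n ≤ top i
      late i with n ≤? top i
      ... | yes p = p
      ... | no  m = case trans (sym (h i)) (trans (cong (_/ d) (m≤n⇒m∸n≡0 (<⇒≤ (≰⇒> m)))) (0/n≡0 d)) of λ ()

  blocks-no-cycle : ¬ HasMonoCycle (2 * n) blocks
  blocks-no-cycle (v , inj , r , h) = split (toℕ r) λ i j a → trans (sym (Finₚ.toℕ-fromℕ< _)) (cong toℕ (h i j a))
    where
    split : ∀ r → (∀ i j → CycleAdj (2 * n) i j → cl (toℕ (v i) ⊔ toℕ (v j)) ≡ r) → ⊥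
    split zero    h = no-zero-cycle v inj h
    split (suc r) h = no-later-cycle v inj r λ i → h (left v inj i) (right v inj i)
      (inj₁ (trans (cong suc (left≡ v inj i)) (sym (right≡ v inj i))))

theorem1p9 : (k n : ℕ) → 1 ≤ k → 3 ≤ n →
  Σ ℕ λ N → IsGRCycle k (2 * n) N ×
    ((n ∸ 1) * k + n + 1 ≤ N) × (N ≤ (n ∸ 1) * k + 2 * n + 2)
theorem1p9 k (suc zero) k≥1 (s≤s ())
-- The search for the least N starts at 1, so the upper bound is split as 1 plus the number of
-- further candidates.
theorem1p9 k n@(suc d@(suc e)) k≥1 n≥3 = finish (least (λ N → Arrows N k (2 * n)) (λ N → arrows? N k (2 * n)) (d * k + 2 * n + 1) 1
    (subst (λ N → Arrows N k (2 * n)) (+-suc (d * k + 2 * n) 1) upper))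
  where
  upper : Arrows (d * k + 2 * n + 2) k (2 * n)
  upper c g = decidable-stable (hasMonoCycle? (2 * n) c) λ none → Upper.upper⊥ c g d (s≤s z≤n)
    (λ i zs l u cy → none (cycle⇒mono c i zs (trans l (cong (n +_) (sym (+-identityʳ n)))) u cy))
    (trans (+-assoc (d * k) (2 * n) 2) (cong (λ z → d * k + (n + z + 2)) (+-identityʳ n)))
  lower : ∀ {N} → Arrows N k (2 * n) → d * k + n + 1 ≤ N
  lower {N} ar with d * k + n + 1 ≤? N
  ... | yes p = p
  ... | no  m = ⊥-elim (Blocks.blocks-no-cycle e k N k≥1 N≤ (ar (Blocks.blocks e k N k≥1 N≤) (Blocks.blocks-gallai e k N k≥1 N≤)))
    where
    N≤ : N ≤ d * k + n
    N≤ = s≤s⁻¹ (subst (suc N ≤_) (+-comm (d * k + n) 1) (≰⇒> m))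
  finish : (Σ[ N ∈ ℕ ] (1 ≤ N × N ≤ suc (d * k + 2 * n + 1) × Arrows N k (2 * n) × (∀ M → 1 ≤ M → Arrows M k (2 * n) → N ≤ M))) →
    Σ ℕ λ N → IsGRCycle k (2 * n) N × (d * k + n + 1 ≤ N) × (N ≤ d * k + 2 * n + 2)
  finish (N , N≥1 , N≤ , ar , low) = N , (N≥1 , ar , low) , lower ar , subst (N ≤_) (sym (+-suc (d * k + 2 * n) 1)) N≤
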